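{- Let $k\geq 3$ be odd. If there is $\epsilon>0$ such that we can count the number of witnesses for $k$-SUM in time $O(n^{\lceil k/2\rceil-\epsilon})$, then for every problem $P$ in $\mathsf{FOP}_{\mathbb{Z}}(\exists^k)$ there is some $\epsilon'>0$ such that we can count the number of witnesses for $P$ in time $O(n^{\lceil k/2\rceil-\epsilon'})$.
   Context: Counting witnesses for $k$-SUM: given sets $A_1,\dots,A_k$ of at most $n$ integers each and a target $t$, compute the number of tuples $(a_1,\dots,a_k)\in A_1\times\dots\times A_k$ with $a_1+\dots+a_k=t$. Model-checking problems: let $x_1=(x_1[1],\dots,x_1[d_1]),\dots,x_k=(x_k[1],\dots,x_k[d_k])$ be vectors of quantified variables, $t_1,\dots,t_l$ free variables, and $\psi$ a quantifier-free linear integer arithmetic formula (Boolean combination of linear equalities and inequalities with fixed integer coefficients) over the variables $x_i[j]$ and $t_1,\dots,t_l$. For $\phi:=Q_1x_1\dots Q_kx_k:\psi$ with $Q_i\in\{\exists,\forall\}$, the problem $\mathsf{FOP}_{\mathbb{Z}}(\phi)$ is: given finite sets $A_1\subseteq\mathbb{Z}^{d_1},\dots,A_k\subseteq\mathbb{Z}^{d_k}$ and $\hat t_1,\dots,\hat t_l\in\mathbb{Z}$, decide whether $Q_1x_1\in A_1\dots Q_kx_k\in A_k:\psi[(t_1,\dots,t_l)\backslash(\hat t_1,\dots,\hat t_l)]$ holds, i.e. $\psi$ with each $t_i$ replaced by $\hat t_i$. The formula $\phi$ is fixed. $\mathsf{FOP}_{\mathbb{Z}}(\exists^k)$ is the class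 of all problems $\mathsf{FOP}_{\mathbb{Z}}(\phi)$ where $\phi$ has exactly $k$ quantifiers, all existential. A witness for such a problem on a given input is a tuple $(a_1,\dots,a_k)\in A_1\times\dots\times A_k$ satisfying $\psi[(t_1,\dots,t_l)\backslash(\hat t_1,\dots,\hat t_l)]$. Input size: $n:=\max_i|A_i|$. Throughout, all input numbers lie in a polynomially sized universe $\{ -U,\dots,U\}$ with $U\le n^{c}$ for some constant $c$. -}

module Defs where

open import Data.Bool using (Bool; if_then_else_; _∧_)
open import Data.Fin using (Fin; zero; suc)
open import Data.Fin.Properties using (∀-cons)
open import Data.Integer as ℤ using (ℤ; +_; -[1+_]; 0ℤ; 1ℤ; ∣_∣)
import Data.Integer.Properties as ℤ
open import Data.List as List using (List; []; _∷_; _++_; [_])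
open import Data.List.Relation.Unary.All using (All)
open import Data.List.Relation.Unary.Unique.Propositional using (Unique)
open import Data.Nat as ℕ using (ℕ; zero; suc; _+_; _*_; _^_; _⊔_; _≤_)
open import Data.Product using (_×_; ∃-syntax)
open import Data.Rational using (ℚ; ↥_; ↧ₙ_)
open import Data.Sum using (_⊎_)
open import Data.Vec as Vec using (Vec; []; _∷_)
import Data.Vec.Functional as Vector
open import Relation.Binary.PropositionalEquality using (_≡_; _≢_)
open import Relation.Nullary using (¬_; Dec; does; ¬?; _×-dec_; _⊎-dec_)

-- Programs are structured rather than lists of jump instructions, and the
-- memory consists of arrays. A program mentions only finitely many arrays, so
-- interleaving them in one memory changes running times by a constant factor.
-- A scalar variable is a fixed cell of an array.

Array : Set
Array = ℕ

Memory : Set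
Memory = Array → ℤ → ℤ

_[_,_]≔_ : Memory → Array → ℤ → ℤ → Memory
(m [ a , i ]≔ v) b j =
  if does (a ℕ.≟ b) ∧ does (i ℤ.≟ j) then v else m b j

data Op : Set where
  add sub mul div less equal : Op

data Expr : Set where
  lit  : ℤ → Expr
  read : Array → Expr → Expr
  op   : Op → Expr → Expr → Expr

data Program : Set where
  skip   : Program
  store  : Array → Expr → Expr → Program
  _⨾_    : Program → Program → Program
  ifz    : Expr → Program → Program → Program
  while  : Expr → Program → Program

infixr 5 _⨾_

truth : Bool → ℤ
truth b = if b then 1ℤ else 0ℤ

-- The remainder of an integer division is non-negative, and x div 0 is 0.
divide : ℤ → ℤ → ℤ
divide x (+ zero)    = 0ℤ
divide x (+ (suc n)) = x ℤ./ (+ (suc n))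
divide x (-[1+ n ])  = x ℤ./ -[1+ n ]

⟦_⟧ᵒ : Op → ℤ → ℤ → ℤ
⟦ add ⟧ᵒ   x y = x ℤ.+ y
⟦ sub ⟧ᵒ   x y = x ℤ.- y
⟦ mul ⟧ᵒ   x y = x ℤ.* y
⟦ div ⟧ᵒ   x y = divide x y
⟦ less ⟧ᵒ  x y = truth (does (x ℤ.<? y))
⟦ equal ⟧ᵒ x y = truth (does (x ℤ.≟ y))

eval : Expr → Memory → ℤ
eval (lit z)    m = z
eval (read a e) m = m a (eval e m)
eval (op o e f) m = ⟦ o ⟧ᵒ (eval e m) (eval f m)

-- Every value arising in the evaluation is a word, i.e. lies in {-B,…,B}.
Fits : ℕ → Expr → Memory → Set
Fits B e@(lit _)    m = ∣ eval e m ∣ ≤ B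
Fits B e@(read _ f) m = ∣ eval e m ∣ ≤ B × Fits B f m
Fits B e@(op _ f g) m = ∣ eval e m ∣ ≤ B × Fits B f m × Fits B g m

-- Run B p m t m′ : with words bounded by B, program p started in memory m
-- halts after t steps in memory m′. A run that overflows a word is stuck.
-- One step evaluates the boundedly many expression nodes of one statement.
data Run (B : ℕ) : Program → Memory → ℕ → Memory → Set where
  skip : ∀ {m} → Run B skip m 1 m
  store : ∀ {a e f m} → Fits B e m → Fits B f m →
          Run B (store a e f) m 1 (m [ a , eval e m ]≔ eval f m)
  _⨾_ : ∀ {p q m m′ m″ s t} → Run B p m s m′ → Run B q m′ t m″ →
        Run B (p ⨾ q) m (s + t) m″
  ifz-zero : ∀ {e p q m m′ t} → Fits B e m → eval e m ≡ 0ℤ →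
             Run B p m t m′ → Run B (ifz e p q) m (suc t) m′
  ifz-nonzero : ∀ {e p q m m′ t} → Fits B e m → eval e m ≢ 0ℤ →
                Run B q m t m′ → Run B (ifz e p q) m (suc t) m′
  while-stop : ∀ {e p m} → Fits B e m → eval e m ≡ 0ℤ →
               Run B (while e p) m 1 m
  while-step : ∀ {e p m m′ m″ s t} → Fits B e m → eval e m ≢ 0ℤ →
               Run B p m s m′ → Run B (while e p) m′ t m″ →
               Run B (while e p) m (suc (s + t)) m″

inputArray outputArray : Array
inputArray  = 0
outputArray = 1

nth : List ℤ → ℕ → ℤ
nth []       _       = 0ℤ
nth (x ∷ _)  zero    = x
nth (_ ∷ xs) (suc i) = nth xs i

initial : List ℤ → Memory
initial xs zero    (+ i)    = nth xs i
initial xs zero    -[1+ _ ] = 0ℤ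
initial xs (suc _) _        = 0ℤ

output : Memory → ℤ
output m = m outputArray 0ℤ

choices : ∀ {k} {X : Fin k → Set} → (∀ i → List (X i)) → List (∀ i → X i)
choices {zero}      A = [ (λ ()) ]
choices {suc k} {X} A =
  List.cartesianProductWith (∀-cons {P = X}) (A zero) (choices (λ i → A (suc i)))

-- An instance consists of finite sets A i ⊆ X i and parameters t₁,…,tₗ.
record WitnessProblem (k : ℕ) : Set₁ where
  field
    X        : Fin k → Set
    entries  : ∀ {i} → X i → List ℤ
    l        : ℕ
    Witness  : (∀ i → X i) → Vec ℤ l → Set
    witness? : ∀ a t → Dec (Witness a t)

  record Instance : Set where
    field
      set    : ∀ i → List (X i)
      unique : ∀ i → Unique (set i)
      params : Vec ℤ l

    size : ℕ
    size = Vector.foldr _⊔_ 0 (λ i → List.length (set i))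

    numbers : List ℤ
    numbers = List.concat (List.tabulate λ i → List.concatMap entries (set i))
              ++ Vec.toList params

    encoding : List ℤ
    encoding = List.concat (List.tabulate λ i →
                 + List.length (set i) ∷ List.concatMap entries (set i))
               ++ Vec.toList params

    InUniverse : ℕ → Set
    InUniverse U = All (λ z → ∣ z ∣ ≤ U) numbers

    #witnesses : ℕ
    #witnesses = List.length
      (List.filter (λ a → witness? a params) (choices set))

-- T ≤ C · n ^ (h - ε), with the negative and fractional powers cleared.
Bound : (T C n h : ℕ) (ε : ℚ) → Set
Bound T C n h ε =
  T ^ (↧ₙ ε) * n ^ ∣ ↥ ε ∣ ≤ C * n ^ (h * ↧ₙ ε)

-- Counting in time O(n ^ (h - ε)), for ε > 0. The exponent c of the universe
-- is a constant of the problem: the program and the constants may depend on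
-- it, the exponent of the running time may not. Words have O(log n) bits:
-- they range over {-B,…,B} for B = (2 + n) ^ w with w constant.
CountableInTime : ∀ {k} → WitnessProblem k → (h : ℕ) (ε : ℚ) → Set
CountableInTime P h ε =
  ∀ (c : ℕ) →
  ∃[ p ] ∃[ w ] ∃[ C ] ∃[ n₀ ]
  ∀ (I : WitnessProblem.Instance P) → let open WitnessProblem.Instance I in
  InUniverse (size ^ c) →
  ∃[ T ] ∃[ m ]
    Run ((2 + size) ^ w) p (initial encoding) T m ×
    output m ≡ + #witnesses ×
    (n₀ ≤ size → Bound T C size h ε)

sumℤ : ∀ {k} → (Fin k → ℤ) → ℤ
sumℤ = Vector.foldr ℤ._+_ 0ℤ

kSUM : (k : ℕ) → WitnessProblem k
kSUM k = record
  { X        = λ _ → ℤ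
  ; entries  = [_]
  ; l        = 1
  ; Witness  = λ a t → sumℤ a ≡ Vec.head t
  ; witness? = λ a t → sumℤ a ℤ.≟ Vec.head t
  }

data Comparison : Set where
  eq le lt ge gt : Comparison

⟦_⟧ᶜ : Comparison → ℤ → ℤ → Set
⟦ eq ⟧ᶜ x y = x ≡ y
⟦ le ⟧ᶜ x y = x ℤ.≤ y
⟦ lt ⟧ᶜ x y = x ℤ.< y
⟦ ge ⟧ᶜ x y = x ℤ.≥ y
⟦ gt ⟧ᶜ x y = x ℤ.> y

compare? : ∀ r x y → Dec (⟦ r ⟧ᶜ x y)
compare? eq x y = x ℤ.≟ y
compare? le x y = x ℤ.≤? y
compare? lt x y = x ℤ.<? y
compare? ge x y = y ℤ.≤? x
compare? gt x y = y ℤ.<? x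

dot : ∀ {n} → Vec ℤ n → Vec ℤ n → ℤ
dot u v = Vec.foldr′ ℤ._+_ 0ℤ (Vec.zipWith ℤ._*_ u v)

module _ {k : ℕ} (d : Fin k → ℕ) (l : ℕ) where

  Point : Set
  Point = ∀ i → Vec ℤ (d i)

  -- linear α β r γ is the atom  Σᵢ αᵢ · xᵢ + β · t  r  γ.
  data Formula : Set where
    linear      : Point → Vec ℤ l → Comparison → ℤ → Formula
    not         : Formula → Formula
    _and_ _or_  : Formula → Formula → Formula

module _ {k : ℕ} {d : Fin k → ℕ} {l : ℕ} where

  Satisfies : Formula d l → Point d l → Vec ℤ l → Set
  Satisfies (linear α β r γ) x t =
    ⟦ r ⟧ᶜ (sumℤ (λ i → dot (α i) (x i)) ℤ.+ dot β t) γ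
  Satisfies (not ψ)   x t = ¬ Satisfies ψ x t
  Satisfies (ψ and χ) x t = Satisfies ψ x t × Satisfies χ x t
  Satisfies (ψ or χ)  x t = Satisfies ψ x t ⊎ Satisfies χ x t

  satisfies? : ∀ ψ x t → Dec (Satisfies ψ x t)
  satisfies? (linear α β r γ) x t =
    compare? r (sumℤ (λ i → dot (α i) (x i)) ℤ.+ dot β t) γ
  satisfies? (not ψ)   x t = ¬? (satisfies? ψ x t)
  satisfies? (ψ and χ) x t = satisfies? ψ x t ×-dec satisfies? χ x t
  satisfies? (ψ or χ)  x t = satisfies? ψ x t ⊎-dec satisfies? χ x t

-- The formula ∃x₁ … ∃xₖ : ψ.
record ∃Formula (k : ℕ) : Set where
  field
    d : Fin k → ℕ
    l : ℕ
    ψ : Formula d l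

FOPℤ : ∀ {k} → ∃Formula k → WitnessProblem k
FOPℤ φ = record
  { X        = λ i → Vec ℤ (d i)
  ; entries  = Vec.toList
  ; l        = l
  ; Witness  = Satisfies ψ
  ; witness? = satisfies? ψ
  }
  where open ∃Formula φ

{-# OPTIONS --safe #-}
module Submission where

-- A linear atom compares ∑ᵢ uᵢ with a threshold τ, where all numbers can be made
-- non-negative and less than 2 ^ R with R = O(log n). Halving all of them again and
-- again, with rounding, the difference of the two sides shrinks until it is smaller
-- than k in absolute value. The last level at which it is at least k (or level 0)
-- determines the outcome of the comparison, and given that level the difference
-- takes O(k) values on it and on the next one. Hence the witnesses are classified by
-- polylogarithmically many certificates, one level and two differences per atom, and
-- a certificate is a conjunction of linear equations, which one k-SUM equation in
-- radix Y expresses.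
--
-- Different vectors may yield the same number, but k-SUM takes sets. The numbers
-- whose multiplicity has bit b set form a set of weight 2 ^ b, so summing over all
-- k-tuples of bits counts with multiplicity. Since the sizes of these sets vary, they
-- are padded to a common size N by numbers too large to occur in a solution.
--
-- The program makes one call for every certificate and tuple of bits, which are the
-- digits of the number of the call in radix R. Every call runs in a window of fresh
-- memory of its own.

open import Defs
open import Data.Bool as Bool using (Bool; true; false; if_then_else_; _∧_; _∨_)
open import Data.Bool.Properties using (∧-zeroʳ)
open import Data.Fin using (Fin; zero; suc)
open import Data.Integer as ℤ using (ℤ; +_; -[1+_]; 0ℤ; 1ℤ; ∣_∣)
import Data.Integer.Properties as ℤ
open import Data.List as List
  using (List; []; _∷_; _++_; map; downFrom; cartesianProductWith; foldl; length; filter; concatMap; concat; tabulate)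
open import Data.List.Membership.Propositional using (_∈_)
open import Data.List.Membership.Propositional.Properties using (∈-downFrom⁻; ∈-cartesianProductWith⁻; ∈-map⁺)
open import Data.List.Properties
  using (tabulate-cong; concat-map-[_]; ++-assoc; ++-identityʳ; length-++; length-map; length-filter)
open import Data.List.Relation.Unary.All as All using (All; []; _∷_)
import Data.List.Relation.Unary.All.Properties as All
open import Data.List.Relation.Unary.AllPairs using ([]; _∷_)
open import Data.List.Relation.Unary.Any using (here; there)
open import Data.List.Relation.Unary.Unique.Propositional using (Unique)
import Data.List.Relation.Unary.Unique.Propositional.Properties as Unique
open import Data.Nat
open import Data.Nat.Coprimality using (1-coprimeTo)
open import Data.Nat.DivMod hiding (_mod_; _div_)
open import Data.Nat.Divisibility using (_∤_)
open import Data.Nat.Properties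
open import Data.Nat.Solver using (module +-*-Solver)
open import Data.Product using (_×_; _,_; ∃-syntax; proj₁; proj₂)
open import Data.Rational as ℚ using (ℚ; mkℚ; 0ℚ; ↥_; ↧ₙ_)
open import Data.Sum using (_⊎_; inj₁; inj₂)
open import Data.Unit using (⊤; tt)
open import Data.Vec as Vec using (Vec; []; _∷_)
import Data.Vec.Functional as Vector
import Data.Vec.Properties as Vec
open import Function using (_∘_; id; mk⇔)
open import Relation.Binary using (tri<; tri≈; tri>)
open import Relation.Binary.PropositionalEquality
open import Relation.Nullary using (¬_; Dec; does; yes; no; contradiction)
open import Relation.Nullary.Decidable using (dec-true; dec-false; does-⇔)
open import Algebra.Properties.CommutativeSemigroup +-commutativeSemigroup using (interchange)
open import Algebra.Properties.CommutativeSemigroup ℤ.+-commutativeSemigroup using ()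
  renaming (interchange to ℤ-interchange)
import Algebra.Properties.AbelianGroup ℤ.+-0-abelianGroup as ℤ+
open +-*-Solver using (solve; _:=_; _:+_; _:*_; con)

-- Finite sums

-- Levels are needed because a `k`-SUM call tests equalities only. Rounding spoils additivity, but
-- only by at most `k` from one level to the next: a difference of at least `k` survives on the
-- finer level, so its sign persists down to level 0, and a difference below `k` grows to at most
-- `3k`. Each tuple thus satisfies the equations of exactly one valid certificate, and no tuple is
-- counted twice. Padding is forced by the hypothesis, which bounds the time only for sizes from
-- some `n₀` on and admits only numbers polynomial in the size: a call on a few large numbers would
-- be outside of it. Addresses of the called program are words, hence at most a power of `N`. A
-- window of polynomial length contains all the cells it can write, the next window is still zero,
-- and nothing has to be cleared between calls. With `m` atoms there are `R ^ (3m + k)` calls. Every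
-- fixed power of `R` is `O(N)`, so their number costs only a part of the saving; writing an
-- instance takes linear time, which is affordable because `⌈ k /2⌉ ≥ 2`.

∑ : {A : Set} → List A → (A → ℕ) → ℕ
∑ []       f = 0
∑ (x ∷ xs) f = f x + ∑ xs f

∑< : ℕ → (ℕ → ℕ) → ℕ
∑< n = ∑ (downFrom n)

∑-cong∈ : ∀ {A : Set} (xs : List A) {f g : A → ℕ} →
          (∀ {x} → x ∈ xs → f x ≡ g x) → ∑ xs f ≡ ∑ xs g
∑-cong∈ []       f≗g = refl
∑-cong∈ (x ∷ xs) f≗g = cong₂ _+_ (f≗g (here refl)) (∑-cong∈ xs (f≗g ∘ there))

∑-cong : ∀ {A : Set} (xs : List A) {f g : A → ℕ} →
         (∀ x → f x ≡ g x) → ∑ xs f ≡ ∑ xs g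
∑-cong xs f≗g = ∑-cong∈ xs (λ {x} _ → f≗g x)

∑<-cong : ∀ n {f g : ℕ → ℕ} → (∀ i → i < n → f i ≡ g i) → ∑< n f ≡ ∑< n g
∑<-cong n f≗g = ∑-cong∈ (downFrom n) (λ i∈ → f≗g _ (∈-downFrom⁻ i∈))

∑-zero : ∀ {A : Set} (xs : List A) → ∑ xs (λ _ → 0) ≡ 0
∑-zero []       = refl
∑-zero (x ∷ xs) = ∑-zero xs

∑-+ : ∀ {A : Set} (xs : List A) (f g : A → ℕ) →
      ∑ xs (λ x → f x + g x) ≡ ∑ xs f + ∑ xs g
∑-+ []       f g = refl
∑-+ (x ∷ xs) f g =
  trans (cong (_+_ (f x + g x)) (∑-+ xs f g)) (interchange (f x) (g x) (∑ xs f) (∑ xs g))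

*-∑ : ∀ {A : Set} c (xs : List A) (f : A → ℕ) → c * ∑ xs f ≡ ∑ xs (λ x → c * f x)
*-∑ c []       f = *-zeroʳ c
*-∑ c (x ∷ xs) f = trans (*-distribˡ-+ c (f x) (∑ xs f)) (cong (_+_ (c * f x)) (*-∑ c xs f))

∑-* : ∀ {A : Set} c (xs : List A) (f : A → ℕ) → ∑ xs f * c ≡ ∑ xs (λ x → f x * c)
∑-* c xs f = trans (*-comm (∑ xs f) c)
  (trans (*-∑ c xs f) (∑-cong xs (λ x → *-comm c (f x))))

∑-swap : ∀ {A B : Set} (xs : List A) (ys : List B) (f : A → B → ℕ) →
         ∑ xs (λ x → ∑ ys (f x)) ≡ ∑ ys (λ y → ∑ xs (λ x → f x y))
∑-swap []       ys f = sym (∑-zero ys)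
∑-swap (x ∷ xs) ys f =
  trans (cong (_+_ (∑ ys (f x))) (∑-swap xs ys f))
        (sym (∑-+ ys (f x) (λ y → ∑ xs (λ z → f z y))))

∑-++ : ∀ {A : Set} (xs ys : List A) (f : A → ℕ) → ∑ (xs ++ ys) f ≡ ∑ xs f + ∑ ys f
∑-++ []       ys f = refl
∑-++ (x ∷ xs) ys f =
  trans (cong (_+_ (f x)) (∑-++ xs ys f)) (sym (+-assoc (f x) (∑ xs f) (∑ ys f)))

∑-map : ∀ {A B : Set} (g : A → B) (xs : List A) (f : B → ℕ) →
        ∑ (map g xs) f ≡ ∑ xs (f ∘ g)
∑-map g []       f = refl
∑-map g (x ∷ xs) f = cong (_+_ (f (g x))) (∑-map g xs f)

∑-product : ∀ {A B C : Set} (g : A → B → C) (xs : List A) (ys : List B) (f : C → ℕ) →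
            ∑ (cartesianProductWith g xs ys) f ≡ ∑ xs (λ x → ∑ ys (λ y → f (g x y)))
∑-product g []       ys f = refl
∑-product g (x ∷ xs) ys f =
  trans (∑-++ (map (g x) ys) (cartesianProductWith g xs ys) f)
        (cong₂ _+_ (∑-map (g x) ys f) (∑-product g xs ys f))

∑<-split : ∀ m n (f : ℕ → ℕ) → ∑< (m + n) f ≡ ∑< m (λ i → f (i + n)) + ∑< n f
∑<-split zero    n f = refl
∑<-split (suc m) n f =
  trans (cong (_+_ (f (m + n))) (∑<-split m n f))
        (sym (+-assoc (f (m + n)) (∑< m (λ i → f (i + n))) (∑< n f)))

∑<-radix : ∀ n r (f : ℕ → ℕ) →
           ∑< (n * r) f ≡ ∑< r (λ c → ∑< n (λ q → f (c + q * r)))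
∑<-radix zero    r f = sym (∑-zero (downFrom r))
∑<-radix (suc n) r f = begin
  ∑< (r + n * r) f
    ≡⟨ ∑<-split r (n * r) f ⟩
  ∑< r (λ c → f (c + n * r)) + ∑< (n * r) f
    ≡⟨ cong (_+_ (∑< r (λ c → f (c + n * r)))) (∑<-radix n r f) ⟩
  ∑< r (λ c → f (c + n * r)) + ∑< r (λ c → ∑< n (λ q → f (c + q * r)))
    ≡⟨ ∑-+ (downFrom r) (λ c → f (c + n * r)) (λ c → ∑< n (λ q → f (c + q * r))) ⟨
  ∑< r (λ c → ∑< (suc n) (λ q → f (c + q * r))) ∎
  where open ≡-Reasoning

indicator : Bool → ℕ
indicator b = if b then 1 else 0

-- Pairs the value of the Boolean test, which reduces an `if`, with the proposition that it decides,
-- so that one case split yields both.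
data Comparable (v x : ℕ) : Set where
  same  : (v ≡ᵇ x) ≡ true → v ≡ x → Comparable v x
  other : (v ≡ᵇ x) ≡ false → v ≢ x → Comparable v x

compare≡ : ∀ v x → Comparable v x
compare≡ v x with v ≟ x
... | yes v≡x = same (dec-true (v ≟ x) v≡x) v≡x
... | no v≢x  = other (dec-false (v ≟ x) v≢x) v≢x

∑<-indicator : ∀ n i (f : ℕ → ℕ) → i < n →
               ∑< n (λ j → indicator (does (i ≟ j)) * f j) ≡ f i
∑<-indicator (suc n) i f (s≤s i≤n) with compare≡ i n
... | same e≡ refl rewrite e≡ = begin
  f n + 0 + ∑< n (λ j → indicator (does (n ≟ j)) * f j)
    ≡⟨ cong₂ _+_ (+-identityʳ (f n)) (trans (∑<-cong n vanish) (∑-zero (downFrom n))) ⟩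
  f n + 0
    ≡⟨ +-identityʳ (f n) ⟩
  f n ∎
  where
  open ≡-Reasoning
  vanish : ∀ j → j < n → indicator (does (n ≟ j)) * f j ≡ 0
  vanish j j<n with compare≡ n j
  ... | same _ refl           = contradiction j<n (<-irrefl refl)
  ... | other e≡′ _ rewrite e≡′ = refl
... | other e≡ i≢n rewrite e≡ = ∑<-indicator n i f (≤∧≢⇒< i≤n i≢n)

-- Digits

module _ (R : ℕ) .{{_ : NonZero R}} where

  digits : ∀ D → ℕ → Vec ℕ D
  digits zero    q = []
  digits (suc D) q = q % R ∷ digits D (q / R)

  dropDigits : ℕ → ℕ → ℕ
  dropDigits zero    q = q
  dropDigits (suc D) q = dropDigits D (q / R)

allDigits : ℕ → ∀ D → List (Vec ℕ D)
allDigits R zero    = [] ∷ []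
allDigits R (suc D) = cartesianProductWith _∷_ (downFrom R) (allDigits R D)

-- The least significant digit comes off by `∑<-radix`, which writes an index as `c + q * R`; as
-- `c < R`, remainder and quotient give back `c` and `q`.
∑<-digits : ∀ R .{{_ : NonZero R}} D Q (F : Vec ℕ D → ℕ → ℕ) →
            ∑< (R ^ D * Q) (λ q → F (digits R D q) (dropDigits R D q))
            ≡ ∑ (allDigits R D) (λ v → ∑< Q (F v))
∑<-digits R zero    Q F = trans (cong (λ n → ∑< n (F [])) (+-identityʳ Q))
                                (sym (+-identityʳ (∑< Q (F []))))
∑<-digits R (suc D) Q F = begin
  ∑< (R * R ^ D * Q) G
    ≡⟨ cong (λ n → ∑< n G) (trans (*-assoc R (R ^ D) Q) (*-comm R (R ^ D * Q))) ⟩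
  ∑< (R ^ D * Q * R) G
    ≡⟨ ∑<-radix (R ^ D * Q) R G ⟩
  ∑< R (λ c → ∑< (R ^ D * Q) (λ q → G (c + q * R)))
    ≡⟨ ∑<-cong R (λ c c<R → trans
         (∑<-cong (R ^ D * Q) (λ q _ → cong₂ (λ x y → F (x ∷ digits R D y) (dropDigits R D y))
            (trans ([m+kn]%n≡m%n c q R) (m<n⇒m%n≡m c<R)) (quotient c q c<R)))
         (∑<-digits R D Q (λ v → F (c ∷ v)))) ⟩
  ∑< R (λ c → ∑ (allDigits R D) (λ v → ∑< Q (F (c ∷ v))))
    ≡⟨ ∑-product _∷_ (downFrom R) (allDigits R D) (λ v → ∑< Q (F v)) ⟨
  ∑ (allDigits R (suc D)) (λ v → ∑< Q (F v)) ∎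
  where
  open ≡-Reasoning
  G : ℕ → ℕ
  G q = F (digits R (suc D) q) (dropDigits R (suc D) q)
  quotient : ∀ c q → c < R → (c + q * R) / R ≡ q
  quotient c q c<R = begin
    (c + q * R) / R      ≡⟨ +-distrib-/ c (q * R) (subst (_< R) (sym rem) c<R) ⟩
    c / R + (q * R) / R  ≡⟨ cong₂ _+_ (m<n⇒m/n≡0 c<R) (m*n/n≡m q R) ⟩
    q                    ∎
    where
    rem : c % R + (q * R) % R ≡ c
    rem = trans (cong₂ _+_ (m<n⇒m%n≡m c<R) (m*n%n≡0 q R)) (+-identityʳ c)

-- Sums over tuples

∑ᶠ : ∀ {k} → (Fin k → ℕ) → ℕ
∑ᶠ = Vector.foldr _+_ 0

-- The common form of both counting problems. It depends only on lists of numbers, repetitions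
-- included, so the tuples of vectors of a formula and the tuples of integers of `k`-SUM can be
-- compared through it.
convolve : ∀ {k} → (Fin k → List ℕ) → (ℕ → ℕ) → ℕ
convolve {zero}  A F = F 0
convolve {suc k} A F = ∑ (A zero) (λ y → convolve (A ∘ suc) (λ s → F (y + s)))

convolve-choices : ∀ {k} {X : Fin k → Set} (A : ∀ i → List (X i)) (f : ∀ i → X i → ℕ)
                   (F : ℕ → ℕ) →
                   ∑ (choices A) (λ a → F (∑ᶠ (λ i → f i (a i))))
                   ≡ convolve (λ i → map (f i) (A i)) F
convolve-choices {zero}  A f F = +-identityʳ (F 0)
convolve-choices {suc k} A f F =
  trans (∑-product _ (A zero) (choices (A ∘ suc)) _)
  (trans (∑-cong (A zero) (λ x →
            convolve-choices (A ∘ suc) (λ i → f (suc i)) (λ s → F (f zero x + s))))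
         (sym (∑-map (f zero) (A zero) _)))

convolve-kSUM : ∀ {k} (A : Fin k → List ℕ) (G : ℤ → ℕ) →
                ∑ (choices (λ i → map +_ (A i))) (λ a → G (sumℤ a)) ≡ convolve A (λ s → G (+ s))
convolve-kSUM {zero}  A G = +-identityʳ (G ℤ.0ℤ)
convolve-kSUM {suc k} A G =
  trans (∑-product _ (map +_ (A zero)) (choices (λ i → map +_ (A (suc i)))) _)
  (trans (∑-map +_ (A zero) _)
         (∑-cong (A zero) (λ x → convolve-kSUM (A ∘ suc) (λ s → G (+ x ℤ.+ s)))))

convolve-zero : ∀ {k} (A : Fin k → List ℕ) {F : ℕ → ℕ} → (∀ s → F s ≡ 0) →
                convolve A F ≡ 0
convolve-zero {zero}  A F≗0 = F≗0 0
convolve-zero {suc k} A F≗0 =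
  trans (∑-cong (A zero) (λ y → convolve-zero (A ∘ suc) (λ s → F≗0 (y + s))))
        (∑-zero (A zero))

-- Multiplicities

_[_↦_] : (ℕ → ℕ) → ℕ → ℕ → ℕ → ℕ
(c [ v ↦ y ]) x = if v ≡ᵇ x then y else c x

increment : (ℕ → ℕ) → ℕ → ℕ → ℕ
increment c v = c [ v ↦ c v + 1 ]

reset : (ℕ → ℕ) → ℕ → ℕ → ℕ
reset c v = c [ v ↦ 0 ]

tally : List ℕ → ℕ → ℕ
tally = foldl increment (λ _ → 0)

[↦]-same : ∀ c v y → (c [ v ↦ y ]) v ≡ y
[↦]-same c v y rewrite dec-true (v ≟ v) refl = refl

[↦]-other : ∀ c {v x} y → v ≢ x → (c [ v ↦ y ]) x ≡ c x
[↦]-other c {v} {x} y v≢x rewrite dec-false (v ≟ x) v≢x = refl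

reset≢0 : ∀ c v {x} → reset c v x ≢ 0 → v ≢ x × c x ≢ 0
reset≢0 c v {x} ≢0 with compare≡ v x
... | same e≡ _ rewrite e≡     = contradiction refl ≢0
... | other e≡ v≢x rewrite e≡ = v≢x , ≢0

reset-≤ : ∀ c v x → reset c v x ≤ c x
reset-≤ c v x with v ≡ᵇ x
... | true  = z≤n
... | false = ≤-refl

increment-≤ : ∀ c v x → increment c v x ≤ c x + 1
increment-≤ c v x with compare≡ v x
... | same e≡ refl rewrite e≡ = ≤-refl
... | other e≡ _ rewrite e≡   = m≤m+n (c x) 1

tally-≤ : ∀ c vs x → foldl increment c vs x ≤ c x + length vs
tally-≤ c []       x = m≤m+n (c x) 0
tally-≤ c (v ∷ vs) x = ≤-trans (tally-≤ (increment c v) vs x)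
  (≤-trans (+-monoˡ-≤ (length vs) (increment-≤ c v x)) (≤-reflexive (+-assoc (c x) 1 (length vs))))

tally-support : ∀ c vs x → foldl increment c vs x ≢ 0 → c x ≢ 0 ⊎ x ∈ vs
tally-support c []       x ≢0 = inj₁ ≢0
tally-support c (v ∷ vs) x ≢0 with tally-support (increment c v) vs x ≢0
... | inj₂ x∈vs = inj₂ (there x∈vs)
... | inj₁ ≢0′ with compare≡ v x
...   | same _ refl           = inj₂ (here refl)
...   | other e≡ _ rewrite e≡ = inj₁ ≢0′

reset-all : ∀ c vs → (∀ x → c x ≢ 0 → x ∈ vs) → ∀ x → foldl reset c vs x ≡ 0
reset-all c []       supp x with c x ≟ 0
... | yes ≡0 = ≡0
... | no ≢0  with () ← supp x ≢0
reset-all c (v ∷ vs) supp = reset-all (reset c v) vs supp′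
  where
  supp′ : ∀ x → reset c v x ≢ 0 → x ∈ vs
  supp′ x ≢0 with reset≢0 c v {x} ≢0
  ... | v≢x , c≢0 with supp x c≢0
  ...   | here refl = contradiction refl v≢x
  ...   | there x∈  = x∈

-- Because of this the array of multiplicities is zero again when the next set is built.
reset-tally : ∀ vs x → foldl reset (tally vs) vs x ≡ 0
reset-tally vs = reset-all (tally vs) vs supp
  where
  supp : ∀ x → tally vs x ≢ 0 → x ∈ vs
  supp x ≢0 with tally-support (λ _ → 0) vs x ≢0
  ... | inj₁ 0≢0 = contradiction refl 0≢0
  ... | inj₂ x∈  = x∈

-- A value contributes its whole multiplicity at its first occurrence and nothing later, since its
-- counter is then reset. This is the order in which `slots` and the program go through a list.
∑distinct : (ℕ → ℕ) → (ℕ → ℕ) → List ℕ → ℕ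
∑distinct g c []       = 0
∑distinct g c (v ∷ vs) = c v * g v + ∑distinct g (reset c v) vs

∑distinct-cong : ∀ g vs {c c′ : ℕ → ℕ} → (∀ x → c x ≡ c′ x) →
                 ∑distinct g c vs ≡ ∑distinct g c′ vs
∑distinct-cong g []       c≗c′ = refl
∑distinct-cong g (v ∷ vs) {c} {c′} c≗c′ =
  cong₂ _+_ (cong (_* g v) (c≗c′ v)) (∑distinct-cong g vs reset-cong)
  where
  reset-cong : ∀ x → reset c v x ≡ reset c′ v x
  reset-cong x with v ≡ᵇ x
  ... | true  = refl
  ... | false = c≗c′ x

∑distinct-zero : ∀ g vs {c : ℕ → ℕ} → (∀ x → c x ≡ 0) → ∑distinct g c vs ≡ 0
∑distinct-zero g []       c≗0 = refl
∑distinct-zero g (v ∷ vs) {c} c≗0 rewrite c≗0 v = ∑distinct-zero g vs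
  (λ x → n≤0⇒n≡0 (≤-trans (reset-≤ c v x) (≤-reflexive (c≗0 x))))

-- The additional unit is collected at the first occurrence of `v` in `vs`; up to there only other
-- values are reset, which commutes with incrementing `v`.
∑distinct-increment : ∀ g vs c v → v ∈ vs →
                      ∑distinct g (increment c v) vs ≡ g v + ∑distinct g c vs
∑distinct-increment g (u ∷ vs) c v v∈ with u ≟ v
... | yes refl = trans
  (cong₂ _+_ (cong (_* g v) ([↦]-same c v (c v + 1))) (∑distinct-cong g vs agree))
  (rearrange (c v) (g v) (∑distinct g (reset c v) vs))
  where
  agree : ∀ x → reset (increment c v) v x ≡ reset c v x
  agree x with v ≡ᵇ x
  ... | true  = refl
  ... | false = refl
  rearrange : ∀ a b c → (a + 1) * b + c ≡ b + (a * b + c)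
  rearrange a b c = trans (cong (λ n → n * b + c) (+-comm a 1)) (+-assoc b (a * b) c)
... | no u≢v = trans
  (cong₂ _+_ (cong (_* g u) ([↦]-other c (c v + 1) (u≢v ∘ sym)))
     (trans (∑distinct-cong g vs commute) (∑distinct-increment g vs (reset c u) v (tail v∈))))
  (rearrange (c u * g u) (g v) (∑distinct g (reset c u) vs))
  where
  tail : v ∈ u ∷ vs → v ∈ vs
  tail (here refl) = contradiction refl u≢v
  tail (there v∈′) = v∈′
  commute : ∀ x → reset (increment c v) u x ≡ increment (reset c u) v x
  commute x with compare≡ u x | compare≡ v x
  ... | same _ refl  | same _ refl   = contradiction refl u≢v
  ... | same e≡ refl | other e≡′ _ rewrite e≡ | e≡′ = refl
  ... | other e≡ _   | same e≡′ refl rewrite e≡ | e≡′ = refl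
  ... | other e≡ _   | other e≡′ _ rewrite e≡ | e≡′ = refl
  rearrange : ∀ a b c → a + (b + c) ≡ b + (a + c)
  rearrange = solve 3 (λ a b c → a :+ (b :+ c) := b :+ (a :+ c)) refl

∑distinct-tally : ∀ g vs → ∑distinct g (tally vs) vs ≡ ∑ vs g
∑distinct-tally g vs = trans (go vs (λ _ → 0) id)
  (trans (cong (_+_ (∑ vs g)) (∑distinct-zero g vs (λ _ → refl))) (+-identityʳ (∑ vs g)))
  where
  -- The list `vs` summed over stays whole, while `ws`, the part still to be tallied, shrinks.
  go : ∀ ws c → (∀ {x} → x ∈ ws → x ∈ vs) →
       ∑distinct g (foldl increment c ws) vs ≡ ∑ ws g + ∑distinct g c vs
  go []       c ws⊆vs = refl
  go (w ∷ ws) c ws⊆vs = trans (go ws (increment c w) (ws⊆vs ∘ there))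
    (trans (cong (_+_ (∑ ws g)) (∑distinct-increment g vs c w (ws⊆vs (here refl))))
           (rearrange (∑ ws g) (g w) (∑distinct g c vs)))
    where
    rearrange : ∀ a b c → a + (b + c) ≡ b + a + c
    rearrange = solve 3 (λ a b c → a :+ (b :+ c) := b :+ a :+ c) refl

-- Binary expansions and sets of distinct numbers

shift : ℕ → ℕ → ℕ
shift x b = (x / 2 ^ b) {{m^n≢0 2 b}}

shift-zero : ∀ x → shift x 0 ≡ x
shift-zero x = n/1≡n x

shift-suc : ∀ x b → shift x (suc b) ≡ shift x b / 2
shift-suc x b = sym (trans
  (m/n/o≡m/[n*o] x (2 ^ b) 2 {{m^n≢0 2 b}} {{_}} {{subst NonZero (*-comm 2 (2 ^ b)) (m^n≢0 2 (suc b))}})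
  (/-congʳ {{subst NonZero (*-comm 2 (2 ^ b)) (m^n≢0 2 (suc b))}} {{m^n≢0 2 (suc b)}} (*-comm (2 ^ b) 2)))

bit : ℕ → ℕ → ℕ
bit b x = shift x b % 2

binary-expansion : ∀ R x → x ≡ ∑< R (λ b → 2 ^ b * bit b x) + 2 ^ R * shift x R
binary-expansion zero    x = sym (trans (+-identityʳ (shift x 0)) (shift-zero x))
binary-expansion (suc R) x = begin
  x
    ≡⟨ binary-expansion R x ⟩
  S + 2 ^ R * shift x R
    ≡⟨ cong (λ y → S + 2 ^ R * y) (m≡m%n+[m/n]*n (shift x R) 2) ⟩
  S + 2 ^ R * (bit R x + shift x R / 2 * 2)
    ≡⟨ cong (λ y → S + 2 ^ R * (bit R x + y * 2)) (shift-suc x R) ⟨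
  S + 2 ^ R * (bit R x + shift x (suc R) * 2)
    ≡⟨ rearrange S (2 ^ R) (bit R x) (shift x (suc R)) ⟩
  2 ^ R * bit R x + S + 2 * 2 ^ R * shift x (suc R) ∎
  where
  open ≡-Reasoning
  S = ∑< R (λ b → 2 ^ b * bit b x)
  rearrange : ∀ s p b y → s + p * (b + y * 2) ≡ p * b + s + 2 * p * y
  rearrange = solve 4 (λ s p b y → s :+ p :* (b :+ y :* con 2) := p :* b :+ s :+ con 2 :* p :* y) refl

shift-small : ∀ {x} b → x < 2 ^ b → shift x b ≡ 0
shift-small b x<2^b = m<n⇒m/n≡0 {{m^n≢0 2 b}} x<2^b

∑bits : ∀ R x → x < 2 ^ R → ∑< R (λ b → 2 ^ b * bit b x) ≡ x
∑bits R x x<2^R = sym (begin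
  x                        ≡⟨ binary-expansion R x ⟩
  S + 2 ^ R * shift x R    ≡⟨ cong (λ y → S + 2 ^ R * y) (shift-small R x<2^R) ⟩
  S + 2 ^ R * 0            ≡⟨ cong (_+_ S) (*-zeroʳ (2 ^ R)) ⟩
  S + 0                    ≡⟨ +-identityʳ S ⟩
  S                        ∎)
  where
  open ≡-Reasoning
  S = ∑< R (λ b → 2 ^ b * bit b x)

weightOfBits : ∀ {k} → Vec ℕ k → ℕ
weightOfBits []       = 1
weightOfBits (b ∷ bs) = 2 ^ b * weightOfBits bs

-- The r-th slot of a set holds the r-th element v of the list if v occurs there
-- for the first time and its multiplicity has bit b, and the padding Z + r
-- otherwise. The function c holds the multiplicities of the elements not yet seen.
module _ (Z : ℕ) where

  slot : ℕ → ℕ → ℕ → ℕ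
  slot zero    v r = Z + r
  slot (suc _) v r = v

  padding : ℕ → ℕ → List ℕ
  padding r zero    = []
  padding r (suc j) = Z + r ∷ padding (suc r) j

  slots : ℕ → (ℕ → ℕ) → ℕ → List ℕ → ℕ → List ℕ
  slots b c r []       j = padding r j
  slots b c r (v ∷ vs) j = slot (bit b (c v)) v r ∷ slots b (reset c v) (suc r) vs j

  length-padding : ∀ r j → length (padding r j) ≡ j
  length-padding r zero    = refl
  length-padding r (suc j) = cong suc (length-padding (suc r) j)

  length-slots : ∀ b c r vs j → length (slots b c r vs j) ≡ length vs + j
  length-slots b c r []       j = length-padding r j
  length-slots b c r (v ∷ vs) j = cong suc (length-slots b (reset c v) (suc r) vs j)

  ∑padding : ∀ g → (∀ y → Z ≤ y → g y ≡ 0) → ∀ r j → ∑ (padding r j) g ≡ 0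
  ∑padding g g≥Z r zero    = refl
  ∑padding g g≥Z r (suc j) = cong₂ _+_ (g≥Z (Z + r) (m≤m+n Z r)) (∑padding g g≥Z (suc r) j)

  slot-sum : ∀ (g : ℕ → ℕ) → (∀ y → Z ≤ y → g y ≡ 0) → ∀ a v r → a < 2 → g (slot a v r) ≡ a * g v
  slot-sum g g≥Z zero          v r _ = g≥Z (Z + r) (m≤m+n Z r)
  slot-sum g g≥Z (suc zero)    v r _ = sym (+-identityʳ (g v))
  slot-sum g g≥Z (suc (suc a)) v r (s≤s (s≤s ()))

  -- At the first occurrence of `v` the bits of `c v`, weighted by powers of 2, add up to `c v`, as
  -- `c v < 2 ^ R`; all padding falls where `g` vanishes.
  ∑slots : ∀ R g → (∀ y → Z ≤ y → g y ≡ 0) → ∀ c r vs j → (∀ x → c x < 2 ^ R) →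
           ∑< R (λ b → 2 ^ b * ∑ (slots b c r vs j) g) ≡ ∑distinct g c vs
  ∑slots R g g≥Z c r []       j c< = trans
    (∑<-cong R (λ b _ → trans (cong (2 ^ b *_) (∑padding g g≥Z r j)) (*-zeroʳ (2 ^ b))))
    (∑-zero (downFrom R))
  ∑slots R g g≥Z c r (v ∷ vs) j c< = begin
    ∑< R (λ b → 2 ^ b * (g (slot (bit b (c v)) v r) + rest b))
      ≡⟨ ∑<-cong R (λ b _ → trans (*-distribˡ-+ (2 ^ b) _ (rest b))
           (cong (_+ 2 ^ b * rest b)
             (trans (cong (2 ^ b *_) (slot-sum g g≥Z (bit b (c v)) v r (m%n<n (shift (c v) b) 2)))
                    (sym (*-assoc (2 ^ b) (bit b (c v)) (g v)))))) ⟩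
    ∑< R (λ b → 2 ^ b * bit b (c v) * g v + 2 ^ b * rest b)
      ≡⟨ ∑-+ (downFrom R) _ _ ⟩
    ∑< R (λ b → 2 ^ b * bit b (c v) * g v) + ∑< R (λ b → 2 ^ b * rest b)
      ≡⟨ cong₂ _+_ (sym (∑-* (g v) (downFrom R) (λ b → 2 ^ b * bit b (c v))))
           (∑slots R g g≥Z (reset c v) (suc r) vs j
              (λ x → ≤-<-trans (reset-≤ c v x) (c< x))) ⟩
    ∑< R (λ b → 2 ^ b * bit b (c v)) * g v + ∑distinct g (reset c v) vs
      ≡⟨ cong (λ n → n * g v + ∑distinct g (reset c v) vs) (∑bits R (c v) (c< v)) ⟩
    ∑distinct g c (v ∷ vs) ∎
    where
    open ≡-Reasoning
    rest : ℕ → ℕ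
    rest b = ∑ (slots b (reset c v) (suc r) vs j) g

  padding-≥ : ∀ r j → All (Z + r ≤_) (padding r j)
  padding-≥ r zero    = []
  padding-≥ r (suc j) = ≤-refl ∷
    All.map (≤-trans (+-monoʳ-≤ Z (n≤1+n r))) (padding-≥ (suc r) j)

  padding-< : ∀ r j → All (_< Z + (r + j)) (padding r j)
  padding-< r zero    = []
  padding-< r (suc j) = +-monoʳ-< Z (m<m+n r z<s) ∷
    subst (λ n → All (_< Z + n) (padding (suc r) j)) (sym (+-suc r j)) (padding-< (suc r) j)

  padding-unique : ∀ r j → Unique (padding r j)
  padding-unique r zero    = []
  padding-unique r (suc j) =
    All.map (λ {y} Z+r<y → <⇒≢ (subst (λ n → n ≤ y) (+-suc Z r) Z+r<y)) (padding-≥ (suc r) j)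
    ∷ padding-unique (suc r) j

  -- The invariant behind `slots-unique`: a value once passed has multiplicity 0 and cannot recur,
  -- and the padding of later slots exceeds that of the present one.
  slots-range : ∀ b c r vs j → All (_< Z) vs →
                All (λ y → (y < Z × c y ≢ 0) ⊎ Z + r ≤ y) (slots b c r vs j)
  slots-range b c r []       j _           = All.map inj₂ (padding-≥ r j)
  slots-range b c r (v ∷ vs) j (v<Z ∷ vs<Z) =
    first ∷ All.map weaken (slots-range b (reset c v) (suc r) vs j vs<Z)
    where
    weaken : ∀ {y} → (y < Z × reset c v y ≢ 0) ⊎ Z + suc r ≤ y → (y < Z × c y ≢ 0) ⊎ Z + r ≤ y
    weaken (inj₁ (y<Z , ≢0)) = inj₁ (y<Z , proj₂ (reset≢0 c v ≢0))
    weaken (inj₂ Z+r<y)      = inj₂ (≤-trans (+-monoʳ-≤ Z (n≤1+n r)) Z+r<y)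
    first : (slot (bit b (c v)) v r < Z × c (slot (bit b (c v)) v r) ≢ 0)
            ⊎ Z + r ≤ slot (bit b (c v)) v r
    first with bit b (c v) in e≡
    ... | zero  = inj₂ ≤-refl
    ... | suc _ = inj₁ (v<Z , λ c≡0 → 1+n≢0 (trans (sym e≡) (trans (cong (bit b) c≡0) bit-zero)))
      where
      bit-zero : bit b 0 ≡ 0
      bit-zero = cong (_% 2) (0/n≡0 (2 ^ b) {{m^n≢0 2 b}})

  slots-unique : ∀ b c r vs j → All (_< Z) vs → Unique (slots b c r vs j)
  slots-unique b c r []       j _            = padding-unique r j
  slots-unique b c r (v ∷ vs) j (v<Z ∷ vs<Z) =
    All.map distinct (slots-range b (reset c v) (suc r) vs j vs<Z)
    ∷ slots-unique b (reset c v) (suc r) vs j vs<Z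
    where
    distinct : ∀ {y} → (y < Z × reset c v y ≢ 0) ⊎ Z + suc r ≤ y → slot (bit b (c v)) v r ≢ y
    distinct with bit b (c v)
    ... | zero  = λ
      { (inj₁ (y<Z , _)) refl → ≤⇒≯ (m≤m+n Z r) y<Z
      ; (inj₂ Z+r<y)     refl → <-irrefl refl (subst (λ n → n ≤ Z + r) (+-suc Z r) Z+r<y) }
    ... | suc _ = λ
      { (inj₁ (_ , ≢0)) refl → proj₁ (reset≢0 c v ≢0) refl
      ; (inj₂ Z+r<v)    refl → ≤⇒≯ (≤-trans (m≤m+n Z (suc r)) Z+r<v) v<Z }

  slots-bound : ∀ b c r vs j → All (_< Z) vs → All (_≤ Z + (r + (length vs + j))) (slots b c r vs j)
  slots-bound b c r []       j _            = All.map <⇒≤ (padding-< r j)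
  slots-bound b c r (v ∷ vs) j (v<Z ∷ vs<Z) =
    first ∷ subst (λ n → All (_≤ Z + n) (slots b (reset c v) (suc r) vs j))
                  (sym (+-suc r (length vs + j)))
                  (slots-bound b (reset c v) (suc r) vs j vs<Z)
    where
    first : slot (bit b (c v)) v r ≤ Z + (r + suc (length vs + j))
    first with bit b (c v)
    ... | zero  = +-monoʳ-≤ Z (m≤m+n r (suc (length vs + j)))
    ... | suc _ = ≤-trans (<⇒≤ v<Z) (m≤m+n Z (r + suc (length vs + j)))

  padded : ℕ → ℕ → List ℕ → List ℕ
  padded N b vs = slots b (tally vs) 0 vs (N ∸ length vs)

  -- The sets are replaced one at a time. All numbers are non-negative, so a sum that involves
  -- padding is at least `Z`, where `F` vanishes; the function `F (y + s)` left for the remaining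
  -- sets inherits this property.
  convolve-bits : ∀ N R {k} (vs : Fin k → List ℕ) (F : ℕ → ℕ) →
                  (∀ y → Z ≤ y → F y ≡ 0) → (∀ i → length (vs i) < 2 ^ R) →
                  convolve vs F
                  ≡ ∑ (allDigits R k) (λ bs → weightOfBits bs *
                        convolve (λ i → padded N (Vec.lookup bs i) (vs i)) F)
  convolve-bits N R {zero}  vs F F≥Z vs< = sym (trans (+-identityʳ _) (+-identityʳ (F 0)))
  convolve-bits N R {suc k} vs F F≥Z vs< = begin
    ∑ (vs zero) g
      ≡⟨ ∑distinct-tally g (vs zero) ⟨
    ∑distinct g (tally (vs zero)) (vs zero)
      ≡⟨ ∑slots R g g≥Z (tally (vs zero)) 0 (vs zero) (N ∸ length (vs zero))
           (λ x → ≤-<-trans (tally-≤ (λ _ → 0) (vs zero) x) (vs< zero)) ⟨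
    ∑< R (λ b → 2 ^ b * ∑ (head b) g)
      ≡⟨ ∑<-cong R (λ b _ → trans (cong (2 ^ b *_) (expand b)) (*-∑ (2 ^ b) (allDigits R k) _)) ⟩
    ∑< R (λ b → ∑ (allDigits R k) (λ bs → 2 ^ b * (weightOfBits bs * rest b bs)))
      ≡⟨ ∑<-cong R (λ b _ → ∑-cong (allDigits R k)
           (λ bs → sym (*-assoc (2 ^ b) (weightOfBits bs) (rest b bs)))) ⟩
    ∑< R (λ b → ∑ (allDigits R k) (λ bs → weightOfBits (b ∷ bs) * rest b bs))
      ≡⟨ ∑-product _∷_ (downFrom R) (allDigits R k) _ ⟨
    ∑ (allDigits R (suc k)) (λ bs → weightOfBits bs *
        convolve (λ i → padded N (Vec.lookup bs i) (vs i)) F) ∎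
    where
    open ≡-Reasoning
    g : ℕ → ℕ
    g y = convolve (vs ∘ suc) (λ s → F (y + s))
    g≥Z : ∀ y → Z ≤ y → g y ≡ 0
    g≥Z y Z≤y = convolve-zero (vs ∘ suc) (λ s → F≥Z (y + s) (≤-trans Z≤y (m≤m+n y s)))
    head : ℕ → List ℕ
    head b = padded N b (vs zero)
    tail : Vec ℕ k → Fin k → List ℕ
    tail bs i = padded N (Vec.lookup bs i) (vs (suc i))
    rest : ℕ → Vec ℕ k → ℕ
    rest b bs = ∑ (head b) (λ y → convolve (tail bs) (λ s → F (y + s)))
    expand : ∀ b → ∑ (head b) g ≡ ∑ (allDigits R k) (λ bs → weightOfBits bs * rest b bs)
    expand b = begin
      ∑ (head b) g
        ≡⟨ ∑-cong (head b) (λ y → convolve-bits N R (vs ∘ suc) (λ s → F (y + s))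
             (λ s Z≤s → F≥Z (y + s) (≤-trans Z≤s (m≤n+m s y))) (λ i → vs< (suc i))) ⟩
      ∑ (head b) (λ y → ∑ (allDigits R k) (λ bs → weightOfBits bs *
          convolve (tail bs) (λ s → F (y + s))))
        ≡⟨ ∑-swap (head b) (allDigits R k) _ ⟩
      ∑ (allDigits R k) (λ bs → ∑ (head b) (λ y → weightOfBits bs *
          convolve (tail bs) (λ s → F (y + s))))
        ≡⟨ ∑-cong (allDigits R k) (λ bs → *-∑ (weightOfBits bs) (head b) _) ⟨
      ∑ (allDigits R k) (λ bs → weightOfBits bs * rest b bs) ∎

-- Comparisons

data SameOrder (x y x′ y′ : ℤ) : Set where
  both< : x ℤ.< y → x′ ℤ.< y′ → SameOrder x y x′ y′
  both≡ : x ≡ y → x′ ≡ y′ → SameOrder x y x′ y′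
  both> : y ℤ.< x → y′ ℤ.< x′ → SameOrder x y x′ y′

compare-same : ∀ r {x y x′ y′} → SameOrder x y x′ y′ →
               does (compare? r x y) ≡ does (compare? r x′ y′)
compare-same r {x} {y} {x′} {y′} (both< p q) = trans (value r p) (sym (value r q))
  where
  expected : Comparison → Bool
  expected eq = false
  expected le = true
  expected lt = true
  expected ge = false
  expected gt = false
  value : ∀ r {x y} → x ℤ.< y → does (compare? r x y) ≡ expected r
  value eq x<y = dec-false (_ ℤ.≟ _) (ℤ.<⇒≢ x<y)
  value le x<y = dec-true (_ ℤ.≤? _) (ℤ.<⇒≤ x<y)
  value lt x<y = dec-true (_ ℤ.<? _) x<y
  value ge x<y = dec-false (_ ℤ.≤? _) (ℤ.<⇒≱ x<y)
  value gt x<y = dec-false (_ ℤ.<? _) (ℤ.<-asym x<y)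
compare-same r {x} {y} {x′} {y′} (both≡ p q) = trans (value r p) (sym (value r q))
  where
  expected : Comparison → Bool
  expected eq = true
  expected le = true
  expected lt = false
  expected ge = true
  expected gt = false
  value : ∀ r {x y} → x ≡ y → does (compare? r x y) ≡ expected r
  value eq x≡y  = dec-true (_ ℤ.≟ _) x≡y
  value le {x} refl = dec-true (x ℤ.≤? x) ℤ.≤-refl
  value lt {x} refl = dec-false (x ℤ.<? x) (ℤ.<-irrefl refl)
  value ge {x} refl = dec-true (x ℤ.≤? x) ℤ.≤-refl
  value gt {x} refl = dec-false (x ℤ.<? x) (ℤ.<-irrefl refl)
compare-same r {x} {y} {x′} {y′} (both> p q) = trans (value r p) (sym (value r q))
  where
  expected : Comparison → Bool
  expected eq = false
  expected le = false
  expected lt = false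
  expected ge = true
  expected gt = true
  value : ∀ r {x y} → y ℤ.< x → does (compare? r x y) ≡ expected r
  value eq y<x = dec-false (_ ℤ.≟ _) (ℤ.<⇒≢ y<x ∘ sym)
  value le y<x = dec-false (_ ℤ.≤? _) (ℤ.<⇒≱ y<x)
  value lt y<x = dec-false (_ ℤ.<? _) (ℤ.<-asym y<x)
  value ge y<x = dec-true (_ ℤ.≤? _) (ℤ.<⇒≤ y<x)
  value gt y<x = dec-true (_ ℤ.<? _) y<x

compare-translate : ∀ r x y c → does (compare? r (x ℤ.+ c) (y ℤ.+ c)) ≡ does (compare? r x y)
compare-translate r x y c with ℤ.<-cmp x y
... | tri< x<y _ _ = compare-same r (both< (ℤ.+-monoˡ-< c x<y) x<y)
... | tri≈ _ x≡y _ = compare-same r (both≡ (cong (ℤ._+ c) x≡y) x≡y)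
... | tri> _ _ y<x = compare-same r (both> (ℤ.+-monoˡ-< c y<x) y<x)

cmp : Comparison → ℕ → ℕ → Bool
cmp r x y = does (compare? r (+ x) (+ y))

-- Used with the offset `k * 3` for `c` and a code `δ` for `d`: the code alone tells how the two
-- sides compare.
cmp-shift : ∀ r a t d c → a + c ≡ t + d → cmp r d c ≡ cmp r a t
cmp-shift r a t d c e = trans (sym (compare-translate r (+ d) (+ c) (+ t)))
  (trans (cong₂ (cmp r) (trans (+-comm d t) (sym e)) (+-comm c t))
  (trans (cong (cmp r (a + c)) (refl {x = t + c})) (compare-translate r (+ a) (+ t) (+ c))))

∑ᶠ-+ : ∀ {k} (f g : Fin k → ℕ) → ∑ᶠ (λ i → f i + g i) ≡ ∑ᶠ f + ∑ᶠ g
∑ᶠ-+ {zero}  f g = refl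
∑ᶠ-+ {suc k} f g = trans (cong (_+_ (f zero + g zero)) (∑ᶠ-+ (f ∘ suc) (g ∘ suc)))
  (interchange (f zero) (g zero) (∑ᶠ (f ∘ suc)) (∑ᶠ (g ∘ suc)))

∑ᶠ-* : ∀ {k} c (f : Fin k → ℕ) → ∑ᶠ (λ i → c * f i) ≡ c * ∑ᶠ f
∑ᶠ-* {zero}  c f = sym (*-zeroʳ c)
∑ᶠ-* {suc k} c f = trans (cong (_+_ (c * f zero)) (∑ᶠ-* c (f ∘ suc)))
  (sym (*-distribˡ-+ c (f zero) (∑ᶠ (f ∘ suc))))

∑ᶠ-const : ∀ k c → ∑ᶠ {k} (λ _ → c) ≡ k * c
∑ᶠ-const zero    c = refl
∑ᶠ-const (suc k) c = cong (_+_ c) (∑ᶠ-const k c)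

∑ᶠ-mono : ∀ {k} {f g : Fin k → ℕ} → (∀ i → f i ≤ g i) → ∑ᶠ f ≤ ∑ᶠ g
∑ᶠ-mono {zero}  f≤g = z≤n
∑ᶠ-mono {suc k} f≤g = +-mono-≤ (f≤g zero) (∑ᶠ-mono (f≤g ∘ suc))

∑ᶠ-cong : ∀ {k} {f g : Fin k → ℕ} → (∀ i → f i ≡ g i) → ∑ᶠ f ≡ ∑ᶠ g
∑ᶠ-cong {zero}  f≗g = refl
∑ᶠ-cong {suc k} f≗g = cong₂ _+_ (f≗g zero) (∑ᶠ-cong (f≗g ∘ suc))

∑ᶠ-≤ : ∀ {k} {f : Fin k → ℕ} c → (∀ i → f i ≤ c) → ∑ᶠ f ≤ k * c
∑ᶠ-≤ {k} c f≤c = ≤-trans (∑ᶠ-mono f≤c) (≤-reflexive (∑ᶠ-const k c))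

shift-half : ∀ x ℓ → 2 * shift x (suc ℓ) ≤ shift x ℓ × shift x ℓ ≤ 2 * shift x (suc ℓ) + 1
shift-half x ℓ = ≤-trans (≤-reflexive lhs) (m/n*n≤m (shift x ℓ) 2) ,
  ≤-trans (≤-reflexive (m≡m%n+[m/n]*n (shift x ℓ) 2))
    (≤-trans (+-monoˡ-≤ (shift x ℓ / 2 * 2) (s≤s⁻¹ (m%n<n (shift x ℓ) 2)))
             (≤-reflexive (trans (cong (_+_ 1) (sym lhs)) (+-comm 1 (2 * shift x (suc ℓ))))))
  where
  lhs : 2 * shift x (suc ℓ) ≡ shift x ℓ / 2 * 2
  lhs = trans (*-comm 2 (shift x (suc ℓ))) (cong (_* 2) (shift-suc x ℓ))

shift-≤ : ∀ x ℓ → shift x ℓ ≤ x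
shift-≤ x ℓ = m/n≤m x (2 ^ ℓ) {{m^n≢0 2 ℓ}}

-- Each of the `k` roundings loses at most 1. This is the origin of `k` as the threshold between
-- small and large differences.
∑ᶠ-shift-half : ∀ {k} (U : Fin k → ℕ) ℓ →
  2 * ∑ᶠ (λ i → shift (U i) (suc ℓ)) ≤ ∑ᶠ (λ i → shift (U i) ℓ) ×
  ∑ᶠ (λ i → shift (U i) ℓ) ≤ 2 * ∑ᶠ (λ i → shift (U i) (suc ℓ)) + k
∑ᶠ-shift-half {k} U ℓ =
  ≤-trans (≤-reflexive (sym (∑ᶠ-* 2 (λ i → shift (U i) (suc ℓ))))) (∑ᶠ-mono (λ i → proj₁ (shift-half (U i) ℓ))) ,
  ≤-trans (∑ᶠ-mono (λ i → proj₂ (shift-half (U i) ℓ)))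
    (≤-reflexive (trans (∑ᶠ-+ (λ i → 2 * shift (U i) (suc ℓ)) (λ _ → 1))
      (cong₂ _+_ (∑ᶠ-* 2 (λ i → shift (U i) (suc ℓ))) (trans (∑ᶠ-const k 1) (*-identityʳ k)))))

-- Certificates

indicator-∧ : ∀ a b → indicator (a ∧ b) ≡ indicator a * indicator b
indicator-∧ true  b = sym (+-identityʳ (indicator b))
indicator-∧ false b = refl

≡ᵇ-cancel : ∀ t d e → (t + d ≡ᵇ t + e) ≡ (d ≡ᵇ e)
≡ᵇ-cancel zero    d e = refl
≡ᵇ-cancel (suc t) d e = ≡ᵇ-cancel t d e

∑<-collapse : ∀ n {s} t d (f : ℕ → ℕ) → s ≡ t + d → d < n →
              ∑< n (λ e → indicator (s ≡ᵇ t + e) * f e) ≡ f d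
∑<-collapse n t d f refl d<n = trans
  (∑<-cong n (λ e _ → cong (λ b → indicator b * f e) (≡ᵇ-cancel t d e)))
  (∑<-indicator n d f d<n)

-- The difference of the sum of the ⌊uᵢ / 2^ℓ⌋ and ⌊τ / 2^ℓ⌋ is coded by
-- δ = difference + 3k, which is non-negative in the relevant cases. The level ℓ
-- of a tuple is the largest one at which the absolute difference is at least k,
-- and 0 if there is none; the sign of the difference at this level is the sign at level 0.
module _ (k : ℕ) where

  -- For `δ` = difference + 3k, the difference is less than `k` in absolute value.
  small : ℕ → Bool
  small δ = (k * 2 <ᵇ δ) ∧ (δ <ᵇ k * 4)

  -- Here `δ′` belongs to level `suc ℓ`, where the difference has to be small, and `δ` to level `ℓ`,
  -- where it must not be. The factor `ℓ` exempts level 0 from the second condition.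
  valid : ℕ → ℕ → ℕ → ℕ
  valid ℓ δ′ δ = indicator (small δ′) * indicator (ℓ * indicator (small δ) ≡ᵇ 0)

data Zone (k a t : ℕ) : Set where
  low  : a + k ≤ t → Zone k a t
  mid  : t < a + k → a < t + k → Zone k a t
  high : t + k ≤ a → Zone k a t

zone : ∀ k a t → Zone k a t
zone k a t with a + k ≤? t | t + k ≤? a
... | yes p | _     = low p
... | no _  | yes q = high q
... | no ¬p | no ¬q = mid (≰⇒> ¬p) (≰⇒> ¬q)

Mid : ℕ → ℕ → ℕ → Set
Mid k a t = t < a + k × a < t + k

small-mid : ∀ k a t δ → a + k * 3 ≡ t + δ → Mid k a t → small k δ ≡ true
small-mid k a t δ e (t<a+k , a<t+k) = cong₂ _∧_ (dec-true (k * 2 <? δ) 2k<δ) (dec-true (δ <? k * 4) δ<4k)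
  where
  2k<δ : k * 2 < δ
  2k<δ = +-cancelˡ-< t _ _ (begin-strict
    t + k * 2        <⟨ +-monoˡ-< (k * 2) t<a+k ⟩
    a + k + k * 2    ≡⟨ solve 2 (λ a k → a :+ k :+ k :* con 2 := a :+ k :* con 3) refl a k ⟩
    a + k * 3        ≡⟨ e ⟩
    t + δ            ∎)
    where open ≤-Reasoning
  δ<4k : δ < k * 4
  δ<4k = +-cancelˡ-< t _ _ (begin-strict
    t + δ            ≡⟨ e ⟨
    a + k * 3        <⟨ +-monoˡ-< (k * 3) a<t+k ⟩
    t + k + k * 3    ≡⟨ solve 2 (λ t k → t :+ k :+ k :* con 3 := t :+ k :* con 4) refl t k ⟩
    t + k * 4        ∎)
    where open ≤-Reasoning

small⇒Mid : ∀ k a t δ → a + k * 3 ≡ t + δ → small k δ ≡ true → Mid k a t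
small⇒Mid k a t δ e s with k * 2 <? δ | δ <? k * 4
... | no ¬p | _    rewrite dec-false (k * 2 <? δ) ¬p with () ← s
... | yes p | no ¬q rewrite dec-true (k * 2 <? δ) p | dec-false (δ <? k * 4) ¬q with () ← s
... | yes p | yes q = t<a+k , a<t+k
  where
  t<a+k : t < a + k
  t<a+k = +-cancelʳ-< (k * 2) _ _ (begin-strict
    t + k * 2        <⟨ +-monoʳ-< t p ⟩
    t + δ            ≡⟨ e ⟨
    a + k * 3        ≡⟨ solve 2 (λ a k → a :+ k :+ k :* con 2 := a :+ k :* con 3) refl a k ⟨
    a + k + k * 2    ∎)
    where open ≤-Reasoning
  a<t+k : a < t + k
  a<t+k = +-cancelʳ-< (k * 3) _ _ (begin-strict
    a + k * 3        ≡⟨ e ⟩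
    t + δ            <⟨ +-monoʳ-< t q ⟩
    t + k * 4        ≡⟨ solve 2 (λ t k → t :+ k :+ k :* con 3 := t :+ k :* con 4) refl t k ⟨
    t + k + k * 3    ∎)
    where open ≤-Reasoning

-- The function `h` stands for everything that still depends on the truth of this atom, so that the
-- atoms can be treated one after another.
module AtomSum (k : ℕ) .{{_ : NonZero k}} (R : ℕ) (6k<R : k * 6 < R)
               (U : Fin k → ℕ) (τ : ℕ) (r : Comparison) (h : Bool → ℕ) where

  a t : ℕ → ℕ
  a ℓ = ∑ᶠ (λ i → shift (U i) ℓ)
  t ℓ = shift τ ℓ

  -- Each summand carries 3 of the offset `k * 3`, so that `A ℓ ≡ t ℓ + δ` is an equation between
  -- sums of natural numbers, as a `k`-SUM call can test.
  A : ℕ → ℕ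
  A ℓ = ∑ᶠ (λ i → shift (U i) ℓ + 3)

  A≡ : ∀ ℓ → A ℓ ≡ a ℓ + k * 3
  A≡ ℓ = trans (∑ᶠ-+ (λ i → shift (U i) ℓ) (λ _ → 3)) (cong (_+_ (a ℓ)) (∑ᶠ-const k 3))

  H : ℕ
  H = h (cmp r (a 0) (t 0))

  level : ℕ → ℕ
  level ℓ = ∑< R (λ δ′ → ∑< R (λ δ → valid k ℓ δ′ δ *
    (indicator (A ℓ ≡ᵇ t ℓ + δ) * indicator (A (suc ℓ) ≡ᵇ t (suc ℓ) + δ′) * h (cmp r δ (k * 3)))))

  1≤k : 1 ≤ k
  1≤k = >-nonZero⁻¹ k

  -- On the finer level a gap of at least `k` has doubled, and rounding takes back at most `k` of
  -- it.
  low-down : ∀ ℓ → a (suc ℓ) + k ≤ t (suc ℓ) → a ℓ + k ≤ t ℓ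
  low-down ℓ p = begin
    a ℓ + k                    ≤⟨ +-monoˡ-≤ k (proj₂ (∑ᶠ-shift-half U ℓ)) ⟩
    2 * a (suc ℓ) + k + k      ≡⟨ solve 2 (λ a k → con 2 :* a :+ k :+ k := con 2 :* (a :+ k)) refl (a (suc ℓ)) k ⟩
    2 * (a (suc ℓ) + k)        ≤⟨ *-monoʳ-≤ 2 p ⟩
    2 * t (suc ℓ)              ≤⟨ proj₁ (shift-half τ ℓ) ⟩
    t ℓ                        ∎
    where open ≤-Reasoning

  high-down : ∀ ℓ → t (suc ℓ) + k ≤ a (suc ℓ) → t ℓ + k ≤ a ℓ
  high-down ℓ p = begin
    t ℓ + k                    ≤⟨ +-monoˡ-≤ k (proj₂ (shift-half τ ℓ)) ⟩
    2 * t (suc ℓ) + 1 + k      ≤⟨ +-monoˡ-≤ k (+-monoʳ-≤ (2 * t (suc ℓ)) 1≤k) ⟩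
    2 * t (suc ℓ) + k + k      ≡⟨ solve 2 (λ a k → con 2 :* a :+ k :+ k := con 2 :* (a :+ k)) refl (t (suc ℓ)) k ⟩
    2 * (t (suc ℓ) + k)        ≤⟨ *-monoʳ-≤ 2 p ⟩
    2 * a (suc ℓ)              ≤⟨ proj₁ (∑ᶠ-shift-half U ℓ) ⟩
    a ℓ                        ∎
    where open ≤-Reasoning

  low-bottom : ∀ ℓ → a ℓ + k ≤ t ℓ → a 0 + k ≤ t 0
  low-bottom zero    p = p
  low-bottom (suc ℓ) p = low-bottom ℓ (low-down ℓ p)

  high-bottom : ∀ ℓ → t ℓ + k ≤ a ℓ → t 0 + k ≤ a 0
  high-bottom zero    p = p
  high-bottom (suc ℓ) p = high-bottom ℓ (high-down ℓ p)

  ¬mid-down : ∀ ℓ → ¬ Mid k (a (suc ℓ)) (t (suc ℓ)) → ¬ Mid k (a ℓ) (t ℓ)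
  ¬mid-down ℓ ¬m (t< , a<) with zone k (a (suc ℓ)) (t (suc ℓ))
  ... | low p   = ≤⇒≯ (low-down ℓ p) t<
  ... | mid p q = ¬m (p , q)
  ... | high p  = ≤⇒≯ (high-down ℓ p) a<

  ¬mid-below : ∀ n → ¬ Mid k (a n) (t n) → ∀ i → i ≤ n → ¬ Mid k (a i) (t i)
  ¬mid-below zero    ¬m zero _   = ¬m
  ¬mid-below (suc n) ¬m i i≤1+n with i ≟ suc n
  ... | yes refl = ¬m
  ... | no i≢    = ¬mid-below n (¬mid-down n ¬m) i (s≤s⁻¹ (≤∧≢⇒< i≤1+n i≢))

  -- With `mid-a≤` the origin of the offset: a difference below `k` at level `suc ℓ` doubles to at
  -- most `2k`, and rounding adds at most another `k`. At level `ℓ` it lies between `-3k` and `3k`,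
  -- and its code between 0 and `6k`.
  mid-t≤ : ∀ ℓ → Mid k (a (suc ℓ)) (t (suc ℓ)) → t ℓ ≤ a ℓ + k * 3
  mid-t≤ ℓ (t< , _) = begin
    t ℓ                                ≤⟨ proj₂ (shift-half τ ℓ) ⟩
    2 * t (suc ℓ) + 1                  ≤⟨ +-monoʳ-≤ (2 * t (suc ℓ)) 1≤k ⟩
    2 * t (suc ℓ) + k                  ≤⟨ +-monoˡ-≤ k (*-monoʳ-≤ 2 (<⇒≤ t<)) ⟩
    2 * (a (suc ℓ) + k) + k            ≡⟨ solve 2 (λ a k → con 2 :* (a :+ k) :+ k := con 2 :* a :+ k :* con 3) refl (a (suc ℓ)) k ⟩
    2 * a (suc ℓ) + k * 3              ≤⟨ +-monoˡ-≤ (k * 3) (proj₁ (∑ᶠ-shift-half U ℓ)) ⟩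
    a ℓ + k * 3                        ∎
    where open ≤-Reasoning

  mid-a≤ : ∀ ℓ → Mid k (a (suc ℓ)) (t (suc ℓ)) → a ℓ + k * 3 ≤ t ℓ + k * 6
  mid-a≤ ℓ (_ , a<) = begin
    a ℓ + k * 3                        ≤⟨ +-monoˡ-≤ (k * 3) (proj₂ (∑ᶠ-shift-half U ℓ)) ⟩
    2 * a (suc ℓ) + k + k * 3          ≤⟨ +-monoˡ-≤ (k * 3) (+-monoˡ-≤ k (*-monoʳ-≤ 2 (<⇒≤ a<))) ⟩
    2 * (t (suc ℓ) + k) + k + k * 3    ≡⟨ solve 2 (λ t k → con 2 :* (t :+ k) :+ k :+ k :* con 3 := con 2 :* t :+ k :* con 6) refl (t (suc ℓ)) k ⟩
    2 * t (suc ℓ) + k * 6              ≤⟨ +-monoˡ-≤ (k * 6) (proj₁ (shift-half τ ℓ)) ⟩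
    t ℓ + k * 6                        ∎
    where open ≤-Reasoning

  code : ∀ ℓ → t ℓ ≤ a ℓ + k * 3 → a ℓ + k * 3 ≤ t ℓ + k * 6 →
         ∃[ δ ] a ℓ + k * 3 ≡ t ℓ + δ × δ < R
  code ℓ p q = a ℓ + k * 3 ∸ t ℓ , sym (m+[n∸m]≡n p) ,
    ≤-<-trans (≤-trans (∸-monoˡ-≤ (t ℓ) q) (≤-reflexive (m+n∸m≡n (t ℓ) (k * 6)))) 6k<R

  mid-code : ∀ ℓ → Mid k (a ℓ) (t ℓ) → ∃[ δ ] a ℓ + k * 3 ≡ t ℓ + δ × δ < R
  mid-code ℓ (t< , a<) = code ℓ
    (≤-trans (<⇒≤ t<) (+-monoʳ-≤ (a ℓ) (m≤m*n k 3)))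
    (≤-trans (+-monoˡ-≤ (k * 3) (<⇒≤ a<))
      (≤-trans (≤-reflexive (solve 2 (λ t k → t :+ k :+ k :* con 3 := t :+ k :* con 4) refl (t ℓ) k))
               (+-monoʳ-≤ (t ℓ) (*-monoʳ-≤ k (s≤s (s≤s (s≤s (s≤s (z≤n {2})))))))))

  -- The two equations determine `δ` and `δ′`, so that one term of the double sum remains. Its `δ′`
  -- is small by `Mid`; the condition on `δ` stays as an indicator.
  level-collapse : ∀ ℓ δ → a ℓ + k * 3 ≡ t ℓ + δ → δ < R → Mid k (a (suc ℓ)) (t (suc ℓ)) →
                   level ℓ ≡ indicator (ℓ * indicator (small k δ) ≡ᵇ 0) * h (cmp r δ (k * 3))
  level-collapse ℓ δ e δ<R m with mid-code (suc ℓ) m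
  ... | δ′ , e′ , δ′<R = begin
    level ℓ
      ≡⟨ ∑<-cong R (λ d′ _ → trans
           (∑<-cong R (λ d _ → rearrange₁ (valid k ℓ d′ d) (indicator (A ℓ ≡ᵇ t ℓ + d)) (I′ d′) (h (cmp r d (k * 3)))))
           (∑<-collapse R (t ℓ) δ (λ d → valid k ℓ d′ d * (I′ d′ * h (cmp r d (k * 3))))
             (trans (A≡ ℓ) e) δ<R)) ⟩
    ∑< R (λ d′ → valid k ℓ d′ δ * (I′ d′ * h (cmp r δ (k * 3))))
      ≡⟨ ∑<-cong R (λ d′ _ → rearrange₂ (valid k ℓ d′ δ) (I′ d′) (h (cmp r δ (k * 3)))) ⟩
    ∑< R (λ d′ → I′ d′ * (valid k ℓ d′ δ * h (cmp r δ (k * 3))))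
      ≡⟨ ∑<-collapse R (t (suc ℓ)) δ′ (λ d′ → valid k ℓ d′ δ * h (cmp r δ (k * 3)))
           (trans (A≡ (suc ℓ)) e′) δ′<R ⟩
    valid k ℓ δ′ δ * h (cmp r δ (k * 3))
      ≡⟨ cong (λ b → indicator b * indicator (ℓ * indicator (small k δ) ≡ᵇ 0) * h (cmp r δ (k * 3)))
           (small-mid k _ _ δ′ e′ m) ⟩
    1 * indicator (ℓ * indicator (small k δ) ≡ᵇ 0) * h (cmp r δ (k * 3))
      ≡⟨ cong (_* h (cmp r δ (k * 3))) (*-identityˡ (indicator (ℓ * indicator (small k δ) ≡ᵇ 0))) ⟩
    indicator (ℓ * indicator (small k δ) ≡ᵇ 0) * h (cmp r δ (k * 3)) ∎
    where
    open ≡-Reasoning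
    I′ : ℕ → ℕ
    I′ d′ = indicator (A (suc ℓ) ≡ᵇ t (suc ℓ) + d′)
    rearrange₁ : ∀ v i j x → v * (i * j * x) ≡ i * (v * (j * x))
    rearrange₁ = solve 4 (λ v i j x → v :* (i :* j :* x) := i :* (v :* (j :* x))) refl
    rearrange₂ : ∀ v j x → v * (j * x) ≡ j * (v * x)
    rearrange₂ = solve 3 (λ v j x → v :* (j :* x) := j :* (v :* x)) refl

  level-zero : ∀ ℓ → ¬ Mid k (a (suc ℓ)) (t (suc ℓ)) → level ℓ ≡ 0
  level-zero ℓ ¬m = trans (∑<-cong R (λ δ′ _ → trans (∑<-cong R (λ δ _ → vanish δ′ δ)) (∑-zero (downFrom R))))
                          (∑-zero (downFrom R))
    where
    vanish : ∀ δ′ δ → valid k ℓ δ′ δ * (indicator (A ℓ ≡ᵇ t ℓ + δ) *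
             indicator (A (suc ℓ) ≡ᵇ t (suc ℓ) + δ′) * h (cmp r δ (k * 3))) ≡ 0
    vanish δ′ δ with compare≡ (A (suc ℓ)) (t (suc ℓ) + δ′)
    ... | other e _ = trans
      (cong (λ b → valid k ℓ δ′ δ * (indicator (A ℓ ≡ᵇ t ℓ + δ) * indicator b * h (cmp r δ (k * 3)))) e)
      (trans (cong (λ x → valid k ℓ δ′ δ * (x * h (cmp r δ (k * 3)))) (*-zeroʳ (indicator (A ℓ ≡ᵇ t ℓ + δ))))
             (*-zeroʳ (valid k ℓ δ′ δ)))
    ... | same _ e  = notSmall (small k δ′) refl
      where
      notSmall : ∀ b → small k δ′ ≡ b → valid k ℓ δ′ δ * (indicator (A ℓ ≡ᵇ t ℓ + δ) *
                 indicator (A (suc ℓ) ≡ᵇ t (suc ℓ) + δ′) * h (cmp r δ (k * 3))) ≡ 0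
      notSmall true  s = contradiction
        (small⇒Mid k (a (suc ℓ)) (t (suc ℓ)) δ′ (trans (sym (A≡ (suc ℓ))) e) s) ¬m
      notSmall false s = cong (λ b → indicator b * indicator (ℓ * indicator (small k δ) ≡ᵇ 0) *
        (indicator (A ℓ ≡ᵇ t ℓ + δ) * indicator (A (suc ℓ) ≡ᵇ t (suc ℓ) + δ′) * h (cmp r δ (k * 3)))) s

  sign : ∀ ℓ → ¬ Mid k (a ℓ) (t ℓ) → cmp r (a ℓ) (t ℓ) ≡ cmp r (a 0) (t 0)
  sign ℓ ¬m with zone k (a ℓ) (t ℓ)
  ... | mid p q = contradiction (p , q) ¬m
  ... | low p  = compare-same r (both< (strict p) (strict (low-bottom ℓ p)))
    where
    strict : ∀ {x y} → x + k ≤ y → + x ℤ.< + y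
    strict {x} x+k≤y = ℤ.+<+ (≤-trans (m<m+n x 1≤k) x+k≤y)
  ... | high p = compare-same r (both> (strict p) (strict (high-bottom ℓ p)))
    where
    strict : ∀ {x y} → x + k ≤ y → + x ℤ.< + y
    strict {x} x+k≤y = ℤ.+<+ (≤-trans (m<m+n x 1≤k) x+k≤y)

  level-value : ∀ ℓ → Mid k (a (suc ℓ)) (t (suc ℓ)) →
                ∃[ δ ] a ℓ + k * 3 ≡ t ℓ + δ ×
                level ℓ ≡ indicator (ℓ * indicator (small k δ) ≡ᵇ 0) * h (cmp r (a ℓ) (t ℓ))
  level-value ℓ m = let (δ , e , δ<R) = code ℓ (mid-t≤ ℓ m) (mid-a≤ ℓ m) in δ , e , trans (level-collapse ℓ δ e δ<R m)
    (cong (λ b → indicator (ℓ * indicator (small k δ) ≡ᵇ 0) * h b) (cmp-shift r (a ℓ) (t ℓ) δ (k * 3) e))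

  -- The case in which `suc n` is the level of the tuple: its own term is `H` by `sign`, and every
  -- lower level fails the condition on the level above it, by `¬mid-below`.
  ∑levels-outer : ∀ n δ → a (suc n) + k * 3 ≡ t (suc n) + δ →
    level (suc n) ≡ indicator (suc n * indicator (small k δ) ≡ᵇ 0) * h (cmp r (a (suc n)) (t (suc n))) →
    ¬ Mid k (a (suc n)) (t (suc n)) → ∑< (suc (suc n)) level ≡ H
  ∑levels-outer n δ e v ¬m = begin
    level (suc n) + ∑< (suc n) level
      ≡⟨ cong₂ _+_ (trans v (notSmall (small k δ) refl))
           (trans (∑<-cong (suc n) (λ i i≤n → level-zero i (¬mid-below (suc n) ¬m (suc i) i≤n)))
                  (∑-zero (downFrom (suc n)))) ⟩
    h (cmp r (a (suc n)) (t (suc n))) + 0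
      ≡⟨ +-identityʳ (h (cmp r (a (suc n)) (t (suc n)))) ⟩
    h (cmp r (a (suc n)) (t (suc n)))
      ≡⟨ cong h (sign (suc n) ¬m) ⟩
    H ∎
    where
    open ≡-Reasoning
    notSmall : ∀ b → small k δ ≡ b → indicator (suc n * indicator (small k δ) ≡ᵇ 0) * h (cmp r (a (suc n)) (t (suc n)))
               ≡ h (cmp r (a (suc n)) (t (suc n)))
    notSmall true  s = contradiction (small⇒Mid k (a (suc n)) (t (suc n)) δ e s) ¬m
    notSmall false s = trans
      (cong₂ (λ b x → indicator (x ≡ᵇ 0) * h (cmp r (a (suc n)) (t (suc n)))) s
        (trans (cong (λ b → suc n * indicator b) s) (*-zeroʳ n)))
      (*-identityˡ (h (cmp r (a (suc n)) (t (suc n)))))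

  -- Descent from a level with a small difference. A level that is small again contributes 0 and the
  -- descent continues; the first one that is not contributes all of `H`. If level 0 is reached, its
  -- exemption in `valid` yields `H`.
  ∑levels : ∀ n → Mid k (a (suc n)) (t (suc n)) → ∑< (suc n) level ≡ H
  ∑levels-step : ∀ n → Mid k (a (suc (suc n))) (t (suc (suc n))) → Zone k (a (suc n)) (t (suc n)) →
                 ∑< (suc (suc n)) level ≡ H
  ∑levels zero m = let (δ , e , v) = level-value 0 m in
    trans (+-identityʳ (level 0)) (trans v (+-identityʳ H))
  ∑levels (suc n) m = ∑levels-step n m (zone k (a (suc n)) (t (suc n)))
  ∑levels-step n m (mid p q) = let (δ , e , v) = level-value (suc n) m in
    cong₂ _+_ {x = level (suc n)} {y = 0}
      (trans v (cong (λ b → indicator (suc n * indicator b ≡ᵇ 0) * h (cmp r (a (suc n)) (t (suc n))))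
                     (small-mid k (a (suc n)) (t (suc n)) δ e (p , q))))
      (∑levels n (p , q))
  ∑levels-step n m (low p)  = let (δ , e , v) = level-value (suc n) m in
    ∑levels-outer n δ e v (λ (t< , _) → ≤⇒≯ p t<)
  ∑levels-step n m (high p) = let (δ , e , v) = level-value (suc n) m in
    ∑levels-outer n δ e v (λ (_ , a<) → ≤⇒≯ p a<)

  ∑certificates : (∀ i → U i < 2 ^ R) → τ < 2 ^ R → ∑< R level ≡ h (cmp r (∑ᶠ U) τ)
  ∑certificates U< τ< = trans
    (subst (λ n → ∑< n level ≡ H) R≡ (∑levels (pred R) (subst (λ n → Mid k (a n) (t n)) (sym R≡) top)))
    (cong₂ (λ x y → h (cmp r x y)) (∑ᶠ-cong (λ i → shift-zero (U i))) (shift-zero τ))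
    where
    R≡ : suc (pred R) ≡ R
    R≡ = suc-pred R {{>-nonZero (≤-<-trans z≤n 6k<R)}}
    a≡0 : a R ≡ 0
    a≡0 = trans (∑ᶠ-cong (λ i → shift-small R (U< i))) (trans (∑ᶠ-const k 0) (*-zeroʳ k))
    -- At level `R` all numbers have been rounded to 0, so the descent can start there.
    top : Mid k (a R) (t R)
    top = subst₂ (Mid k) (sym a≡0) (sym (shift-small R τ<)) (1≤k , 1≤k)

-- Packing

radix-injective : ∀ Y {x x′ p p′} → x < Y → x′ < Y → x + Y * p ≡ x′ + Y * p′ → x ≡ x′ × p ≡ p′
radix-injective Y {x} {x′} {p} {p′} x<Y x′<Y e = x≡x′ , p≡p′
  where
  instance _ = >-nonZero (≤-<-trans z≤n x<Y)
  rem : ∀ {x} p → x < Y → (x + Y * p) % Y ≡ x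
  rem {x} p x<Y = trans (cong (λ n → (x + n) % Y) (*-comm Y p))
    (trans ([m+kn]%n≡m%n x p Y) (m<n⇒m%n≡m x<Y))
  x≡x′ : x ≡ x′
  x≡x′ = trans (sym (rem p x<Y)) (trans (cong (_% Y) e) (rem p′ x′<Y))
  p≡p′ : p ≡ p′
  p≡p′ = *-cancelˡ-≡ p p′ Y (+-cancelˡ-≡ x _ _ (trans e (cong (λ n → n + Y * p′) (sym x≡x′))))

indicator-radix : ∀ Y {x x′} p p′ → x < Y → x′ < Y →
  indicator (x + Y * p ≡ᵇ x′ + Y * p′) ≡ indicator (x ≡ᵇ x′) * indicator (p ≡ᵇ p′)
indicator-radix Y {x} {x′} p p′ x<Y x′<Y = trans (cong indicator (cases (compare≡ x x′) (compare≡ p p′)))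
                                                 (indicator-∧ (x ≡ᵇ x′) (p ≡ᵇ p′))
  where
  cases : Comparable x x′ → Comparable p p′ → (x + Y * p ≡ᵇ x′ + Y * p′) ≡ (x ≡ᵇ x′) ∧ (p ≡ᵇ p′)
  cases (other e ≢) _ = trans
    (dec-false (x + Y * p ≟ x′ + Y * p′) (≢ ∘ proj₁ ∘ radix-injective Y x<Y x′<Y))
    (cong (λ b → b ∧ (p ≡ᵇ p′)) (sym e))
  cases (same e _) (other e′ ≢) = trans
    (dec-false (x + Y * p ≟ x′ + Y * p′) (≢ ∘ proj₂ ∘ radix-injective Y x<Y x′<Y))
    (sym (cong₂ _∧_ e e′))
  cases (same e refl) (same e′ refl) = trans
    (dec-true (x + Y * p ≟ x + Y * p) refl) (sym (cong₂ _∧_ e e′))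

module _ (Y : ℕ) where

  -- Two digits for each atom, for the levels `ℓ` and `suc ℓ`; the two codes enter only on the side
  -- of `target`. Taking `us` apart by `head` and `tail` lets `pack Y (U i) cs` unfold for a
  -- variable `i`.
  pack : ∀ {m} → Vec ℕ m → Vec ℕ (m * 3) → ℕ
  pack {zero}  us cs               = 0
  pack {suc m} us (ℓ ∷ _ ∷ _ ∷ cs) =
    shift (Vec.head us) ℓ + 3 + Y * (shift (Vec.head us) (suc ℓ) + 3 + Y * pack (Vec.tail us) cs)

  target : ∀ {m} → Vec ℕ m → Vec ℕ (m * 3) → ℕ
  target {zero}  τs cs                 = 0
  target {suc m} τs (ℓ ∷ δ′ ∷ δ ∷ cs) =
    shift (Vec.head τs) ℓ + δ + Y * (shift (Vec.head τs) (suc ℓ) + δ′ + Y * target (Vec.tail τs) cs)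

  ∑ᶠ-radix : ∀ {k} (x y z : Fin k → ℕ) →
    ∑ᶠ (λ i → x i + Y * (y i + Y * z i)) ≡ ∑ᶠ x + Y * (∑ᶠ y + Y * ∑ᶠ z)
  ∑ᶠ-radix x y z =
    trans (∑ᶠ-+ x (λ i → Y * (y i + Y * z i))) (cong (_+_ (∑ᶠ x))
    (trans (∑ᶠ-* Y (λ i → y i + Y * z i)) (cong (_*_ Y)
    (trans (∑ᶠ-+ y (λ i → Y * z i)) (cong (_+_ (∑ᶠ y)) (∑ᶠ-* Y z))))))

  radix-< : ∀ {x y p q} → x < Y → y < Y → p < q → x + Y * (y + Y * p) < Y * (Y * q)
  radix-< {x} {y} {p} {q} x<Y y<Y p<q = step x<Y (step y<Y p<q)
    where
    step : ∀ {x p q} → x < Y → p < q → x + Y * p < Y * q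
    step {x} {p} {q} x<Y p<q = begin-strict
      x + Y * p  <⟨ +-monoˡ-< (Y * p) x<Y ⟩
      Y + Y * p  ≡⟨ *-suc Y p ⟨
      Y * suc p  ≤⟨ *-monoʳ-≤ Y p<q ⟩
      Y * q      ∎
      where open ≤-Reasoning

data All< (R : ℕ) : ∀ {D} → Vec ℕ D → Set where
  []  : All< R []
  _∷_ : ∀ {D c} {cs : Vec ℕ D} → c < R → All< R cs → All< R (c ∷ cs)

digits-< : ∀ R .{{_ : NonZero R}} D q → All< R (digits R D q)
digits-< R zero    q = []
digits-< R (suc D) q = m%n<n q R ∷ digits-< R D (q / R)

Below : ∀ {m} → ℕ → Vec ℕ m → Set
Below {zero}  b us = ⊤
Below {suc m} b us = Vec.head us < b × Below b (Vec.tail us)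

module _ (k : ℕ) where

  validity : ∀ m → Vec ℕ (m * 3) → ℕ
  validity zero    cs                 = 1
  validity (suc m) (ℓ ∷ δ′ ∷ δ ∷ cs) = valid k ℓ δ′ δ * validity m cs

  claims : ∀ {m} → Vec Comparison m → Vec ℕ (m * 3) → List Bool
  claims []       cs                = []
  claims (r ∷ rs) (_ ∷ _ ∷ δ ∷ cs) = cmp r δ (k * 3) ∷ claims rs cs

atomTruths : ∀ {k m} → Vec Comparison m → (Fin k → Vec ℕ m) → Vec ℕ m → List Bool
atomTruths []       U τs = []
atomTruths (r ∷ rs) U τs =
  cmp r (∑ᶠ (λ i → Vec.head (U i))) (Vec.head τs) ∷ atomTruths rs (λ i → Vec.tail (U i)) (Vec.tail τs)

module _ {k : ℕ} .{{_ : NonZero k}} (R Y : ℕ) (6k<R : k * 6 < R)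
         (Y-large : k * (2 ^ R + 3) < Y) (Y-large′ : 2 ^ R + R ≤ Y) where

  -- The purpose of `Y-large`: when `k` packed numbers are added, no digit produces a carry.
  atom-digit-< : ∀ (U : Fin k → ℕ) ℓ → (∀ i → U i < 2 ^ R) → ∑ᶠ (λ i → shift (U i) ℓ + 3) < Y
  atom-digit-< U ℓ U< = ≤-<-trans
    (∑ᶠ-≤ (2 ^ R + 3) (λ i → +-monoˡ-≤ 3 (≤-trans (shift-≤ (U i) ℓ) (<⇒≤ (U< i))))) Y-large

  target-digit-< : ∀ {τ δ} ℓ → τ < 2 ^ R → δ < R → shift τ ℓ + δ < Y
  target-digit-< {τ} ℓ τ< δ< =
    <-≤-trans (+-mono-<-≤ (≤-<-trans (shift-≤ τ ℓ) τ<) (<⇒≤ δ<)) Y-large′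

  target-< : ∀ {m} (τs : Vec ℕ m) (cs : Vec ℕ (m * 3)) → Below (2 ^ R) τs → All< R cs →
             target Y τs cs < Y ^ (m * 2)
  target-< {zero}  τs cs _ _ = s≤s z≤n
  target-< {suc m} τs (ℓ ∷ δ′ ∷ δ ∷ cs) (τ< , τs<) (_ ∷ δ′< ∷ δ< ∷ cs<) =
    radix-< Y (target-digit-< ℓ τ< δ<) (target-digit-< (suc ℓ) τ< δ′<) (target-< (Vec.tail τs) cs τs< cs<)

  pack-< : ∀ {m} (us : Vec ℕ m) (cs : Vec ℕ (m * 3)) → Below (2 ^ R) us → pack Y us cs < Y ^ (m * 2)
  pack-< {zero}  us cs _ = s≤s z≤n
  pack-< {suc m} us (ℓ ∷ δ′ ∷ δ ∷ cs) (u< , us<) =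
    radix-< Y (digit ℓ) (digit (suc ℓ)) (pack-< (Vec.tail us) cs us<)
    where
    digit : ∀ ℓ → shift (Vec.head us) ℓ + 3 < Y
    digit ℓ = ≤-<-trans (≤-trans (+-monoˡ-≤ 3 (≤-trans (shift-≤ _ ℓ) (<⇒≤ u<)))
                                 (m≤n*m (2 ^ R + 3) k)) Y-large

  -- Induction on the atoms. Without carries, the packed equation is the conjunction of the two
  -- equations of the first atom and that of the others. The sum over the remaining digits is the
  -- induction hypothesis for `h` with the first claim put in front, and `AtomSum` does the rest.
  ∑-certificates : ∀ {m} (rs : Vec Comparison m) (U : Fin k → Vec ℕ m) (τs : Vec ℕ m) (h : List Bool → ℕ) →
    (∀ i → Below (2 ^ R) (U i)) → Below (2 ^ R) τs →
    ∑ (allDigits R (m * 3)) (λ cs → validity k m cs *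
      (indicator (∑ᶠ (λ i → pack Y (U i) cs) ≡ᵇ target Y τs cs) * h (claims k rs cs)))
    ≡ h (atomTruths rs U τs)
  ∑-certificates []       U τs h U< τs<
    rewrite ∑ᶠ-const k 0 | *-zeroʳ k = trans (+-identityʳ _) (trans (+-identityʳ _) (+-identityʳ (h [])))
  ∑-certificates {suc m} (r ∷ rs) U τs h U< τs< = begin
    ∑ (allDigits R (3 + m * 3)) G
      ≡⟨ ∑-product _∷_ (downFrom R) (allDigits R (2 + m * 3)) G ⟩
    ∑< R (λ ℓ → ∑ (allDigits R (2 + m * 3)) (λ v → G (ℓ ∷ v)))
      ≡⟨ ∑<-cong R (λ ℓ _ → trans
           (∑-product _∷_ (downFrom R) (allDigits R (1 + m * 3)) (λ v → G (ℓ ∷ v)))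
           (∑<-cong R (λ δ′ δ′<R → trans
             (∑-product _∷_ (downFrom R) (allDigits R (m * 3)) (λ v → G (ℓ ∷ δ′ ∷ v)))
             (∑<-cong R (λ δ δ<R → inner ℓ δ′ δ δ′<R δ<R))))) ⟩
    ∑< R (AtomSum.level k R 6k<R U₀ τ r h′)
      ≡⟨ AtomSum.∑certificates k R 6k<R U₀ τ r h′ (λ i → proj₁ (U< i)) (proj₁ τs<) ⟩
    h (atomTruths (r ∷ rs) U τs) ∎
    where
    open ≡-Reasoning
    U₀ : Fin k → ℕ
    U₀ i = Vec.head (U i)
    U′ : Fin k → Vec ℕ m
    U′ i = Vec.tail (U i)
    τ : ℕ
    τ = Vec.head τs
    h′ : Bool → ℕ
    h′ b = h (b ∷ atomTruths rs U′ (Vec.tail τs))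
    G : Vec ℕ (3 + m * 3) → ℕ
    G cs = validity k (suc m) cs *
      (indicator (∑ᶠ (λ i → pack Y (U i) cs) ≡ᵇ target Y τs cs) * h (claims k (r ∷ rs) cs))
    E : ℕ → ℕ → ℕ
    E ℓ δ = indicator (∑ᶠ (λ i → shift (U₀ i) ℓ + 3) ≡ᵇ shift τ ℓ + δ)
    E′ : Vec ℕ (m * 3) → ℕ
    E′ cs = indicator (∑ᶠ (λ i → pack Y (U′ i) cs) ≡ᵇ target Y (Vec.tail τs) cs)
    rearrange : ∀ v w a b c h → v * w * (a * (b * c) * h) ≡ v * (a * b) * (w * (c * h))
    rearrange = solve 6 (λ v w a b c h → v :* w :* (a :* (b :* c) :* h) := v :* (a :* b) :* (w :* (c :* h))) refl
    inner : ∀ ℓ δ′ δ → δ′ < R → δ < R →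
      ∑ (allDigits R (m * 3)) (λ cs → G (ℓ ∷ δ′ ∷ δ ∷ cs))
      ≡ valid k ℓ δ′ δ * (E ℓ δ * E (suc ℓ) δ′ * h′ (cmp r δ (k * 3)))
    inner ℓ δ′ δ δ′<R δ<R = begin
      ∑ (allDigits R (m * 3)) (λ cs → G (ℓ ∷ δ′ ∷ δ ∷ cs))
        ≡⟨ ∑-cong (allDigits R (m * 3)) (λ cs → trans
             (cong (λ x → valid k ℓ δ′ δ * validity k m cs * (x * h (claims k (r ∷ rs) (ℓ ∷ δ′ ∷ δ ∷ cs)))) (split cs))
             (rearrange (valid k ℓ δ′ δ) (validity k m cs) (E ℓ δ) (E (suc ℓ) δ′) (E′ cs)
               (h (claims k (r ∷ rs) (ℓ ∷ δ′ ∷ δ ∷ cs))))) ⟩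
      ∑ (allDigits R (m * 3)) (λ cs → valid k ℓ δ′ δ * (E ℓ δ * E (suc ℓ) δ′) *
          (validity k m cs * (E′ cs * h (cmp r δ (k * 3) ∷ claims k rs cs))))
        ≡⟨ *-∑ (valid k ℓ δ′ δ * (E ℓ δ * E (suc ℓ) δ′)) (allDigits R (m * 3)) _ ⟨
      valid k ℓ δ′ δ * (E ℓ δ * E (suc ℓ) δ′) * ∑ (allDigits R (m * 3)) (λ cs →
          validity k m cs * (E′ cs * h (cmp r δ (k * 3) ∷ claims k rs cs)))
        ≡⟨ cong (_*_ (valid k ℓ δ′ δ * (E ℓ δ * E (suc ℓ) δ′)))
             (∑-certificates rs U′ (Vec.tail τs) (λ bs → h (cmp r δ (k * 3) ∷ bs))
               (λ i → proj₂ (U< i)) (proj₂ τs<)) ⟩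
      valid k ℓ δ′ δ * (E ℓ δ * E (suc ℓ) δ′) * h′ (cmp r δ (k * 3))
        ≡⟨ *-assoc (valid k ℓ δ′ δ) (E ℓ δ * E (suc ℓ) δ′) (h′ (cmp r δ (k * 3))) ⟩
      valid k ℓ δ′ δ * (E ℓ δ * E (suc ℓ) δ′ * h′ (cmp r δ (k * 3))) ∎
      where
      split : ∀ cs → indicator (∑ᶠ (λ i → pack Y (U i) (ℓ ∷ δ′ ∷ δ ∷ cs)) ≡ᵇ target Y τs (ℓ ∷ δ′ ∷ δ ∷ cs))
                     ≡ E ℓ δ * (E (suc ℓ) δ′ * E′ cs)
      split cs = begin
        indicator (∑ᶠ (λ i → pack Y (U i) (ℓ ∷ δ′ ∷ δ ∷ cs)) ≡ᵇ target Y τs (ℓ ∷ δ′ ∷ δ ∷ cs))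
          ≡⟨ cong (λ n → indicator (n ≡ᵇ target Y τs (ℓ ∷ δ′ ∷ δ ∷ cs)))
               (∑ᶠ-radix Y (λ i → shift (U₀ i) ℓ + 3) (λ i → shift (U₀ i) (suc ℓ) + 3) (λ i → pack Y (U′ i) cs)) ⟩
        indicator (∑ᶠ (λ i → shift (U₀ i) ℓ + 3) + Y * (∑ᶠ (λ i → shift (U₀ i) (suc ℓ) + 3) + Y * ∑ᶠ (λ i → pack Y (U′ i) cs))
                   ≡ᵇ target Y τs (ℓ ∷ δ′ ∷ δ ∷ cs))
          ≡⟨ indicator-radix Y _ _ (atom-digit-< U₀ ℓ (λ i → proj₁ (U< i))) (target-digit-< ℓ (proj₁ τs<) δ<R) ⟩
        E ℓ δ * indicator (∑ᶠ (λ i → shift (U₀ i) (suc ℓ) + 3) + Y * ∑ᶠ (λ i → pack Y (U′ i) cs)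
                   ≡ᵇ shift τ (suc ℓ) + δ′ + Y * target Y (Vec.tail τs) cs)
          ≡⟨ cong (_*_ (E ℓ δ)) (indicator-radix Y _ _ (atom-digit-< U₀ (suc ℓ) (λ i → proj₁ (U< i)))
                                                       (target-digit-< (suc ℓ) (proj₁ τs<) δ′<R)) ⟩
        E ℓ δ * (E (suc ℓ) δ′ * E′ cs) ∎

length-filter-∑ : ∀ {A : Set} {P : A → Set} (P? : ∀ a → Dec (P a)) xs →
                  length (filter P? xs) ≡ ∑ xs (λ a → indicator (does (P? a)))
length-filter-∑ P? []       = refl
length-filter-∑ P? (x ∷ xs) with does (P? x)
... | true  = cong suc (length-filter-∑ P? xs)
... | false = length-filter-∑ P? xs

∑digits-cong : ∀ R D {f g : Vec ℕ D → ℕ} → (∀ v → All< R v → f v ≡ g v) →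
               ∑ (allDigits R D) f ≡ ∑ (allDigits R D) g
∑digits-cong R zero    f≗g = cong (_+ 0) (f≗g [] [])
∑digits-cong R (suc D) {f} {g} f≗g =
  trans (∑-product _∷_ (downFrom R) (allDigits R D) f)
  (trans (∑<-cong R (λ c c<R → ∑digits-cong R D (λ v v< → f≗g (c ∷ v) (c<R ∷ v<))))
         (sym (∑-product _∷_ (downFrom R) (allDigits R D) g)))

∑<-digits₂ : ∀ R .{{_ : NonZero R}} D E (F : Vec ℕ D → Vec ℕ E → ℕ) →
             ∑< (R ^ D * R ^ E) (λ q → F (digits R D q) (digits R E (dropDigits R D q)))
             ≡ ∑ (allDigits R D) (λ v → ∑ (allDigits R E) (F v))
∑<-digits₂ R D E F = trans (∑<-digits R D (R ^ E) (λ v q → F v (digits R E q)))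
  (∑-cong (allDigits R D) (λ v → trans (cong (λ n → ∑< n (λ q → F v (digits R E q))) (sym (*-identityʳ (R ^ E))))
    (trans (∑<-digits R E 1 (λ w _ → F v w)) (∑-cong (allDigits R E) (λ w → +-identityʳ (F v w))))))

-- Atoms of a formula

record Atom {k : ℕ} (d : Fin k → ℕ) (l : ℕ) : Set where
  constructor atom
  field
    coefficients : Point d l
    parameters   : Vec ℤ l
    comparison   : Comparison
    constant     : ℤ
open Atom

module _ {k : ℕ} {d : Fin k → ℕ} {l : ℕ} where

  atoms : Formula d l → List (Atom d l)
  atoms (linear α β r γ) = atom α β r γ ∷ []
  atoms (not ψ)          = atoms ψ
  atoms (ψ and χ)        = atoms ψ ++ atoms χ
  atoms (ψ or χ)         = atoms ψ ++ atoms χ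

  decide : Formula d l → List Bool → Bool × List Bool
  decide (linear _ _ _ _) []       = false , []
  decide (linear _ _ _ _) (b ∷ bs) = b , bs
  decide (not ψ) bs   = let (b , bs′) = decide ψ bs in Bool.not b , bs′
  decide (ψ and χ) bs = let (b , bs′) = decide ψ bs ; (c , bs″) = decide χ bs′ in b ∧ c , bs″
  decide (ψ or χ) bs  = let (b , bs′) = decide ψ bs ; (c , bs″) = decide χ bs′ in b ∨ c , bs″

  truths : List (Atom d l) → Point d l → Vec ℤ l → List Bool
  truths []                   x t = []
  truths (atom α β r γ ∷ as) x t =
    does (compare? r (sumℤ (λ i → dot (α i) (x i)) ℤ.+ dot β t) γ) ∷ truths as x t

  truths-++ : ∀ as bs x t → truths (as ++ bs) x t ≡ truths as x t ++ truths bs x t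
  truths-++ []       bs x t = refl
  truths-++ (a ∷ as) bs x t = cong (_ ∷_) (truths-++ as bs x t)

  decide-truths : ∀ ψ x t bs → decide ψ (truths (atoms ψ) x t ++ bs) ≡ (does (satisfies? ψ x t) , bs)
  decide-truths₂ : ∀ ψ χ x t bs → let (b , bs′) = decide ψ (truths (atoms ψ ++ atoms χ) x t ++ bs) in
    b ≡ does (satisfies? ψ x t) × decide χ bs′ ≡ (does (satisfies? χ x t) , bs)
  decide-truths (linear α β r γ) x t bs = refl
  decide-truths (not ψ)   x t bs = cong (λ (b , bs′) → Bool.not b , bs′) (decide-truths ψ x t bs)
  decide-truths (ψ and χ) x t bs = let (e , e′) = decide-truths₂ ψ χ x t bs in
    cong₂ (λ b (c , bs″) → b ∧ c , bs″) e e′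
  decide-truths (ψ or χ)  x t bs = let (e , e′) = decide-truths₂ ψ χ x t bs in
    cong₂ (λ b (c , bs″) → b ∨ c , bs″) e e′
  decide-truths₂ ψ χ x t bs
    rewrite truths-++ (atoms ψ) (atoms χ) x t
          | ++-assoc (truths (atoms ψ) x t) (truths (atoms χ) x t) bs
          | decide-truths ψ x t (truths (atoms χ) x t ++ bs)
    = refl , decide-truths χ x t bs

  module _ (W : ℕ) where

    -- Adding `W` to each of the `k` values and `k * W` to the threshold does not affect the
    -- comparison. Under the bounds assumed later it makes all numbers non-negative, and the
    -- absolute value then merely turns an integer into a natural number.
    elementValues : (as : List (Atom d l)) → ∀ i → Vec ℤ (d i) → Vec ℕ (length as)
    elementValues []       i x = []
    elementValues (a ∷ as) i x = ∣ dot (coefficients a i) x ℤ.+ + W ∣ ∷ elementValues as i x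

    thresholds : (as : List (Atom d l)) → Vec ℤ l → Vec ℕ (length as)
    thresholds []       t = []
    thresholds (a ∷ as) t = ∣ constant a ℤ.- dot (parameters a) t ℤ.+ + (k * W) ∣ ∷ thresholds as t

  comparisons : (as : List (Atom d l)) → Vec Comparison (length as)
  comparisons []       = []
  comparisons (a ∷ as) = comparison a ∷ comparisons as

  ElementBound : ℕ → Point d l → Atom d l → Set
  ElementBound W x a = ∀ i → ∣ dot (coefficients a i) (x i) ∣ ≤ W

  ThresholdBound : ℕ → Vec ℤ l → Atom d l → Set
  ThresholdBound W t a = ∣ constant a ℤ.- dot (parameters a) t ∣ ≤ W

∣i+n∣ : ∀ i n → ∣ i ∣ ≤ n → + ∣ i ℤ.+ + n ∣ ≡ i ℤ.+ + n
∣i+n∣ (+ m)    n _ = refl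
∣i+n∣ -[1+ m ] n m<n rewrite ℤ.⊖-≥ m<n = refl

sumℤ-translate : ∀ {k} (s : Fin k → ℤ) (u : Fin k → ℕ) W → (∀ i → + u i ≡ s i ℤ.+ + W) →
                 + ∑ᶠ u ≡ sumℤ s ℤ.+ + (k * W)
sumℤ-translate {zero}  s u W e = refl
sumℤ-translate {suc k} s u W e =
  trans (cong₂ ℤ._+_ (e zero) (sumℤ-translate (s ∘ suc) (u ∘ suc) W (e ∘ suc)))
        (ℤ-interchange (s zero) (+ W) (sumℤ (s ∘ suc)) (+ (k * W)))

atomTruths≡truths : ∀ {k} {d : Fin k → ℕ} {l} W (as : List (Atom d l)) (x : Point d l) t →
  All (ElementBound W x) as → All (ThresholdBound W t) as → W ≤ k * W →
  atomTruths (comparisons as) (λ i → elementValues W as i (x i)) (thresholds W as t) ≡ truths as x t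
atomTruths≡truths W []       x t []       []       _ = refl
atomTruths≡truths {k} W (atom α β r γ ∷ as) x t (p ∷ ps) (q ∷ qs) W≤ =
  cong₂ _∷_ first (atomTruths≡truths W as x t ps qs W≤)
  where
  S T : ℤ
  S = sumℤ (λ i → dot (α i) (x i))
  T = dot β t
  first : cmp r (∑ᶠ (λ i → ∣ dot (α i) (x i) ℤ.+ + W ∣)) ∣ γ ℤ.- T ℤ.+ + (k * W) ∣ ≡ does (compare? r (S ℤ.+ T) γ)
  first = trans
    (cong₂ (λ a b → does (compare? r a b))
      (sumℤ-translate (λ i → dot (α i) (x i)) (λ i → ∣ dot (α i) (x i) ℤ.+ + W ∣) W (λ i → ∣i+n∣ (dot (α i) (x i)) W (p i)))
      (∣i+n∣ (γ ℤ.- T) (k * W) (≤-trans q W≤)))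
    -- The common shift by `k * W` is removed, then `T` is added on both sides to recover the atom
    -- as it was stated.
    (trans (compare-translate r S (γ ℤ.- T) (+ (k * W)))
    (trans (sym (compare-translate r S (γ ℤ.- T) T))
           (cong (λ z → does (compare? r (S ℤ.+ T) z)) cancel)))
    where
    cancel : γ ℤ.- T ℤ.+ T ≡ γ
    cancel = trans (ℤ.+-assoc γ (ℤ.- T) T) (trans (cong (ℤ._+_ γ) (ℤ.+-inverseˡ T)) (ℤ.+-identityʳ γ))

-- The number of witnesses as a weighted sum of `k`-SUM counts

module Reduction {k : ℕ} .{{_ : NonZero k}} {d : Fin k → ℕ} {l : ℕ} (ψ : Formula d l)
         (A : ∀ i → List (Vec ℤ (d i))) (t : Vec ℤ l)
         (N R Y W : ℕ)
         (6k<R : k * 6 < R) (Y-large : k * (2 ^ R + 3) < Y) (Y-large′ : 2 ^ R + R ≤ Y)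
         (W-large : W + k * W < 2 ^ R)
         (A< : ∀ i → length (A i) < 2 ^ R)
         (elements : ∀ i {x} → x ∈ A i → All (λ a → ∣ dot (coefficients a i) x ∣ ≤ W) (atoms ψ))
         (params : All (ThresholdBound W t) (atoms ψ)) where

  m : ℕ
  m = length (atoms ψ)

  instance
    R-nonZero : NonZero R
    R-nonZero = >-nonZero (≤-<-trans z≤n 6k<R)

  Z : ℕ
  Z = Y ^ (m * 2)

  T : Vec ℕ (m * 3) → ℕ
  T cs = target Y (thresholds W (atoms ψ) t) cs

  values : Vec ℕ (m * 3) → Fin k → List ℕ
  values cs i = map (λ x → pack Y (elementValues W (atoms ψ) i x) cs) (A i)

  weight : Vec ℕ (m * 3) → Vec ℕ k → ℕ
  weight cs bs = validity k m cs * (indicator (proj₁ (decide ψ (claims k (comparisons (atoms ψ)) cs))) * weightOfBits bs)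

  count : Vec ℕ (m * 3) → Vec ℕ k → ℕ
  count cs bs = convolve (λ i → padded Z N (Vec.lookup bs i) (values cs i)) (λ s → indicator (s ≡ᵇ T cs))

  W≤kW : W ≤ k * W
  W≤kW = m≤n*m W k

  thresholds-< : Below (2 ^ R) (thresholds W (atoms ψ) t)
  thresholds-< = go (atoms ψ) params
    where
    go : ∀ as → All (ThresholdBound W t) as → Below (2 ^ R) (thresholds W as t)
    go []       []       = tt
    go (a ∷ as) (p ∷ ps) = ≤-<-trans (≤-trans (ℤ.∣i+j∣≤∣i∣+∣j∣ (constant a ℤ.- dot (parameters a) t) (+ (k * W)))
                                              (+-monoˡ-≤ (k * W) p)) W-large , go as ps

  elementValues-< : ∀ i {x} → x ∈ A i → Below (2 ^ R) (elementValues W (atoms ψ) i x)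
  elementValues-< i {x} x∈ = go (atoms ψ) (elements i x∈)
    where
    go : ∀ as → All (λ a → ∣ dot (coefficients a i) x ∣ ≤ W) as → Below (2 ^ R) (elementValues W as i x)
    go []       []       = tt
    go (a ∷ as) (p ∷ ps) = ≤-<-trans (≤-trans (ℤ.∣i+j∣≤∣i∣+∣j∣ (dot (coefficients a i) x) (+ W))
                                              (+-mono-≤ p W≤kW)) W-large , go as ps

  values-< : ∀ cs i → All (_< Z) (values cs i)
  values-< cs i = All.map⁺ (All.tabulate (λ x∈ → pack-< R Y 6k<R Y-large Y-large′ _ cs (elementValues-< i x∈)))

  length-values : ∀ cs i → length (values cs i) ≡ length (A i)
  length-values cs i = length-map _ (A i)

  T<Z : ∀ cs → All< R cs → T cs < Z
  T<Z cs cs< = target-< R Y 6k<R Y-large Y-large′ (thresholds W (atoms ψ) t) cs thresholds-< cs<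

  choices-∈ : ∀ {k} {X : Fin k → Set} (A : ∀ i → List (X i)) {a} → a ∈ choices A → ∀ i → a i ∈ A i
  choices-∈ {suc k} A a∈ with ∈-cartesianProductWith⁻ _ (A zero) (choices (A ∘ suc)) a∈
  ... | x , b , x∈ , b∈ , refl = λ where
    zero    → x∈
    (suc i) → choices-∈ (A ∘ suc) b∈ i

  -- This is `∑-certificates` with the value of the formula on a list of claims for `h`: the claims
  -- of the only certificate that contributes are the actual truth values of the atoms.
  witnesses-certificates : ∀ a → a ∈ choices A →
    indicator (does (satisfies? ψ a t)) ≡
    ∑ (allDigits R (m * 3)) (λ cs → validity k m cs *
      (indicator (∑ᶠ (λ i → pack Y (elementValues W (atoms ψ) i (a i)) cs) ≡ᵇ T cs) *
       indicator (proj₁ (decide ψ (claims k (comparisons (atoms ψ)) cs)))))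
  witnesses-certificates a a∈ = sym (trans
    (∑-certificates R Y 6k<R Y-large Y-large′ (comparisons (atoms ψ))
      (λ i → elementValues W (atoms ψ) i (a i)) (thresholds W (atoms ψ) t)
      (λ bs → indicator (proj₁ (decide ψ bs)))
      (λ i → elementValues-< i (choices-∈ A a∈ i)) thresholds-<)
    (cong indicator (cong proj₁ (trans
      (cong (decide ψ) (trans (atomTruths≡truths W (atoms ψ) a t bounds params W≤kW)
                              (sym (++-identityʳ (truths (atoms ψ) a t)))))
      (decide-truths ψ a t [])))))
    where
    bounds : All (ElementBound W a) (atoms ψ)
    bounds = All.tabulate (λ {at} at∈ i → All.lookup (elements i (choices-∈ A a∈ i)) at∈)

  -- After the sums over tuples and certificates are exchanged, each certificate asks for the number
  -- of solutions of one equation with multiplicities; `convolve-bits` reduces this to sets, and the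
  -- digits of `q` enumerate all cases.
  #witnesses-sum : length (filter (λ a → satisfies? ψ a t) (choices A)) ≡
    ∑< (R ^ (m * 3) * R ^ k) (λ q →
      let cs = digits R (m * 3) q ; bs = digits R k (dropDigits R (m * 3) q) in
      weight cs bs * count cs bs)
  #witnesses-sum = begin
    length (filter (λ a → satisfies? ψ a t) (choices A))
      ≡⟨ length-filter-∑ (λ a → satisfies? ψ a t) (choices A) ⟩
    ∑ (choices A) (λ a → indicator (does (satisfies? ψ a t)))
      ≡⟨ ∑-cong∈ (choices A) (λ {a} a∈ → witnesses-certificates a a∈) ⟩
    ∑ (choices A) (λ a → ∑ (allDigits R (m * 3)) (λ cs → V cs * (E cs (∑ᶠ (λ i → f cs i (a i))) * D cs)))
      ≡⟨ ∑-swap (choices A) (allDigits R (m * 3)) _ ⟩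
    ∑ (allDigits R (m * 3)) (λ cs → ∑ (choices A) (λ a → V cs * (E cs (∑ᶠ (λ i → f cs i (a i))) * D cs)))
      -- The restriction to digits below `R` gives `T cs < Z`, without which padding could take part
      -- in a solution.
      ≡⟨ ∑digits-cong R (m * 3) perCertificate ⟩
    ∑ (allDigits R (m * 3)) (λ cs → ∑ (allDigits R k) (λ bs → weight cs bs * count cs bs))
      ≡⟨ ∑<-digits₂ R (m * 3) k (λ cs bs → weight cs bs * count cs bs) ⟨
    ∑< (R ^ (m * 3) * R ^ k) (λ q →
      weight (digits R (m * 3) q) (digits R k (dropDigits R (m * 3) q)) *
      count (digits R (m * 3) q) (digits R k (dropDigits R (m * 3) q))) ∎
    where
    open ≡-Reasoning
    f : Vec ℕ (m * 3) → ∀ i → Vec ℤ (d i) → ℕ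
    f cs i x = pack Y (elementValues W (atoms ψ) i x) cs
    V : Vec ℕ (m * 3) → ℕ
    V cs = validity k m cs
    D : Vec ℕ (m * 3) → ℕ
    D cs = indicator (proj₁ (decide ψ (claims k (comparisons (atoms ψ)) cs)))
    E : Vec ℕ (m * 3) → ℕ → ℕ
    E cs s = indicator (s ≡ᵇ T cs)
    rearrange₁ : ∀ v e d → v * (e * d) ≡ v * d * e
    rearrange₁ = solve 3 (λ v e d → v :* (e :* d) := v :* d :* e) refl
    rearrange₂ : ∀ v d w c → v * d * (w * c) ≡ v * (d * w) * c
    rearrange₂ = solve 4 (λ v d w c → v :* d :* (w :* c) := v :* (d :* w) :* c) refl
    perCertificate : ∀ cs → All< R cs →
      ∑ (choices A) (λ a → V cs * (E cs (∑ᶠ (λ i → f cs i (a i))) * D cs))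
      ≡ ∑ (allDigits R k) (λ bs → weight cs bs * count cs bs)
    perCertificate cs cs< = begin
      ∑ (choices A) (λ a → V cs * (E cs (∑ᶠ (λ i → f cs i (a i))) * D cs))
        ≡⟨ ∑-cong (choices A) (λ a → rearrange₁ (V cs) (E cs (∑ᶠ (λ i → f cs i (a i)))) (D cs)) ⟩
      ∑ (choices A) (λ a → V cs * D cs * E cs (∑ᶠ (λ i → f cs i (a i))))
        ≡⟨ *-∑ (V cs * D cs) (choices A) (λ a → E cs (∑ᶠ (λ i → f cs i (a i)))) ⟨
      V cs * D cs * ∑ (choices A) (λ a → E cs (∑ᶠ (λ i → f cs i (a i))))
        ≡⟨ cong (_*_ (V cs * D cs)) (trans (convolve-choices A (f cs) (E cs))
             (convolve-bits Z N R (values cs) (E cs) E≥Z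
               (λ i → subst (_< 2 ^ R) (sym (length-values cs i)) (A< i)))) ⟩
      V cs * D cs * ∑ (allDigits R k) (λ bs → weightOfBits bs * count cs bs)
        ≡⟨ *-∑ (V cs * D cs) (allDigits R k) _ ⟩
      ∑ (allDigits R k) (λ bs → V cs * D cs * (weightOfBits bs * count cs bs))
        ≡⟨ ∑-cong (allDigits R k) (λ bs → rearrange₂ (V cs) (D cs) (weightOfBits bs) (count cs bs)) ⟩
      ∑ (allDigits R k) (λ bs → weight cs bs * count cs bs) ∎
      where
      E≥Z : ∀ y → Z ≤ y → E cs y ≡ 0
      E≥Z y Z≤y = cong indicator (dec-false (y ≟ T cs) (λ where refl → ≤⇒≯ Z≤y (T<Z cs cs<)))

  kSUM-instance : Vec ℕ (m * 3) → Vec ℕ k → WitnessProblem.Instance (kSUM k)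
  kSUM-instance cs bs = record
    { set    = λ i → map +_ (padded Z N (Vec.lookup bs i) (values cs i))
    ; unique = λ i → Unique.map⁺ ℤ.+-injective
                 (slots-unique Z (Vec.lookup bs i) (tally (values cs i)) 0 (values cs i)
                   (N ∸ length (values cs i)) (values-< cs i))
    ; params = + T cs ∷ []
    }

  #witnesses-instance : ∀ cs bs → WitnessProblem.Instance.#witnesses (kSUM-instance cs bs) ≡ count cs bs
  #witnesses-instance cs bs = trans
    (length-filter-∑ (λ a → sumℤ a ℤ.≟ + T cs)
       (choices (λ i → map +_ (padded Z N (Vec.lookup bs i) (values cs i)))))
    (convolve-kSUM (λ i → padded Z N (Vec.lookup bs i) (values cs i)) (λ s → indicator (does (s ℤ.≟ + T cs))))

-- Word sizes

-- Only the values stored are bounded here: the values of the subexpressions of a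
-- fixed program are polynomial in them.

data Exec (M : ℕ) : Program → Memory → ℕ → Memory → Set where
  skip : ∀ {m} → Exec M skip m 1 m
  store : ∀ {a e f m} → ∣ eval f m ∣ ≤ M →
          Exec M (store a e f) m 1 (m [ a , eval e m ]≔ eval f m)
  _⨾_ : ∀ {p q m m′ m″ s t} → Exec M p m s m′ → Exec M q m′ t m″ →
        Exec M (p ⨾ q) m (s + t) m″
  ifz-zero : ∀ {e p q m m′ t} → eval e m ≡ 0ℤ → Exec M p m t m′ → Exec M (ifz e p q) m (suc t) m′
  ifz-nonzero : ∀ {e p q m m′ t} → eval e m ≢ 0ℤ → Exec M q m t m′ → Exec M (ifz e p q) m (suc t) m′
  while-stop : ∀ {e p m} → eval e m ≡ 0ℤ → Exec M (while e p) m 1 m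
  while-step : ∀ {e p m m′ m″ s t} → eval e m ≢ 0ℤ → Exec M p m s m′ → Exec M (while e p) m′ t m″ →
               Exec M (while e p) m (suc (s + t)) m″

-- An exponent: if all cells are at most `M ≥ 2` in absolute value, then all values in an evaluation
-- are at most `M ^ exprWeight e`. A literal `z` is at most `2 ^ ∣ z ∣`; the successor keeps weights
-- positive, so that a sum of two bounds is at most their product.
exprWeight : Expr → ℕ
exprWeight (lit z)    = suc ∣ z ∣
exprWeight (read a e) = suc (exprWeight e)
exprWeight (op o e f) = exprWeight e + exprWeight f

programWeight : Program → ℕ
programWeight skip          = 0
programWeight (store a e f) = exprWeight e + exprWeight f
programWeight (p ⨾ q)       = programWeight p + programWeight q
programWeight (ifz e p q)   = exprWeight e + (programWeight p + programWeight q)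
programWeight (while e p)   = exprWeight e + programWeight p

Small : ℕ → Memory → Set
Small M m = ∀ a i → ∣ m a i ∣ ≤ M

small-store : ∀ {M m} a i {v} → Small M m → ∣ v ∣ ≤ M → Small M (m [ a , i ]≔ v)
small-store a i sm v≤ b j with does (a ≟ b) ∧ does (i ℤ.≟ j)
... | true  = v≤
... | false = sm b j

∣/ℕ∣-≤ : ∀ i d .{{_ : NonZero d}} → ∣ i ℤ./ℕ d ∣ ≤ ∣ i ∣
∣/ℕ∣-≤ (+ n)    d = m/n≤m n d
∣/ℕ∣-≤ -[1+ n ] d with suc n % d in e
... | zero  = ≤-trans (≤-reflexive (ℤ.∣-i∣≡∣i∣ (+ (suc n / d)))) (m/n≤m (suc n) d)
-- A negative quotient is rounded away from 0, which adds 1. A nonzero remainder forces `d > 1`, and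
-- the quotient before rounding is then strictly smaller than the dividend.
... | suc _ = m/n<m (suc n) d (1<d d e)
  where
  1<d : ∀ d .{{_ : NonZero d}} {r} → suc n % d ≡ suc r → 1 < d
  1<d 1             e with () ← trans (sym e) (n%1≡0 (suc n))
  1<d (suc (suc d)) _ = s≤s (s≤s z≤n)

∣/∣-≤ : ∀ i j .{{_ : ℤ.NonZero j}} → ∣ i ℤ./ j ∣ ≤ ∣ i ∣
∣/∣-≤ i j = ≤-trans (≤-reflexive (trans (ℤ.abs-* (ℤ.sign j ℤ.◃ 1) (i ℤ./ℕ ∣ j ∣))
                                        (trans (cong (_* ∣ i ℤ./ℕ ∣ j ∣ ∣) (ℤ.abs-◃ (ℤ.sign j) 1)) (*-identityˡ _))))
                    (∣/ℕ∣-≤ i ∣ j ∣)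

∣divide∣-≤ : ∀ i j → ∣ divide i j ∣ ≤ ∣ i ∣
∣divide∣-≤ i (+ zero)    = z≤n
∣divide∣-≤ i (+ (suc n)) = ∣/∣-≤ i (+ suc n)
∣divide∣-≤ i -[1+ n ]    = ∣/∣-≤ i -[1+ n ]

∣truth∣-≤ : ∀ b → ∣ truth b ∣ ≤ 1
∣truth∣-≤ true  = s≤s z≤n
∣truth∣-≤ false = z≤n

+≤* : ∀ {x y} → 2 ≤ x → 2 ≤ y → x + y ≤ x * y
+≤* {x} {y} 2≤x 2≤y with ≤-total x y
... | inj₁ x≤y = ≤-trans (+-monoˡ-≤ y x≤y) (≤-trans (≤-reflexive (cong (_+_ y) (sym (+-identityʳ y)))) (*-monoˡ-≤ y 2≤x))
... | inj₂ y≤x = ≤-trans (+-monoʳ-≤ x y≤x) (≤-trans (≤-reflexive (trans (cong (_+_ x) (sym (+-identityʳ x))) (*-comm 2 x))) (*-monoʳ-≤ x 2≤y))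

n<2^n : ∀ n → n < 2 ^ n
n<2^n zero    = s≤s z≤n
n<2^n (suc n) = ≤-trans (≤-reflexive (+-comm 1 (suc n))) (≤-trans (+-mono-≤ (n<2^n n) (≤-trans (s≤s z≤n) (n<2^n n))) (≤-reflexive lemma))
  where
  lemma : 2 ^ n + 2 ^ n ≡ 2 ^ suc n
  lemma = cong (_+_ (2 ^ n)) (sym (+-identityʳ (2 ^ n)))

module _ {M : ℕ} (2≤M : 2 ≤ M) where

  private
    instance
      M-nonZero : NonZero M
      M-nonZero = >-nonZero (≤-trans (s≤s z≤n) 2≤M)

  exprWeight>0 : ∀ e → 1 ≤ exprWeight e
  exprWeight>0 (lit z)    = s≤s z≤n
  exprWeight>0 (read a e) = s≤s z≤n
  exprWeight>0 (op o e f) = ≤-trans (exprWeight>0 e) (m≤m+n _ _)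

  M≤M^ : ∀ {w} → 1 ≤ w → M ≤ M ^ w
  M≤M^ 1≤w = ≤-trans (≤-reflexive (sym (*-identityʳ M))) (^-monoʳ-≤ M 1≤w)

  ∣eval∣-≤ : ∀ e {m} → Small M m → ∣ eval e m ∣ ≤ M ^ exprWeight e
  ∣op∣-≤ : ∀ o e f {m} → Small M m → ∣ eval (op o e f) m ∣ ≤ M ^ exprWeight e * M ^ exprWeight f
  ∣eval∣-≤ (lit z)    sm = ≤-trans (<⇒≤ (n<2^n ∣ z ∣))
    (≤-trans (^-monoˡ-≤ ∣ z ∣ 2≤M) (^-monoʳ-≤ M (n≤1+n ∣ z ∣)))
  ∣eval∣-≤ (read a e) sm = ≤-trans (sm a _) (M≤M^ {suc (exprWeight e)} (s≤s z≤n))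
  ∣eval∣-≤ (op o e f) sm = ≤-trans (∣op∣-≤ o e f sm)
    (≤-reflexive (sym (^-distribˡ-+-* M (exprWeight e) (exprWeight f))))
  ∣op∣-≤ o e f {m} sm = go o
    where
    x y : ℤ
    x = eval e m
    y = eval f m
    X Y : ℕ
    X = M ^ exprWeight e
    Y = M ^ exprWeight f
    ∣x∣≤ : ∣ x ∣ ≤ X
    ∣x∣≤ = ∣eval∣-≤ e sm
    ∣y∣≤ : ∣ y ∣ ≤ Y
    ∣y∣≤ = ∣eval∣-≤ f sm
    sum≤ : ∣ x ∣ + ∣ y ∣ ≤ X * Y
    sum≤ = ≤-trans (+-mono-≤ ∣x∣≤ ∣y∣≤)
      (+≤* (≤-trans 2≤M (M≤M^ (exprWeight>0 e))) (≤-trans 2≤M (M≤M^ (exprWeight>0 f))))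
    1≤XY : 1 ≤ X * Y
    1≤XY = *-mono-≤ (m^n>0 M (exprWeight e)) (m^n>0 M (exprWeight f))
    go : ∀ o → ∣ ⟦ o ⟧ᵒ x y ∣ ≤ X * Y
    go add   = ≤-trans (ℤ.∣i+j∣≤∣i∣+∣j∣ x y) sum≤
    go sub   = ≤-trans (ℤ.∣i-j∣≤∣i∣+∣j∣ x y) sum≤
    go mul   = ≤-trans (≤-reflexive (ℤ.abs-* x y)) (*-mono-≤ ∣x∣≤ ∣y∣≤)
    go div   = ≤-trans (∣divide∣-≤ x y) (≤-trans ∣x∣≤ (m≤m*n X Y {{m^n≢0 M (exprWeight f)}}))
    go less  = ≤-trans (∣truth∣-≤ (does (x ℤ.<? y))) 1≤XY
    go equal = ≤-trans (∣truth∣-≤ (does (x ℤ.≟ y))) 1≤XY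

  fits : ∀ {B} e {m} → Small M m → M ^ exprWeight e ≤ B → Fits B e m
  fits e@(lit z) {m} sm ≤B = ≤-trans (∣eval∣-≤ e {m} sm) ≤B
  fits e@(read a f) {m} sm ≤B = ≤-trans (∣eval∣-≤ e {m} sm) ≤B , fits f {m} sm (≤-trans (^-monoʳ-≤ M (n≤1+n (exprWeight f))) ≤B)
  fits e@(op o f g) {m} sm ≤B = ≤-trans (∣eval∣-≤ e {m} sm) ≤B
    , fits f {m} sm (≤-trans (^-monoʳ-≤ M (m≤m+n (exprWeight f) (exprWeight g))) ≤B)
    , fits g {m} sm (≤-trans (^-monoʳ-≤ M (m≤n+m (exprWeight g) (exprWeight f))) ≤B)

  exec⇒run : ∀ {B p m t m′} → Small M m → M ^ programWeight p ≤ B → Exec M p m t m′ →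
             Run B p m t m′ × Small M m′
  exec⇒run sm ≤B skip = skip , sm
  exec⇒run sm ≤B (store {a} {e} {f} {m} v≤) =
    store (fits e sm (≤-trans (^-monoʳ-≤ M (m≤m+n (exprWeight e) (exprWeight f))) ≤B))
          (fits f sm (≤-trans (^-monoʳ-≤ M (m≤n+m (exprWeight f) (exprWeight e))) ≤B)) ,
    small-store a (eval e m) sm v≤
  exec⇒run sm ≤B (_⨾_ {p} {q} x y) =
    let (x′ , sm′) = exec⇒run sm (≤-trans (^-monoʳ-≤ M (m≤m+n (programWeight p) (programWeight q))) ≤B) x
        (y′ , sm″) = exec⇒run sm′ (≤-trans (^-monoʳ-≤ M (m≤n+m (programWeight q) (programWeight p))) ≤B) y
    in x′ ⨾ y′ , sm″
  exec⇒run sm ≤B (ifz-zero {e} {p} {q} e≡0 x) =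
    let (x′ , sm′) = exec⇒run sm (≤-trans (^-monoʳ-≤ M (≤-trans (m≤m+n (programWeight p) (programWeight q))
                                                                (m≤n+m _ (exprWeight e)))) ≤B) x
    in ifz-zero (fits e sm (≤-trans (^-monoʳ-≤ M (m≤m+n (exprWeight e) _)) ≤B)) e≡0 x′ , sm′
  exec⇒run sm ≤B (ifz-nonzero {e} {p} {q} e≢0 x) =
    let (x′ , sm′) = exec⇒run sm (≤-trans (^-monoʳ-≤ M (≤-trans (m≤n+m (programWeight q) (programWeight p))
                                                                (m≤n+m _ (exprWeight e)))) ≤B) x
    in ifz-nonzero (fits e sm (≤-trans (^-monoʳ-≤ M (m≤m+n (exprWeight e) _)) ≤B)) e≢0 x′ , sm′
  exec⇒run sm ≤B (while-stop {e} {p} e≡0) =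
    while-stop (fits e sm (≤-trans (^-monoʳ-≤ M (m≤m+n (exprWeight e) (programWeight p))) ≤B)) e≡0 , sm
  exec⇒run sm ≤B (while-step {e} {p} e≢0 x y) =
    let (x′ , sm′) = exec⇒run sm (≤-trans (^-monoʳ-≤ M (m≤n+m (programWeight p) (exprWeight e))) ≤B) x
        (y′ , sm″) = exec⇒run sm′ ≤B y
    in while-step (fits e sm (≤-trans (^-monoʳ-≤ M (m≤m+n (exprWeight e) (programWeight p))) ≤B)) e≢0 x′ y′ , sm″

-- Relocation

-- Array 2 holds R, 3 the powers of 2, 4 the number of the call, 5 the base address of
-- its window, 6 the pointer to the end of the instance being written, 7 a loop
-- counter and 8 multiplicities. The arrays of the called program are those from 9 on.

base : Expr
base = read 5 (lit 0ℤ)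

relocateᵉ : Expr → Expr
relocateᵉ (lit z)    = lit z
relocateᵉ (read a e) = read (9 + a) (op add base (relocateᵉ e))
relocateᵉ (op o e f) = op o (relocateᵉ e) (relocateᵉ f)

relocate : Program → Program
relocate skip          = skip
relocate (store a e f) = store (9 + a) (op add base (relocateᵉ e)) (relocateᵉ f)
relocate (p ⨾ q)       = relocate p ⨾ relocate q
relocate (ifz e p q)   = ifz (relocateᵉ e) (relocate p) (relocate q)
relocate (while e p)   = while (relocateᵉ e) (relocate p)

-- Cells below `- H` are left out because they belong to the windows of earlier calls. There is no
-- upper limit: nothing beyond the current window has been written.
Represents : (b H : ℕ) → Memory → Memory → Set
Represents b H m μ = ∀ a i → ℤ.- + H ℤ.≤ i → m (9 + a) (+ b ℤ.+ i) ≡ μ a i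

represents-store : ∀ {b H m μ} a i v → Represents b H m μ →
                   Represents b H (m [ 9 + a , + b ℤ.+ i ]≔ v) (μ [ a , i ]≔ v)
represents-store {b} {H} {m} {μ} a i v rep a′ j -H≤j =
  cong₂ (λ c x → if does (a ≟ a′) ∧ c then v else x)
    (does-⇔ (mk⇔ (ℤ+.∙-cancelˡ (+ b) i j) (cong (ℤ._+_ (+ b)))) (+ b ℤ.+ i ℤ.≟ + b ℤ.+ j) (i ℤ.≟ j))
    (rep a′ j -H≤j)

∣i∣≤⇒-≤ : ∀ {i n} → ∣ i ∣ ≤ n → ℤ.- + n ℤ.≤ i
∣i∣≤⇒-≤ {+ _}      {n}     _ = ℤ.≤-trans (ℤ.neg-≤-pos {n} {0}) (ℤ.+≤+ z≤n)
∣i∣≤⇒-≤ { -[1+ _ ]} {suc n} (s≤s i≤n) = ℤ.-≤- i≤n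

fits⇒≤ : ∀ {B} e {m} → Fits B e m → ∣ eval e m ∣ ≤ B
fits⇒≤ (lit _)    f       = f
fits⇒≤ (read _ _) (f , _) = f
fits⇒≤ (op _ _ _) (f , _) = f

Frame : Memory → Memory → Set
Frame m m′ = ∀ {a} → a < 9 → ∀ j → m′ a j ≡ m a j

module _ {M B b H : ℕ} (B≤M : B ≤ M) (B≤H : B ≤ H) where

  eval-relocate : ∀ {m μ} e → m 5 0ℤ ≡ + b → Represents b H m μ → Fits B e μ →
                  eval (relocateᵉ e) m ≡ eval e μ
  eval-relocate (lit z)    m5 rep f       = refl
  eval-relocate {m} (read a e) m5 rep (_ , f) = trans
    (cong₂ (λ x y → m (9 + a) (x ℤ.+ y)) m5 (eval-relocate e m5 rep f))
    (rep a _ (∣i∣≤⇒-≤ (≤-trans (fits⇒≤ e f) B≤H)))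
  eval-relocate (op o e e′) m5 rep (_ , f , f′) =
    cong₂ ⟦ o ⟧ᵒ (eval-relocate e m5 rep f) (eval-relocate e′ m5 rep f′)

  run-relocate : ∀ {p μ t μ′ m} → m 5 0ℤ ≡ + b → Represents b H m μ → Run B p μ t μ′ →
                 ∃[ m′ ] Exec M (relocate p) m t m′ × Represents b H m′ μ′ × Frame m m′
  run-relocate {m = m} m5 rep skip = m , skip , rep , λ _ _ → refl
  run-relocate {μ = μ} {m = m} m5 rep (store {a} {e} {f} fe ff) =
    _ , store (≤-trans (≤-reflexive (cong ∣_∣ ef)) (≤-trans (fits⇒≤ f ff) B≤M)) ,
    subst₂ (λ x v → Represents b H (m [ 9 + a , x ]≔ v) (μ [ a , eval e μ ]≔ eval f μ))
      (sym (cong₂ ℤ._+_ m5 (eval-relocate e m5 rep fe))) (sym ef)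
      (represents-store {m = m} a (eval e μ) (eval f μ) rep) ,
    λ {c} c<9 j → cong (λ b → if b ∧ does (eval (op add base (relocateᵉ e)) m ℤ.≟ j) then eval (relocateᵉ f) m else m c j)
      (dec-false (9 + a ≟ c) (λ 9+a≡c → <⇒≱ c<9 (≤-trans (m≤m+n 9 a) (≤-reflexive 9+a≡c))))
    where
    ef : eval (relocateᵉ f) m ≡ eval f μ
    ef = eval-relocate f m5 rep ff
  run-relocate m5 rep (x ⨾ y) =
    let (m′ , x′ , rep′ , fr) = run-relocate m5 rep x
        (m″ , y′ , rep″ , fr′) = run-relocate (trans (fr (s≤s (s≤s (s≤s (s≤s (s≤s (s≤s z≤n)))))) 0ℤ) m5) rep′ y
    in m″ , x′ ⨾ y′ , rep″ , λ a<9 j → trans (fr′ a<9 j) (fr a<9 j)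
  run-relocate m5 rep (ifz-zero {e} fe e≡0 x) =
    let (m′ , x′ , rep′ , fr) = run-relocate m5 rep x
    in m′ , ifz-zero (trans (eval-relocate e m5 rep fe) e≡0) x′ , rep′ , fr
  run-relocate m5 rep (ifz-nonzero {e} fe e≢0 x) =
    let (m′ , x′ , rep′ , fr) = run-relocate m5 rep x
    in m′ , ifz-nonzero (e≢0 ∘ trans (sym (eval-relocate e m5 rep fe))) x′ , rep′ , fr
  run-relocate {m = m} m5 rep (while-stop {e} fe e≡0) =
    m , while-stop (trans (eval-relocate e m5 rep fe) e≡0) , rep , λ _ _ → refl
  run-relocate m5 rep (while-step {e} fe e≢0 x y) =
    let (m′ , x′ , rep′ , fr) = run-relocate m5 rep x
        (m″ , y′ , rep″ , fr′) = run-relocate (trans (fr (s≤s (s≤s (s≤s (s≤s (s≤s (s≤s z≤n)))))) 0ℤ) m5) rep′ y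
    in m″ , while-step (e≢0 ∘ trans (sym (eval-relocate e m5 rep fe))) x′ y′ , rep″ ,
       λ a<9 j → trans (fr′ a<9 j) (fr a<9 j)

-- A run gets stuck on an address that is not a word, so every address written is at most `B` in
-- absolute value. This keeps the windows of later calls fresh.
run-outside : ∀ {B p μ t μ′} → Run B p μ t μ′ → ∀ a i → B < ∣ i ∣ → μ′ a i ≡ μ a i
run-outside skip a i B<i = refl
run-outside {B} (store {c} {e} {f} {m} fe _) a i B<i =
  cong (λ b → if b then eval f m else m a i) (trans (cong (_∧_ (does (c ≟ a))) (dec-false (eval e m ℤ.≟ i) e≢i)) (∧-zeroʳ (does (c ≟ a))))
  where
  e≢i : eval e m ≢ i
  e≢i refl = <⇒≱ B<i (fits⇒≤ e fe)
run-outside (x ⨾ y)               a i B<i = trans (run-outside y a i B<i) (run-outside x a i B<i)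
run-outside (ifz-zero _ _ x)      a i B<i = run-outside x a i B<i
run-outside (ifz-nonzero _ _ x)   a i B<i = run-outside x a i B<i
run-outside (while-stop _ _)      a i B<i = refl
run-outside (while-step _ _ x y)  a i B<i = trans (run-outside y a i B<i) (run-outside x a i B<i)

-- Total correctness with time bounds

record Reaches (M : ℕ) (p : Program) (m : Memory) (t : ℕ) (Q : Memory → Set) : Set where
  constructor reaches
  field
    {time}   : ℕ
    {memory} : Memory
    exec     : Exec M p m time memory
    time≤    : time ≤ t
    post     : Q memory

module _ {M : ℕ} where

  reach-store : ∀ a e f {m} (Q : Memory → Set) → ∣ eval f m ∣ ≤ M → Q (m [ a , eval e m ]≔ eval f m) →
                Reaches M (store a e f) m 1 Q
  reach-store a e f Q v≤ q = reaches (store v≤) ≤-refl q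

  reach-⨾ : ∀ {p q m s t P Q} → Reaches M p m s P → (∀ {m′} → P m′ → Reaches M q m′ t Q) →
            Reaches M (p ⨾ q) m (s + t) Q
  reach-⨾ (reaches x x≤ P) k = let reaches y y≤ Q = k P in reaches (x ⨾ y) (+-mono-≤ x≤ y≤) Q

  reach-weaken : ∀ {p m s t P Q} → Reaches M p m s P → s ≤ t → (∀ {m′} → P m′ → Q m′) → Reaches M p m t Q
  reach-weaken (reaches x x≤ P) s≤t P⇒Q = reaches x (≤-trans x≤ s≤t) (P⇒Q P)

  -- The index of `Inv` is the exact number of iterations still to come, which gives termination and
  -- the time bound at once.
  reach-while : ∀ {e p} t (Inv : ℕ → Memory → Set) →
    (∀ {j m} → Inv (suc j) m → eval e m ≢ 0ℤ × Reaches M p m t (Inv j)) →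
    (∀ {m} → Inv 0 m → eval e m ≡ 0ℤ) →
    ∀ j {m} → Inv j m → Reaches M (while e p) m (j * suc t + 1) (Inv 0)
  reach-while t Inv step stop zero    inv = reaches (while-stop (stop inv)) ≤-refl inv
  reach-while t Inv step stop (suc j) inv =
    let (e≢0 , reaches x x≤ inv′) = step inv
        reaches y y≤ inv″ = reach-while t Inv step stop j inv′
    in reaches (while-step e≢0 x y)
         (≤-trans (s≤s (+-mono-≤ x≤ y≤)) (≤-reflexive (sym (+-assoc (suc t) (j * suc t) 1)))) inv″

infix 4 _⇓[_]_

-- A record instead of the bare equation, since `e` and `m` could not be inferred from the latter
-- once `eval` has reduced.
record _⇓[_]_ (e : Expr) (m : Memory) (n : ℕ) : Set where
  constructor value
  field eval≡ : eval e m ≡ + n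

open _⇓[_]_

infixl 6 _⊞_ _⊟_
infixl 7 _⊠_ _⊘_ _mod_

_⊞_ _⊟_ _⊠_ _⊘_ _mod_ : Expr → Expr → Expr
_⊞_ = op add
_⊟_ = op sub
_⊠_ = op mul
_⊘_ = op div
e mod f = e ⊟ (e ⊘ f) ⊠ f

nat : ℕ → Expr
nat n = lit (+ n)

scalar : Array → Expr
scalar a = read a (nat 0)

truth-indicator : ∀ b → truth b ≡ + indicator b
truth-indicator true  = refl
truth-indicator false = refl

module _ {m : Memory} where

  ⇓nat : ∀ {n} → nat n ⇓[ m ] n
  ⇓nat = value refl

  ⇓read : ∀ {a e i n} → e ⇓[ m ] i → m a (+ i) ≡ + n → read a e ⇓[ m ] n
  ⇓read {a} (value p) q = value (trans (cong (m a) p) q)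

  ⇓scalar : ∀ {a n} → m a 0ℤ ≡ + n → scalar a ⇓[ m ] n
  ⇓scalar = value

  ⇓+ : ∀ {e f a b} → e ⇓[ m ] a → f ⇓[ m ] b → e ⊞ f ⇓[ m ] a + b
  ⇓+ (value p) (value q) = value (cong₂ ℤ._+_ p q)

  ⇓* : ∀ {e f a b} → e ⇓[ m ] a → f ⇓[ m ] b → e ⊠ f ⇓[ m ] a * b
  ⇓* {a = a} {b} (value p) (value q) = value (trans (cong₂ ℤ._*_ p q) (sym (ℤ.pos-* a b)))

  ⇓/ : ∀ {e f a b} .{{_ : NonZero b}} → e ⇓[ m ] a → f ⇓[ m ] b → e ⊘ f ⇓[ m ] a / b
  ⇓/ {a = a} {suc b} (value p) (value q) = value (trans (cong₂ divide p q) (ℤ.*-identityˡ (+ (a / suc b))))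

  ⇓% : ∀ {e f a b} .{{_ : NonZero b}} → e ⇓[ m ] a → f ⇓[ m ] b → e mod f ⇓[ m ] a % b
  ⇓% {a = a} {b} p q = value (trans (cong₂ ℤ._-_ (eval≡ p) (eval≡ (⇓* (⇓/ p q) q)))
    (trans (ℤ.m-n≡m⊖n a (a / b * b)) (trans (ℤ.⊖-≥ (m/n*n≤m a b)) (cong +_ (sym (m%n≡m∸m/n*n a b))))))

  ⇓< : ∀ {e f a b} → e ⇓[ m ] a → f ⇓[ m ] b → op less e f ⇓[ m ] indicator (a <ᵇ b)
  ⇓< {a = a} {b} (value p) (value q) = value (trans (cong₂ ⟦ less ⟧ᵒ p q) (truth-indicator (a <ᵇ b)))

  ⇓≡ : ∀ {e f a b} → e ⇓[ m ] a → f ⇓[ m ] b → op equal e f ⇓[ m ] indicator (a ≡ᵇ b)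
  ⇓≡ {a = a} {b} (value p) (value q) = value (trans (cong₂ ⟦ equal ⟧ᵒ p q) (truth-indicator (a ≡ᵇ b)))

  less≡0 : ∀ {e f a b} → e ⇓[ m ] a → f ⇓[ m ] b → b ≤ a → eval (op less e f) m ≡ 0ℤ
  less≡0 {a = a} {b} p q b≤a = trans (eval≡ (⇓< p q)) (cong (+_ ∘ indicator) (dec-false (a <? b) (≤⇒≯ b≤a)))

  less≢0 : ∀ {e f a b} → e ⇓[ m ] a → f ⇓[ m ] b → a < b → eval (op less e f) m ≢ 0ℤ
  less≢0 {a = a} {b} p q a<b e≡0
    with () ← trans (sym e≡0) (trans (eval≡ (⇓< p q)) (cong (+_ ∘ indicator) (dec-true (a <? b) a<b)))

-- Expressions

nth-++ : ∀ xs ys j → nth (xs ++ ys) (length xs + j) ≡ nth ys j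
nth-++ []       ys j = refl
nth-++ (x ∷ xs) ys j = nth-++ xs ys j

nth-append : ∀ xs z j → nth (xs ++ z ∷ []) j ≡ (if length xs ≡ᵇ j then z else nth xs j)
nth-append []       z zero    = refl
nth-append []       z (suc j) = refl
nth-append (x ∷ xs) z zero    = refl
nth-append (x ∷ xs) z (suc j) = nth-append xs z j

nth-beyond : ∀ xs j → length xs ≤ j → nth xs j ≡ 0ℤ
nth-beyond []       j       _         = refl
nth-beyond (x ∷ xs) (suc j) (s≤s l≤j) = nth-beyond xs j l≤j

record SuffixAt (enc : List ℤ) (o : ℕ) (xs : List ℤ) : Set where
  constructor suffix
  field at : ∀ j → nth enc (o + j) ≡ nth xs j
open SuffixAt

suffix-drop : ∀ {enc o} xs {ys} → SuffixAt enc o (xs ++ ys) → SuffixAt enc (o + length xs) ys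
suffix-drop {enc} {o} xs {ys} s = suffix λ j →
  trans (cong (nth enc) (+-assoc o (length xs) j)) (trans (at s (length xs + j)) (nth-++ xs ys j))

suffix-head : ∀ {enc o x xs} → SuffixAt enc o (x ∷ xs) → nth enc o ≡ x
suffix-head {enc} {o} s = trans (cong (nth enc) (sym (+-identityʳ o))) (at s 0)

suffix-tail : ∀ {enc o x xs} → SuffixAt enc o (x ∷ xs) → SuffixAt enc (o + 1) xs
suffix-tail {x = x} s = suffix-drop (x ∷ []) s

Input : List ℤ → (ℤ → ℤ) → Set
Input enc m0 = ∀ j → m0 (+ j) ≡ nth enc j

infixr 8 _⊛_

_⊛_ : Expr → ℕ → Expr
e ⊛ zero  = nat 1
e ⊛ suc n = e ⊠ e ⊛ n

⇓⊛ : ∀ {m e a} n → e ⇓[ m ] a → e ⊛ n ⇓[ m ] a ^ n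
⇓⊛ zero    p = ⇓nat
⇓⊛ (suc n) p = ⇓* p (⇓⊛ n p)

-- A block is a length followed by that many vectors of `d` entries. As `k` is fixed, the start of
-- every block is an expression of constant size in the stored lengths and needs no variable.
afterBlock : ℕ → Expr → Expr
afterBlock d off = off ⊞ nat 1 ⊞ read 0 off ⊠ nat d

afterBlocks : ∀ {k} → (Fin k → ℕ) → Expr → Expr
afterBlocks {zero}  d off = off
afterBlocks {suc k} d off = afterBlocks (d ∘ suc) (afterBlock (d zero) off)

totalLength : ∀ {k} → (Fin k → ℕ) → Expr → Expr
totalLength {zero}  d off = nat 0
totalLength {suc k} d off = read 0 off ⊞ totalLength (d ∘ suc) (afterBlock (d zero) off)

block : ∀ {d} → List (Vec ℤ d) → List ℤ
block xs = + length xs ∷ concatMap Vec.toList xs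

blocks : ∀ {k} {d : Fin k → ℕ} → (∀ i → List (Vec ℤ (d i))) → List ℤ
blocks A = concat (tabulate (λ i → block (A i)))

length-entries : ∀ {d} (xs : List (Vec ℤ d)) → length (concatMap Vec.toList xs) ≡ length xs * d
length-entries []       = refl
length-entries (x ∷ xs) = trans (length-++ (Vec.toList x)) (cong₂ _+_ (Vec.length-toList x) (length-entries xs))

suffix-block : ∀ {d} (xs : List (Vec ℤ d)) {enc o ys} → SuffixAt enc o (block xs ++ ys) →
               SuffixAt enc (o + 1 + length xs * d) ys
suffix-block {d} xs {enc} {o} {ys} s = subst (λ n → SuffixAt enc (o + 1 + n) ys) (length-entries xs)
  (suffix-drop (concatMap Vec.toList xs) (suffix-tail s))

blocks-suc : ∀ {k} {d : Fin (suc k) → ℕ} (A : ∀ i → List (Vec ℤ (d i))) {enc o ys} →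
  SuffixAt enc o (blocks A ++ ys) → SuffixAt enc o (block (A zero) ++ blocks (A ∘ suc) ++ ys)
blocks-suc A {enc} {o} {ys} = subst (SuffixAt enc o) (++-assoc (block (A zero)) (blocks (A ∘ suc)) ys)

module _ {enc : List ℤ} {m : Memory} (inp : Input enc (m 0)) where

  ⇓nth : ∀ {e o n} → e ⇓[ m ] o → nth enc o ≡ + n → read 0 e ⇓[ m ] n
  ⇓nth p q = ⇓read p (trans (inp _) q)

  ⇓afterBlock : ∀ {d} (xs : List (Vec ℤ d)) {off o ys} → off ⇓[ m ] o → SuffixAt enc o (block xs ++ ys) →
    afterBlock d off ⇓[ m ] o + 1 + length xs * d
  ⇓afterBlock xs p s = ⇓+ (⇓+ p ⇓nat) (⇓* (⇓nth p (suffix-head s)) ⇓nat)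

  ⇓totalLength : ∀ {k} {d : Fin k → ℕ} (A : ∀ i → List (Vec ℤ (d i))) {off o ys} →
    off ⇓[ m ] o → SuffixAt enc o (blocks A ++ ys) → totalLength d off ⇓[ m ] ∑ᶠ (length ∘ A)
  ⇓totalLength {zero}  A p s = ⇓nat
  ⇓totalLength {suc k} A p s = let s′ = blocks-suc A s in
    ⇓+ (⇓nth p (suffix-head s′))
       (⇓totalLength (A ∘ suc) (⇓afterBlock (A zero) p s′) (suffix-block (A zero) s′))

  ⇓afterBlocks : ∀ {k} {d : Fin k → ℕ} (A : ∀ i → List (Vec ℤ (d i))) {off o ys} →
    off ⇓[ m ] o → SuffixAt enc o (blocks A ++ ys) →
    ∃[ o′ ] afterBlocks d off ⇓[ m ] o′ × SuffixAt enc o′ ys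
  ⇓afterBlocks {zero}  A {o = o} p s = o , p , s
  ⇓afterBlocks {suc k} A p s = let s′ = blocks-suc A s in
    ⇓afterBlocks (A ∘ suc) (⇓afterBlock (A zero) p s′) (suffix-block (A zero) s′)

dotAt : ∀ {d} → Vec ℤ d → Expr → Expr
dotAt []       e = nat 0
dotAt (α ∷ αs) e = lit α ⊠ read 0 e ⊞ dotAt αs (e ⊞ nat 1)

eval-dotAt : ∀ {enc m} → Input enc (m 0) → ∀ {d} (αs xs : Vec ℤ d) {e o ys} →
  e ⇓[ m ] o → SuffixAt enc o (Vec.toList xs ++ ys) → eval (dotAt αs e) m ≡ dot αs xs
eval-dotAt             inp []       []       p s = refl
eval-dotAt {enc} {m} inp (α ∷ αs) (x ∷ xs) {o = o} p s = cong₂ ℤ._+_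
  (cong (ℤ._*_ α) (trans (cong (m 0) (eval≡ p)) (trans (inp o) (suffix-head s))))
  (eval-dotAt {enc} {m} inp αs xs (⇓+ p ⇓nat) (suffix-tail s))

data Evaluates (m : Memory) : ∀ {n} → Vec Expr n → Vec ℕ n → Set where
  []  : Evaluates m [] []
  _∷_ : ∀ {n e x} {es : Vec Expr n} {xs} → e ⇓[ m ] x → Evaluates m es xs → Evaluates m (e ∷ es) (x ∷ xs)

data Decides (m : Memory) : List Expr → List Bool → Set where
  []  : Decides m [] []
  _∷_ : ∀ {e b es bs} → e ⇓[ m ] indicator b → Decides m es bs → Decides m (e ∷ es) (b ∷ bs)

digitsᵉ : Expr → ∀ D → Expr → Vec Expr D
digitsᵉ r zero    q = []
digitsᵉ r (suc D) q = q mod r ∷ digitsᵉ r D (q ⊘ r)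

dropDigitsᵉ : Expr → ℕ → Expr → Expr
dropDigitsᵉ r zero    q = q
dropDigitsᵉ r (suc D) q = dropDigitsᵉ r D (q ⊘ r)

module _ {m : Memory} {R : ℕ} .{{_ : NonZero R}} {r : Expr} (⇓r : r ⇓[ m ] R) where

  ⇓digits : ∀ D {e q} → e ⇓[ m ] q → Evaluates m (digitsᵉ r D e) (digits R D q)
  ⇓digits zero    p = []
  ⇓digits (suc D) p = ⇓% p ⇓r ∷ ⇓digits D (⇓/ p ⇓r)

  ⇓dropDigits : ∀ D {e q} → e ⇓[ m ] q → dropDigitsᵉ r D e ⇓[ m ] dropDigits R D q
  ⇓dropDigits zero    p = p
  ⇓dropDigits (suc D) p = ⇓dropDigits D (⇓/ p ⇓r)

shiftᵉ : Expr → Expr → Expr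
shiftᵉ x ℓ = x ⊘ read 3 ℓ

-- Successors are written with `nat 1` on the left, because `1 + n` computes to `suc n`.
packᵉ : Expr → ∀ {m} → Vec Expr m → Vec Expr (m * 3) → Expr
packᵉ y {zero}  us cs               = nat 0
packᵉ y {suc m} us (ℓ ∷ _ ∷ _ ∷ cs) =
  shiftᵉ (Vec.head us) ℓ ⊞ nat 3 ⊞ y ⊠ (shiftᵉ (Vec.head us) (nat 1 ⊞ ℓ) ⊞ nat 3 ⊞ y ⊠ packᵉ y (Vec.tail us) cs)

targetᵉ : Expr → ∀ {m} → Vec Expr m → Vec Expr (m * 3) → Expr
targetᵉ y {zero}  τs cs                 = nat 0
targetᵉ y {suc m} τs (ℓ ∷ δ′ ∷ δ ∷ cs) =
  shiftᵉ (Vec.head τs) ℓ ⊞ δ ⊞ y ⊠ (shiftᵉ (Vec.head τs) (nat 1 ⊞ ℓ) ⊞ δ′ ⊞ y ⊠ targetᵉ y (Vec.tail τs) cs)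

smallᵉ : ℕ → Expr → Expr
smallᵉ k δ = op less (nat (k * 2)) δ ⊠ op less δ (nat (k * 4))

validityᵉ : ℕ → ∀ m → Vec Expr (m * 3) → Expr
validityᵉ k zero    cs                 = nat 1
validityᵉ k (suc m) (ℓ ∷ δ′ ∷ δ ∷ cs) =
  smallᵉ k δ′ ⊠ op equal (ℓ ⊠ smallᵉ k δ) (nat 0) ⊠ validityᵉ k m cs

cmpᵉ : Comparison → Expr → Expr → Expr
cmpᵉ eq x y = op equal x y
cmpᵉ le x y = nat 1 ⊟ op less y x
cmpᵉ lt x y = op less x y
cmpᵉ ge x y = nat 1 ⊟ op less x y
cmpᵉ gt x y = op less y x

claimsᵉ : ℕ → ∀ {m} → Vec Comparison m → Vec Expr (m * 3) → List Expr
claimsᵉ k []       cs                = []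
claimsᵉ k (r ∷ rs) (_ ∷ _ ∷ δ ∷ cs) = cmpᵉ r δ (nat (k * 3)) ∷ claimsᵉ k rs cs

decideᵉ : ∀ {k} {d : Fin k → ℕ} {l} → Formula d l → List Expr → Expr × List Expr
decideᵉ (linear _ _ _ _) []       = nat 0 , []
decideᵉ (linear _ _ _ _) (e ∷ es) = e , es
decideᵉ (not ψ) es   = let (e , es′) = decideᵉ ψ es in nat 1 ⊟ e , es′
decideᵉ (ψ and χ) es = let (e , es′) = decideᵉ ψ es ; (f , es″) = decideᵉ χ es′ in e ⊠ f , es″
decideᵉ (ψ or χ) es  = let (e , es′) = decideᵉ ψ es ; (f , es″) = decideᵉ χ es′ in e ⊞ f ⊟ e ⊠ f , es″

weightOfBitsᵉ : ∀ {k} → Vec Expr k → Expr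
weightOfBitsᵉ []       = nat 1
weightOfBitsᵉ (b ∷ bs) = read 3 b ⊠ weightOfBitsᵉ bs

-- The bound `R` is included: a level `ℓ < R` also needs the shift by `suc ℓ`, and the radix `Y`
-- contains `2 ^ R`.
PowersOf2 : ℕ → (ℤ → ℤ) → Set
PowersOf2 R m3 = ∀ i → i ≤ R → m3 (+ i) ≡ + (2 ^ i)

module _ {m : Memory} {R : ℕ} (pow : PowersOf2 R (m 3)) where

  ⇓pow : ∀ {e ℓ} → e ⇓[ m ] ℓ → ℓ ≤ R → read 3 e ⇓[ m ] 2 ^ ℓ
  ⇓pow p ℓ≤R = ⇓read p (pow _ ℓ≤R)

  ⇓shift : ∀ {e f x ℓ} → e ⇓[ m ] x → f ⇓[ m ] ℓ → ℓ ≤ R → shiftᵉ e f ⇓[ m ] shift x ℓ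
  ⇓shift {ℓ = ℓ} p q ℓ≤R = ⇓/ {{m^n≢0 2 ℓ}} p (⇓pow q ℓ≤R)

  module _ {y : Expr} {Y : ℕ} (⇓y : y ⇓[ m ] Y) where

    ⇓pack : ∀ {n} {us : Vec Expr n} {U cs CS} → Evaluates m us U → Evaluates m cs CS → All< R CS →
            packᵉ y us cs ⇓[ m ] pack Y U CS
    ⇓pack []         []                   _                 = ⇓nat
    ⇓pack (⇓u ∷ ⇓us) (⇓ℓ ∷ _ ∷ _ ∷ ⇓cs) (ℓ<R ∷ _ ∷ _ ∷ cs<) =
      ⇓+ (⇓+ (⇓shift ⇓u ⇓ℓ (<⇒≤ ℓ<R)) ⇓nat) (⇓* ⇓y
        (⇓+ (⇓+ (⇓shift ⇓u (⇓+ ⇓nat ⇓ℓ) ℓ<R) ⇓nat) (⇓* ⇓y (⇓pack ⇓us ⇓cs cs<))))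

    ⇓target : ∀ {n} {τs : Vec Expr n} {T cs CS} → Evaluates m τs T → Evaluates m cs CS → All< R CS →
              targetᵉ y τs cs ⇓[ m ] target Y T CS
    ⇓target []         []                         _                 = ⇓nat
    ⇓target (⇓τ ∷ ⇓τs) (⇓ℓ ∷ ⇓δ′ ∷ ⇓δ ∷ ⇓cs) (ℓ<R ∷ _ ∷ _ ∷ cs<) =
      ⇓+ (⇓+ (⇓shift ⇓τ ⇓ℓ (<⇒≤ ℓ<R)) ⇓δ) (⇓* ⇓y
        (⇓+ (⇓+ (⇓shift ⇓τ (⇓+ ⇓nat ⇓ℓ) ℓ<R) ⇓δ′) (⇓* ⇓y (⇓target ⇓τs ⇓cs cs<))))

  ⇓weightOfBits : ∀ {k} {bs : Vec Expr k} {BS} → Evaluates m bs BS → All< R BS →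
                  weightOfBitsᵉ bs ⇓[ m ] weightOfBits BS
  ⇓weightOfBits []         []          = ⇓nat
  ⇓weightOfBits (⇓b ∷ ⇓bs) (b<R ∷ bs<) = ⇓* (⇓pow ⇓b (<⇒≤ b<R)) (⇓weightOfBits ⇓bs bs<)

module _ {m : Memory} where

  ⇓small : ∀ k {e δ} → e ⇓[ m ] δ → smallᵉ k e ⇓[ m ] indicator (small k δ)
  ⇓small k {δ = δ} p = subst (λ n → smallᵉ k _ ⇓[ m ] n) (sym (indicator-∧ (k * 2 <ᵇ δ) (δ <ᵇ k * 4)))
    (⇓* (⇓< ⇓nat p) (⇓< p ⇓nat))

  ⇓validity : ∀ k n {cs CS} → Evaluates m cs CS → validityᵉ k n cs ⇓[ m ] validity k n CS
  ⇓validity k zero    []                      = ⇓nat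
  ⇓validity k (suc n) (⇓ℓ ∷ ⇓δ′ ∷ ⇓δ ∷ ⇓cs) =
    ⇓* (⇓* (⇓small k ⇓δ′) (⇓≡ (⇓* ⇓ℓ (⇓small k ⇓δ)) ⇓nat)) (⇓validity k n ⇓cs)

  ⇓not : ∀ {e b} → e ⇓[ m ] indicator b → nat 1 ⊟ e ⇓[ m ] indicator (Bool.not b)
  ⇓not {b = true}  (value p) = value (cong (ℤ._-_ 1ℤ) p)
  ⇓not {b = false} (value p) = value (cong (ℤ._-_ 1ℤ) p)

  ⇓and : ∀ {e f b c} → e ⇓[ m ] indicator b → f ⇓[ m ] indicator c → e ⊠ f ⇓[ m ] indicator (b ∧ c)
  ⇓and {b = b} {c} p q = subst (λ n → _ ⇓[ m ] n) (sym (indicator-∧ b c)) (⇓* p q)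

  ⇓or : ∀ {e f b c} → e ⇓[ m ] indicator b → f ⇓[ m ] indicator c → e ⊞ f ⊟ e ⊠ f ⇓[ m ] indicator (b ∨ c)
  ⇓or {b = b} {c} (value p) (value q) = value (trans (cong₂ (λ x y → x ℤ.+ y ℤ.- x ℤ.* y) p q) (∨-value b c))
    where
    ∨-value : ∀ b c → let x = + indicator b ; y = + indicator c in x ℤ.+ y ℤ.- x ℤ.* y ≡ + indicator (b ∨ c)
    ∨-value true  true  = refl
    ∨-value true  false = refl
    ∨-value false true  = refl
    ∨-value false false = refl

  ⇓cmp : ∀ r {e f a b} → e ⇓[ m ] a → f ⇓[ m ] b → cmpᵉ r e f ⇓[ m ] indicator (cmp r a b)
  ⇓cmp eq p q = ⇓≡ p q
  ⇓cmp lt p q = ⇓< p q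
  ⇓cmp gt p q = ⇓< q p
  ⇓cmp le {a = a} {b} p q = subst (λ x → _ ⇓[ m ] indicator x) (not-< b a) (⇓not (⇓< q p))
    where
    not-< : ∀ b a → Bool.not (b <ᵇ a) ≡ (a ≤ᵇ b)
    not-< b a with a ≤? b
    ... | yes a≤b = trans (cong Bool.not (dec-false (b <? a) (≤⇒≯ a≤b))) (sym (dec-true (a ≤? b) a≤b))
    ... | no a≰b  = trans (cong Bool.not (dec-true (b <? a) (≰⇒> a≰b))) (sym (dec-false (a ≤? b) a≰b))
  ⇓cmp ge p q = ⇓cmp le q p

  ⇓claims : ∀ {k n} (rs : Vec Comparison n) {cs CS} → Evaluates m cs CS →
            Decides m (claimsᵉ k rs cs) (claims k rs CS)
  ⇓claims []       []                   = []
  ⇓claims (r ∷ rs) (_ ∷ _ ∷ ⇓δ ∷ ⇓cs) = ⇓cmp r ⇓δ ⇓nat ∷ ⇓claims rs ⇓cs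

  ⇓decide : ∀ {k} {d : Fin k → ℕ} {l} (ψ : Formula d l) {es bs} → Decides m es bs →
    proj₁ (decideᵉ ψ es) ⇓[ m ] indicator (proj₁ (decide ψ bs)) ×
    Decides m (proj₂ (decideᵉ ψ es)) (proj₂ (decide ψ bs))
  ⇓decide (linear _ _ _ _) []       = ⇓nat , []
  ⇓decide (linear _ _ _ _) (p ∷ ps) = p , ps
  ⇓decide (not ψ)   ps = let (q , qs) = ⇓decide ψ ps in ⇓not q , qs
  ⇓decide (ψ and χ) ps = let (q , qs) = ⇓decide ψ ps ; (q′ , qs′) = ⇓decide χ qs in ⇓and q q′ , qs′
  ⇓decide (ψ or χ)  ps = let (q , qs) = ⇓decide ψ ps ; (q′ , qs′) = ⇓decide χ qs in ⇓or q q′ , qs′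

-- The arrays are separate parameters of these records, so that a store to another
-- array preserves them definitionally.

record Globals (enc : List ℤ) (R : ℕ) (m0 m2 m3 : ℤ → ℤ) : Set where
  field
    input  : Input enc m0
    radix  : m2 0ℤ ≡ + R
    powers : PowersOf2 R m3

record Core (enc : List ℤ) (R acc q b : ℕ) (m0 m1 m2 m3 m4 m5 : ℤ → ℤ) : Set where
  field
    globals : Globals enc R m0 m2 m3
    output≡ : m1 0ℤ ≡ + acc
    index≡  : m4 0ℤ ≡ + q
    base≡   : m5 0ℤ ≡ + b

-- Writing the instances

pointer counter : Expr
pointer = scalar 6
counter = scalar 7

emit : Expr → Program
emit e = store 9 pointer e ⨾ store 6 (nat 0) (nat 1 ⊞ pointer)

emitted : Memory → ℤ → Memory
emitted m z = (m [ 9 , m 6 0ℤ ]≔ z) [ 6 , 0ℤ ]≔ (1ℤ ℤ.+ m 6 0ℤ)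

advance : Program
advance = store 7 (nat 0) (nat 1 ⊞ counter)

-- Arithmetic selection between the padding `z ⊞ counter`, for bit 0, and `v`, for bit 1.
valueSlot : Expr → Expr → Expr → Expr
valueSlot z bit v =
  z ⊞ counter ⊞ shiftᵉ (read 8 v) bit mod nat 2 ⊠ (v ⊟ (z ⊞ counter))

elementAt : ℕ → Expr → Expr
elementAt d off = off ⊞ nat 1 ⊞ counter ⊠ nat d

-- Multiplicities are stored at the address given by the value itself, so counting takes linear
-- time. The values are polynomial in `N` and hence legal addresses.
countValues : Expr → Expr → Program
countValues len v =
  store 7 (nat 0) (nat 0) ⨾
  while (op less counter len) (store 8 v (nat 1 ⊞ read 8 v) ⨾ advance)

emitValues : Expr → Expr → Expr → Expr → Program
emitValues z bit len v =
  store 7 (nat 0) (nat 0) ⨾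
  while (op less counter len) (emit (valueSlot z bit v) ⨾ store 8 v (nat 0) ⨾ advance)

-- The counter is not reset: it continues from the length of the set, which makes these paddings
-- differ from those already written.
emitPadding : Expr → Expr → Program
emitPadding z n = while (op less counter n) (emit (z ⊞ counter) ⨾ advance)

buildSet : (n z : Expr) → ℕ → (Expr → Expr) → (bit off : Expr) → Program
buildSet n z d v bit off =
  emit n ⨾
  countValues (read 0 off) (v (elementAt d off)) ⨾
  emitValues z bit (read 0 off) (v (elementAt d off)) ⨾
  emitPadding z n

buildSets : (n z : Expr) → ∀ {k} (d : Fin k → ℕ) → (Fin k → Expr → Expr) → Vec Expr k → Expr → Program
buildSets n z d v []       off = skip
buildSets n z d v (b ∷ bs) off =
  buildSet n z (d zero) (v zero) b off ⨾ buildSets n z (d ∘ suc) (v ∘ suc) bs (afterBlock (d zero) off)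

Counts : (ℕ → ℕ) → (ℤ → ℤ) → Set
Counts c m8 = ∀ x → m8 (+ x) ≡ + c x

counts-store : ∀ {c} m {i z v n} → Counts c (m 8) → i ≡ + v → z ≡ + n →
               Counts (c [ v ↦ n ]) ((m [ 8 , i ]≔ z) 8)
counts-store m {v = v} {n} cs refl refl x with v ≡ᵇ x
... | true  = refl
... | false = cs x

-- One iteration of the counting, emitting and padding loops takes 3, 5 and 4 steps.
setTime : ℕ → ℕ
setTime N = 12 * suc N

module Build (enc : List ℤ) (R N Z M acc q b H : ℕ) (Z+N≤M : Z + N ≤ M) where

  Context : Memory → Set
  Context m = Core enc R acc q b (m 0) (m 1) (m 2) (m 3) (m 4) (m 5)

  -- At every moment the window looks like the initial memory of the called program on what has been
  -- written so far, so that at the end the run can start as it is.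
  record Building (xs : List ℤ) (m : Memory) : Set where
    field
      core     : Context m
      pointer≡ : m 6 0ℤ ≡ + (b + length xs)
      local    : Represents b H m (initial xs)

  open Building

  initial-append : ∀ xs z a i → (initial xs [ 0 , + length xs ]≔ z) a i ≡ initial (xs ++ z ∷ []) a i
  initial-append xs z zero    (+ j)    = sym (nth-append xs z j)
  initial-append xs z zero    -[1+ j ] = refl
  initial-append xs z (suc a) i        = refl

  building-emitted : ∀ {xs m} z → Building xs m → Building (xs ++ z ∷ []) (emitted m z)
  building-emitted {xs} {m} z B = record
    { core     = core B
    ; pointer≡ = trans (cong (ℤ._+_ 1ℤ) (pointer≡ B))
        (cong +_ (trans (sym (+-suc b (length xs))) (cong (_+_ b) (trans (+-comm 1 (length xs)) (sym (length-++ xs))))))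
    ; local    = λ a i -H≤i → trans
        (cong (λ p → (m [ 9 , p ]≔ z) (9 + a) (+ b ℤ.+ i)) (pointer≡ B))
        (trans (represents-store {b} {H} {m} 0 (+ length xs) z (local B) a i -H≤i) (initial-append xs z a i))
    }

  reach-emit : ∀ e {n m xs} (Q : Memory → Set) → Building xs m → e ⇓[ m ] n → n ≤ M →
               b + suc (length xs) ≤ M → Q (emitted m (+ n)) → Reaches M (emit e) m 2 Q
  reach-emit e {n} {m} {xs} Q B (value p) n≤M p≤M post =
    reach-⨾ {P = λ m′ → m′ ≡ m [ 9 , m 6 0ℤ ]≔ (+ n)}
      (reach-store 9 pointer e _ (≤-trans (≤-reflexive (cong ∣_∣ p)) n≤M) (cong (m [ 9 , m 6 0ℤ ]≔_) p))
      λ { refl → reach-store 6 (nat 0) (nat 1 ⊞ pointer) Q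
            (≤-trans (≤-reflexive (trans (cong (λ x → ∣ 1ℤ ℤ.+ x ∣) (pointer≡ B)) (sym (+-suc b (length xs))))) p≤M)
            post }

  -- The expression is right in every memory with the given `Context`, because pointer, counter and
  -- multiplicities change between its evaluations.
  Computes : ∀ {d} → (Expr → Expr) → (Vec ℤ d → ℕ) → Vec ℤ d → Set
  Computes v f x = f x < Z × (∀ {m e o ys} → Context m →
    e ⇓[ m ] o → SuffixAt enc o (Vec.toList x ++ ys) → v e ⇓[ m ] f x)

  module SetLoops (d : ℕ) (v : Expr → Expr) (f : Vec ℤ d → ℕ)
             (set : List (Vec ℤ d)) (len≤N : length set ≤ N)
             (values : All (Computes v f) set)
             (off : Expr) (o : ℕ) (⇓off : ∀ {m} → Context m → off ⇓[ m ] o)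
             (ys : List ℤ) (at-o : SuffixAt enc o (block set ++ ys)) where

    len : ℕ
    len = length set

    element : Expr
    element = elementAt d off

    N≤M : N ≤ M
    N≤M = ≤-trans (m≤n+m N Z) Z+N≤M

    record At (post : List (Vec ℤ d)) (r : ℕ) (i : ℤ) : Set where
      field
        counter≡ : i ≡ + r
        total    : r + length post ≡ len
        good     : All (Computes v f) post
        remaining : SuffixAt enc (o + 1 + r * d) (concatMap Vec.toList post ++ ys)
    open At

    ⇓len : ∀ {m} → Context m → read 0 off ⇓[ m ] len
    ⇓len g = ⇓nth {enc} (Globals.input (Core.globals g)) (⇓off g) (suffix-head at-o)

    ⇓element : ∀ {m r} → Context m → m 7 0ℤ ≡ + r → element ⇓[ m ] o + 1 + r * d
    ⇓element g c = ⇓+ (⇓+ (⇓off g) ⇓nat) (⇓* (⇓scalar c) ⇓nat)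

    start : At set 0 0ℤ
    start = record
      { counter≡ = refl
      ; total    = refl
      ; good     = values
      ; remaining = subst (λ n → SuffixAt enc n (concatMap Vec.toList set ++ ys)) (sym (+-identityʳ (o + 1))) (suffix-tail at-o)
      }

    remaining′ : ∀ {x post r i} → At (x ∷ post) r i →
            SuffixAt enc (o + 1 + r * d) (Vec.toList x ++ concatMap Vec.toList post ++ ys)
    remaining′ {x} {post} {r} a =
      subst (SuffixAt enc (o + 1 + r * d)) (++-assoc (Vec.toList x) (concatMap Vec.toList post) ys) (remaining a)

    ⇓value : ∀ {x post r m} → Context m → At (x ∷ post) r (m 7 0ℤ) → v element ⇓[ m ] f x
    ⇓value g a = proj₂ (All.head (good a)) g (⇓element g (counter≡ a)) (remaining′ a)

    r<len : ∀ {x post r i} → At (x ∷ post) r i → r < len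
    r<len {post = post} {r} a = ≤-trans (m≤m+n (suc r) (length post))
      (≤-reflexive (trans (sym (+-suc r (length post))) (total a)))

    next : ∀ {x post r i} → At (x ∷ post) r i → At post (suc r) (1ℤ ℤ.+ i)
    next {x} {post} {r} a = record
      { counter≡ = cong (ℤ._+_ 1ℤ) (counter≡ a)
      ; total    = trans (sym (+-suc r (length post))) (total a)
      ; good     = All.tail (good a)
      ; remaining = subst (λ n → SuffixAt enc n (concatMap Vec.toList post ++ ys))
          (trans (cong (_+_ (o + 1 + r * d)) (Vec.length-toList x))
            (trans (+-assoc (o + 1) (r * d) d) (cong (_+_ (o + 1)) (+-comm (r * d) d))))
          (suffix-drop (Vec.toList x) (remaining′ a))
      }

    -- The field `rest` says what remains to be done; it is trivial at the start and gives the
    -- result when nothing is left. The bound `c≤r` makes the stored multiplicities fit into the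
    -- memory bound.
    record Counting (xs : List ℤ) (j : ℕ) (m : Memory) : Set where
      field
        post     : List (Vec ℤ d)
        r        : ℕ
        c        : ℕ → ℕ
        left     : length post ≡ j
        building : Building xs m
        at       : At post r (m 7 0ℤ)
        counts   : Counts c (m 8)
        c≤r      : ∀ x → c x ≤ r
        rest     : foldl increment c (map f post) ≡ tally (map f set)

    reach-countValues : ∀ {xs m} → Building xs m → Counts (λ _ → 0) (m 8) →
      Reaches M (countValues (read 0 off) (v element)) m (1 + (len * 3 + 1))
        (λ m′ → Building xs m′ × Counts (tally (map f set)) (m′ 8))
    reach-countValues {xs} {m} B cs = reach-⨾ {P = Counting xs len}
      (reach-store 7 (nat 0) (nat 0) (Counting xs len) z≤n record
        { post = set ; r = 0 ; c = λ _ → 0 ; left = refl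
        -- A store to another array preserves each field definitionally, but not the record, whose
        -- type mentions the whole memory; so it is taken apart and rebuilt.
        ; building = record { core = core B ; pointer≡ = pointer≡ B ; local = local B }
        ; at = start ; counts = cs ; c≤r = λ _ → z≤n ; rest = refl })
      (λ inv → reach-weaken (reach-while 2 (Counting xs) step stop len inv) ≤-refl finish)
      where
      step : ∀ {j m} → Counting xs (suc j) m → eval (op less counter (read 0 off)) m ≢ 0ℤ ×
             Reaches M (store 8 (v element) (nat 1 ⊞ read 8 (v element)) ⨾ advance) m 2 (Counting xs j)
      step {m = m} record { post = x ∷ post ; r = r ; c = c ; left = left ; building = B ; at = a ; counts = cs ; c≤r = c≤r ; rest = rest } =
        less≢0 {m = m} (⇓scalar (counter≡ a)) (⇓len g) (r<len a) ,
        reach-⨾ {P = λ m′ → m′ ≡ m [ 8 , eval (v element) m ]≔ eval (nat 1 ⊞ read 8 (v element)) m}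
          (reach-store 8 (v element) (nat 1 ⊞ read 8 (v element)) _
            (≤-trans (≤-reflexive (cong ∣_∣ (eval≡ ⇓new))) (≤-trans (s≤s (c≤r (f x))) (≤-trans (r<len a) (≤-trans len≤N N≤M))))
            refl)
          λ { refl → reach-store 7 (nat 0) (nat 1 ⊞ counter) (Counting xs _)
                (≤-trans (≤-reflexive (cong (λ z → ∣ 1ℤ ℤ.+ z ∣) (counter≡ a))) (≤-trans (r<len a) (≤-trans len≤N N≤M)))
                record
                { post = post ; r = suc r ; c = increment c (f x) ; left = suc-injective left
                ; building = record { core = core B ; pointer≡ = pointer≡ B ; local = local B }
                ; at = next a
                ; counts = counts-store {c} m cs (eval≡ (⇓value g a)) (trans (eval≡ ⇓new) (cong +_ (+-comm 1 (c (f x)))))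
                ; c≤r = λ y → ≤-trans (increment-≤ c (f x) y) (≤-trans (+-monoˡ-≤ 1 (c≤r y)) (≤-reflexive (+-comm r 1)))
                ; rest = rest } }
        where
        g : Context m
        g = core B
        ⇓new : nat 1 ⊞ read 8 (v element) ⇓[ m ] suc (c (f x))
        ⇓new = ⇓+ ⇓nat (⇓read (⇓value g a) (cs (f x)))
      stop : ∀ {m} → Counting xs 0 m → eval (op less counter (read 0 off)) m ≡ 0ℤ
      stop {m} record { post = [] ; r = r ; building = B ; at = a } =
        less≡0 {m = m} (⇓scalar (counter≡ a)) (⇓len (core B))
          (≤-reflexive (trans (sym (total a)) (+-identityʳ r)))
      finish : ∀ {m} → Counting xs 0 m → Building xs m × Counts (tally (map f set)) (m 8)
      finish {m} record { post = [] ; building = B ; counts = cs ; rest = rest } = B , subst (λ c → Counts c (m 8)) rest cs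

    module _ (bitᵉ : Expr) (bt : ℕ) (bt≤R : bt ≤ R)
             (⇓bit : ∀ {m} → Context m → bitᵉ ⇓[ m ] bt)
             (zᵉ : Expr) (⇓z : ∀ {m} → Context m → zᵉ ⇓[ m ] Z)
             (nᵉ : Expr) (⇓n : ∀ {m} → Context m → nᵉ ⇓[ m ] N) where

      record Emitting (xs final : List ℤ) (c₀ : ℕ → ℕ) (j : ℕ) (m : Memory) : Set where
        field
          sofar    : List ℤ
          post     : List (Vec ℤ d)
          r        : ℕ
          c        : ℕ → ℕ
          left     : length post ≡ j
          building : Building sofar m
          at       : At post r (m 7 0ℤ)
          counts   : Counts c (m 8)
          rest     : foldl reset c (map f post) ≡ c₀
          slots≡   : sofar ++ map +_ (slots Z bt c r (map f post) (N ∸ len)) ≡ final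
          size≡    : length sofar ≡ length xs + r

      ⇓slot : ∀ {x post r m c} → Context m → At (x ∷ post) r (m 7 0ℤ) → Counts c (m 8) →
              valueSlot zᵉ bitᵉ (v element) ⇓[ m ] slot Z (bit bt (c (f x))) (f x) r
      ⇓slot {x} {post} {r} {m} {c} g a cs = value (trans
        (cong₂ ℤ._+_ (eval≡ ⇓pad) (cong₂ ℤ._*_ (eval≡ ⇓act) (cong₂ ℤ._-_ (eval≡ (⇓value g a)) (eval≡ ⇓pad))))
        (choose (bit bt (c (f x))) (m%n<n (shift (c (f x)) bt) 2)))
        where
        ⇓pad : zᵉ ⊞ counter ⇓[ m ] Z + r
        ⇓pad = ⇓+ (⇓z g) (⇓scalar (counter≡ a))
        ⇓act : shiftᵉ (read 8 (v element)) bitᵉ mod nat 2 ⇓[ m ] bit bt (c (f x))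
        ⇓act = ⇓% (⇓shift (Globals.powers (Core.globals g)) (⇓read (⇓value g a) (cs (f x))) (⇓bit g) bt≤R) ⇓nat
        choose : ∀ n → n < 2 → + (Z + r) ℤ.+ + n ℤ.* (+ f x ℤ.- + (Z + r)) ≡ + slot Z n (f x) r
        choose 0 _ = trans (cong (ℤ._+_ (+ (Z + r))) (ℤ.*-zeroˡ (+ f x ℤ.- + (Z + r)))) (ℤ.+-identityʳ (+ (Z + r)))
        choose 1 _ = trans (cong (ℤ._+_ (+ (Z + r))) (ℤ.*-identityˡ (+ f x ℤ.- + (Z + r))))
          (trans (cong (ℤ._+_ (+ (Z + r))) (ℤ.+-comm (+ f x) (ℤ.- + (Z + r))))
          (trans (sym (ℤ.+-assoc (+ (Z + r)) (ℤ.- + (Z + r)) (+ f x)))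
          (trans (cong (ℤ._+ + f x) (ℤ.+-inverseʳ (+ (Z + r)))) (ℤ.+-identityˡ (+ f x)))))
        choose (suc (suc n)) (s≤s (s≤s ()))

      slot-≤M : ∀ n {x r} → f x < Z → r < N → slot Z n (f x) r ≤ M
      slot-≤M zero    _    r<N = ≤-trans (+-monoʳ-≤ Z (<⇒≤ r<N)) Z+N≤M
      slot-≤M (suc n) fx<Z _   = ≤-trans (<⇒≤ fx<Z) (≤-trans (m≤m+n Z N) Z+N≤M)

      pointer-≤M : ∀ (xs sofar : List ℤ) {r} → length sofar ≡ length xs + r → r < N → b + (length xs + N) ≤ M →
                   b + suc (length sofar) ≤ M
      pointer-≤M xs sofar {r} e r<N ≤M = ≤-trans (+-monoʳ-≤ b
        (≤-trans (≤-reflexive (trans (cong suc e) (sym (+-suc (length xs) r)))) (+-monoʳ-≤ (length xs) r<N))) ≤M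

      reach-emitValues : ∀ {xs m} → b + (length xs + N) ≤ M → Building xs m → Counts (tally (map f set)) (m 8) →
        Reaches M (emitValues zᵉ bitᵉ (read 0 off) (v element)) m (1 + (len * 5 + 1))
          (Emitting xs (xs ++ map +_ (padded Z N bt (map f set))) (foldl reset (tally (map f set)) (map f set)) 0)
      reach-emitValues {xs} {m} ≤M B cs = reach-⨾ {P = Inv len}
        (reach-store 7 (nat 0) (nat 0) (Inv len) z≤n record
          { sofar = xs ; post = set ; r = 0 ; c = tally (map f set) ; left = refl
          ; building = record { core = core B ; pointer≡ = pointer≡ B ; local = local B }
          ; at = start ; counts = cs ; rest = refl
          ; slots≡ = cong (λ n → xs ++ map +_ (slots Z bt (tally (map f set)) 0 (map f set) (N ∸ n))) (sym (length-map f set))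
          ; size≡ = sym (+-identityʳ (length xs)) })
        (λ inv → reach-while 4 Inv step stop len inv)
        where
        Inv : ℕ → Memory → Set
        Inv = Emitting xs (xs ++ map +_ (padded Z N bt (map f set))) (foldl reset (tally (map f set)) (map f set))
        step : ∀ {j m} → Inv (suc j) m → eval (op less counter (read 0 off)) m ≢ 0ℤ ×
               Reaches M (emit (valueSlot zᵉ bitᵉ (v element)) ⨾ store 8 (v element) (nat 0) ⨾ advance) m 4 (Inv j)
        step {j} {m} record { sofar = sofar ; post = x ∷ post ; r = r ; c = c ; left = left ; building = B ; at = a
                        ; counts = cs ; rest = rest ; slots≡ = slots≡ ; size≡ = size≡ } =
          less≢0 {m = m} (⇓scalar (counter≡ a)) (⇓len g) (r<len a) ,
          reach-⨾ {P = λ m′ → m′ ≡ m₁}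
            (reach-emit (valueSlot zᵉ bitᵉ (v element)) _ B (⇓slot g a cs)
              (slot-≤M (bit bt (c (f x))) {x} (proj₁ (All.head (good a))) r<N)
              (pointer-≤M xs sofar size≡ r<N ≤M) refl)
            λ { refl → reach-⨾ {P = λ m′ → m′ ≡ m₁ [ 8 , eval (v element) m₁ ]≔ 0ℤ}
              (reach-store 8 (v element) (nat 0) _ z≤n refl)
              λ { refl → reach-store 7 (nat 0) (nat 1 ⊞ counter) (Inv j)
                (≤-trans (≤-reflexive (cong (λ z → ∣ 1ℤ ℤ.+ z ∣) (counter≡ a))) (≤-trans r<N N≤M))
                record
                { sofar = sofar ++ + s ∷ [] ; post = post ; r = suc r ; c = reset c (f x) ; left = suc-injective left
                ; building = record { core = core B₁ ; pointer≡ = pointer≡ B₁ ; local = local B₁ }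
                ; at = next a
                ; counts = counts-store {c} m₁ cs (eval≡ (⇓value {m = m₁} g a)) refl
                ; rest = rest
                ; slots≡ = trans (++-assoc sofar (+ s ∷ []) _) slots≡
                ; size≡ = trans (length-++ sofar) (trans (cong (_+ 1) size≡)
                            (trans (+-assoc (length xs) r 1) (cong (_+_ (length xs)) (+-comm r 1)))) } } }
          where
          s : ℕ
          s = slot Z (bit bt (c (f x))) (f x) r
          m₁ : Memory
          m₁ = emitted m (+ s)
          g : Context m
          g = core B
          r<N : r < N
          r<N = ≤-trans (r<len a) len≤N
          B₁ : Building (sofar ++ + s ∷ []) m₁
          B₁ = building-emitted (+ s) B
        stop : ∀ {m} → Inv 0 m → eval (op less counter (read 0 off)) m ≡ 0ℤ
        stop {m} record { post = [] ; r = r ; building = B ; at = a } =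
          less≡0 {m = m} (⇓scalar (counter≡ a)) (⇓len (core B))
            (≤-reflexive (trans (sym (total a)) (+-identityʳ r)))

      record Padding (xs final : List ℤ) (c₀ : ℕ → ℕ) (j : ℕ) (m : Memory) : Set where
        field
          sofar    : List ℤ
          r        : ℕ
          left     : r + j ≡ N
          counter≡ : m 7 0ℤ ≡ + r
          building : Building sofar m
          counts   : Counts c₀ (m 8)
          slots≡   : sofar ++ map +_ (padding Z r j) ≡ final
          size≡    : length sofar ≡ length xs + r

      reach-emitPadding : ∀ {xs final c₀ m} → b + (length xs + N) ≤ M → Emitting xs final c₀ 0 m →
        Reaches M (emitPadding zᵉ nᵉ) m ((N ∸ len) * 4 + 1) (λ m′ → Building final m′ × Counts c₀ (m′ 8))
      reach-emitPadding {xs} {final} {c₀} ≤M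
        record { sofar = sofar ; post = [] ; r = r ; building = B ; at = a ; counts = cs ; rest = refl ; slots≡ = slots≡ ; size≡ = size≡ } =
        reach-weaken (reach-while 3 (Padding xs final c₀) step stop (N ∸ len)
          (record { sofar = sofar ; r = r ; left = trans (cong (_+ (N ∸ len)) r≡len) (m+[n∸m]≡n len≤N)
                  ; counter≡ = At.counter≡ a ; building = B ; counts = cs ; slots≡ = slots≡ ; size≡ = size≡ }))
          ≤-refl finish
        where
        r≡len : r ≡ len
        r≡len = trans (sym (+-identityʳ r)) (total a)
        finish : ∀ {m} → Padding xs final c₀ 0 m → Building final m × Counts c₀ (m 8)
        finish {m} record { sofar = sofar ; building = B ; counts = cs ; slots≡ = slots≡ } =
          subst (λ l → Building l m) (trans (sym (++-identityʳ sofar)) slots≡) B , cs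
        stop : ∀ {m} → Padding xs final c₀ 0 m → eval (op less counter nᵉ) m ≡ 0ℤ
        stop {m} record { r = r ; left = left ; counter≡ = c≡ ; building = B } =
          less≡0 {m = m} (⇓scalar c≡) (⇓n (core B)) (≤-reflexive (trans (sym left) (+-identityʳ r)))
        step : ∀ {j m} → Padding xs final c₀ (suc j) m → eval (op less counter nᵉ) m ≢ 0ℤ ×
               Reaches M (emit (zᵉ ⊞ counter) ⨾ advance) m 3 (Padding xs final c₀ j)
        step {j} {m} record { sofar = sofar ; r = r ; left = left ; counter≡ = c≡ ; building = B ; counts = cs ; slots≡ = slots≡ ; size≡ = size≡ } =
          less≢0 {m = m} (⇓scalar c≡) (⇓n (core B)) r<N ,
          reach-⨾ {P = λ m′ → m′ ≡ emitted m (+ (Z + r))}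
            (reach-emit (zᵉ ⊞ counter) _ B (⇓+ (⇓z (core B)) (⇓scalar c≡))
              (≤-trans (+-monoʳ-≤ Z (<⇒≤ r<N)) Z+N≤M) (pointer-≤M xs sofar size≡ r<N ≤M) refl)
            λ { refl → reach-store 7 (nat 0) (nat 1 ⊞ counter) (Padding xs final c₀ j)
                (≤-trans (≤-reflexive (cong (λ z → ∣ 1ℤ ℤ.+ z ∣) c≡)) (≤-trans r<N N≤M))
                (let B₁ = building-emitted (+ (Z + r)) B in record
                { sofar = sofar ++ + (Z + r) ∷ [] ; r = suc r ; left = trans (sym (+-suc r j)) left
                ; counter≡ = cong (ℤ._+_ 1ℤ) c≡
                ; building = record { core = core B₁ ; pointer≡ = pointer≡ B₁ ; local = local B₁ }
                ; counts = cs
                ; slots≡ = trans (++-assoc sofar (+ (Z + r) ∷ []) _) slots≡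
                ; size≡ = trans (length-++ sofar) (trans (cong (_+ 1) size≡)
                            (trans (+-assoc (length xs) r 1) (cong (_+_ (length xs)) (+-comm r 1)))) }) }
          where
          r<N : r < N
          r<N = ≤-trans (m≤m+n (suc r) j) (≤-reflexive (trans (sym (+-suc r j)) left))

      reach-buildSet : ∀ {xs m} → b + (length xs + suc N) ≤ M → Building xs m → Counts (λ _ → 0) (m 8) →
        Reaches M (buildSet nᵉ zᵉ d v bitᵉ off) m (setTime N)
          (λ m′ → Building (xs ++ + N ∷ map +_ (padded Z N bt (map f set))) m′ × Counts (λ _ → 0) (m′ 8))
      reach-buildSet {xs} {m} ≤M B cs = reach-weaken
        (reach-⨾ {P = λ m′ → Building (xs ++ + N ∷ []) m′ × Counts (λ _ → 0) (m′ 8)}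
          (reach-emit nᵉ _ B (⇓n (core B)) N≤M
            (≤-trans (+-monoʳ-≤ b (≤-trans (≤-reflexive (+-comm 1 (length xs))) (+-monoʳ-≤ (length xs) (s≤s z≤n)))) ≤M)
            (building-emitted (+ N) B , cs))
          λ { (B₁ , cs₁) → reach-⨾ (reach-countValues B₁ cs₁)
          λ { (B₂ , cs₂) → reach-⨾ (reach-emitValues ≤M′ B₂ cs₂)
          λ e → reach-emitPadding ≤M′ e } })
        time
        λ { {m′} (B′ , cs′) → subst (λ l → Building l m′) (++-assoc xs (+ N ∷ []) _) B′ ,
                              λ x → trans (cs′ x) (cong +_ (reset-tally (map f set) x)) }
        where
        ≤M′ : b + (length (xs ++ + N ∷ []) + N) ≤ M
        ≤M′ = ≤-trans (≤-reflexive (cong (_+_ b) (trans (cong (_+ N) (length-++ xs)) (+-assoc (length xs) 1 N)))) ≤M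
        time : 2 + (1 + (len * 3 + 1) + (1 + (len * 5 + 1) + ((N ∸ len) * 4 + 1))) ≤ setTime N
        time = begin
          2 + (1 + (len * 3 + 1) + (1 + (len * 5 + 1) + ((N ∸ len) * 4 + 1)))
            ≤⟨ +-monoʳ-≤ 2 (+-mono-≤ (+-monoʳ-≤ 1 (+-monoˡ-≤ 1 (*-monoˡ-≤ 3 len≤N)))
                 (+-mono-≤ (+-monoʳ-≤ 1 (+-monoˡ-≤ 1 (*-monoˡ-≤ 5 len≤N))) (+-monoˡ-≤ 1 (*-monoˡ-≤ 4 (m∸n≤m N len))))) ⟩
          2 + (1 + (N * 3 + 1) + (1 + (N * 5 + 1) + (N * 4 + 1)))
            ≡⟨ solve 1 (λ n → con 2 :+ (con 1 :+ (n :* con 3 :+ con 1) :+ (con 1 :+ (n :* con 5 :+ con 1) :+ (n :* con 4 :+ con 1)))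
                 := con 12 :* n :+ con 7) refl N ⟩
          12 * N + 7
            ≤⟨ +-monoʳ-≤ (12 * N) (m≤m+n 7 5) ⟩
          12 * N + 12
            ≡⟨ solve 1 (λ n → con 12 :* n :+ con 12 := con 12 :* (con 1 :+ n)) refl N ⟩
          setTime N ∎
          where open ≤-Reasoning

  sets : ∀ {k} → (Fin k → List ℕ) → List ℤ
  sets V = concat (tabulate (λ i → + N ∷ map +_ (V i)))

  reach-buildSets : ∀ {k} {d : Fin k → ℕ} (v : Fin k → Expr → Expr) (f : ∀ i → Vec ℤ (d i) → ℕ)
    (A : ∀ i → List (Vec ℤ (d i))) (len≤N : ∀ i → length (A i) ≤ N)
    (values : ∀ i → All (Computes (v i) (f i)) (A i))
    (off : Expr) (o : ℕ) (⇓off : ∀ {m} → Context m → off ⇓[ m ] o)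
    (ys : List ℤ) (at-o : SuffixAt enc o (blocks A ++ ys))
    {bits : Vec Expr k} {bs : Vec ℕ k} (⇓bits : ∀ {m} → Context m → Evaluates m bits bs) (bs≤R : All< R bs)
    (zᵉ : Expr) (⇓z : ∀ {m} → Context m → zᵉ ⇓[ m ] Z)
    (nᵉ : Expr) (⇓n : ∀ {m} → Context m → nᵉ ⇓[ m ] N) →
    ∀ {xs m} → b + (length xs + k * suc N) ≤ M → Building xs m → Counts (λ _ → 0) (m 8) →
    Reaches M (buildSets nᵉ zᵉ d v bits off) m (k * setTime N + 1)
      (λ m′ → Building (xs ++ sets (λ i → padded Z N (Vec.lookup bs i) (map (f i) (A i)))) m′ × Counts (λ _ → 0) (m′ 8))
  reach-buildSets v f A len≤N values off o ⇓off ys at-o {[]} {[]} ⇓bits bs≤R zᵉ ⇓z nᵉ ⇓n {xs} {m} ≤M B cs =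
    reaches skip ≤-refl (subst (λ l → Building l m) (sym (++-identityʳ xs)) B , cs)
  reach-buildSets {suc k} {d} v f A len≤N values off o ⇓off ys at-o {bit ∷ bits} {bt ∷ bs} ⇓bits (bt<R ∷ bs<R) zᵉ ⇓z nᵉ ⇓n {xs} {m} ≤M B cs =
    reach-weaken
      (reach-⨾
        (SetLoops.reach-buildSet (d zero) (v zero) (f zero) (A zero) (len≤N zero) (values zero) off o ⇓off
          (blocks (A ∘ suc) ++ ys) at-o′ bit bt (<⇒≤ bt<R) (λ g → headᵉ (⇓bits g)) zᵉ ⇓z nᵉ ⇓n
          (≤-trans (+-monoʳ-≤ b (+-monoʳ-≤ (length xs) (m≤m+n (suc N) (k * suc N)))) ≤M) B cs)
        (λ { (B′ , cs′) → reach-buildSets (v ∘ suc) (λ i → f (suc i)) (A ∘ suc) (len≤N ∘ suc) (λ i → values (suc i))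
          (afterBlock (d zero) off) _ (λ g → ⇓afterBlock (Globals.input (Core.globals g)) (A zero) (⇓off g) at-o′)
          ys (suffix-block (A zero) at-o′) (λ g → tailᵉ (⇓bits g)) bs<R zᵉ ⇓z nᵉ ⇓n
          (≤-trans (≤-reflexive (cong (_+_ b) (trans (cong (_+ k * suc N) (trans (length-++ xs)
             (cong (λ n → length xs + suc n) (trans (length-map +_ first) length-first)))) (+-assoc (length xs) (suc N) (k * suc N))))) ≤M)
          B′ cs′ }))
      (≤-reflexive (sym (+-assoc (setTime N) (k * setTime N) 1)))
      λ { {m′} (B′ , cs′) → subst (λ l → Building l m′) (++-assoc xs (+ N ∷ map +_ first) _) B′ , cs′ }
    where
    first : List ℕ
    first = padded Z N bt (map (f zero) (A zero))
    length-first : length first ≡ N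
    length-first = trans (length-slots Z bt _ 0 (map (f zero) (A zero)) _)
      (m+[n∸m]≡n (≤-trans (≤-reflexive (length-map (f zero) (A zero))) (len≤N zero)))
    at-o′ : SuffixAt enc o (block (A zero) ++ blocks (A ∘ suc) ++ ys)
    at-o′ = blocks-suc A at-o
    headᵉ : ∀ {m n e x} {es : Vec Expr n} {xs} → Evaluates m (e ∷ es) (x ∷ xs) → e ⇓[ m ] x
    headᵉ (p ∷ _) = p
    tailᵉ : ∀ {m n e x} {es : Vec Expr n} {xs} → Evaluates m (e ∷ es) (x ∷ xs) → Evaluates m es xs
    tailᵉ (_ ∷ ps) = ps

-- The program

valueBound : (A c N : ℕ) → ℕ
valueBound A c N = A * N ^ c

-- With `W` the `valueBound`, a power `2 ^ R` of at least this size satisfies `W + k * W < 2 ^ R`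
-- for the shifted values, `N < 2 ^ R` for the multiplicities and, by the last term, `k * 6 < R` for
-- the codes.
logBound : (k A c N : ℕ) → ℕ
logBound k A c N = 1 + valueBound A c N + k * valueBound A c N + N + 2 ^ (k * 6)

-- Exceeds `k * (2 ^ R + 3)`, which bounds a digit of the sum, and is at least `2 ^ R + R`, which
-- exceeds a digit of the target.
packRadix : (k R : ℕ) → ℕ
packRadix k R = suc k * (2 ^ R + 3 + R)

padStart : (k m R : ℕ) → ℕ
padStart k m R = packRadix k R ^ (m * 2)

-- The word bound of the called program on size `N`, which covers every address it can use, plus the
-- length of the encoding.
window : (k w N : ℕ) → ℕ
window k w N = (2 + N) ^ w + (k * suc N + 1)

-- Addresses from `- H` to `H` make `2H + 1` cells, for `H` the `window`.
stride : (k w N : ℕ) → ℕ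
stride k w N = suc (window k w N + window k w N)

calls : (k m R : ℕ) → ℕ
calls k m R = R ^ (m * 3) * R ^ k

module Reduced {k : ℕ} {d : Fin k → ℕ} {l : ℕ} (ψ : Formula d l) (A c w : ℕ) (p : Program) where

  #atoms : ℕ
  #atoms = length (atoms ψ)

  Nᵉ Wᵉ Xᵉ Rᵉ Yᵉ Zᵉ Hᵉ Sᵉ Qᵉ : Expr
  -- The sum of the lengths is within a factor `k` of their maximum and needs no branching; the 2
  -- ensures `N ≥ 2`, as the polynomial bounds require.
  Nᵉ = nat 2 ⊞ totalLength d (nat 0)
  Wᵉ = nat A ⊠ Nᵉ ⊛ c
  Xᵉ = nat 1 ⊞ Wᵉ ⊞ nat k ⊠ Wᵉ ⊞ Nᵉ ⊞ nat (2 ^ (k * 6))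
  Rᵉ = scalar 2
  Yᵉ = nat (suc k) ⊠ (read 3 Rᵉ ⊞ nat 3 ⊞ Rᵉ)
  Zᵉ = Yᵉ ⊛ (#atoms * 2)
  Hᵉ = (nat 2 ⊞ Nᵉ) ⊛ w ⊞ (nat k ⊠ (nat 1 ⊞ Nᵉ) ⊞ nat 1)
  Sᵉ = nat 1 ⊞ (Hᵉ ⊞ Hᵉ)
  Qᵉ = Rᵉ ⊛ (#atoms * 3) ⊠ Rᵉ ⊛ k

  certificateᵉ : Vec Expr (#atoms * 3)
  certificateᵉ = digitsᵉ Rᵉ (#atoms * 3) (scalar 4)

  bitsᵉ : Vec Expr k
  bitsᵉ = digitsᵉ Rᵉ k (dropDigitsᵉ Rᵉ (#atoms * 3) (scalar 4))

  elementValuesᵉ : (as : List (Atom d l)) → Fin k → Expr → Vec Expr (length as)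
  elementValuesᵉ []       i e = []
  elementValuesᵉ (a ∷ as) i e = dotAt (Atom.coefficients a i) e ⊞ Wᵉ ∷ elementValuesᵉ as i e

  valueᵉ : Fin k → Expr → Expr
  valueᵉ i e = packᵉ Yᵉ (elementValuesᵉ (atoms ψ) i e) certificateᵉ

  thresholdsᵉ : (as : List (Atom d l)) → Expr → Vec Expr (length as)
  thresholdsᵉ []       e = []
  thresholdsᵉ (a ∷ as) e = lit (Atom.constant a) ⊟ dotAt (Atom.parameters a) e ⊞ nat k ⊠ Wᵉ ∷ thresholdsᵉ as e

  Tᵉ : Expr
  Tᵉ = targetᵉ Yᵉ (thresholdsᵉ (atoms ψ) (afterBlocks d (nat 0))) certificateᵉ

  weightᵉ : Expr
  weightᵉ = validityᵉ k #atoms certificateᵉ ⊠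
    (proj₁ (decideᵉ ψ (claimsᵉ k (comparisons (atoms ψ)) certificateᵉ)) ⊠ weightOfBitsᵉ bitsᵉ)

  -- The radix and the table needed for shifts arise together: doubling stops at the first power
  -- that reaches `Xᵉ`, and its exponent is `R`.
  computePowers : Program
  computePowers = store 3 (nat 0) (nat 1) ⨾
    while (op less (read 3 Rᵉ) Xᵉ)
      (store 3 (nat 1 ⊞ Rᵉ) (nat 2 ⊠ read 3 Rᵉ) ⨾ store 2 (nat 0) (nat 1 ⊞ Rᵉ))

  -- Array 10 is the output array 1 of the called program after relocation by 9.
  resultᵉ : Expr
  resultᵉ = read 10 (op add base (lit 0ℤ))

  callOnce : Program
  callOnce =
    store 5 (nat 0) (scalar 4 ⊠ Sᵉ) ⨾
    store 6 (nat 0) (scalar 5) ⨾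
    buildSets Nᵉ Zᵉ d valueᵉ bitsᵉ (nat 0) ⨾
    emit Tᵉ ⨾
    relocate p ⨾
    store 1 (nat 0) (weightᵉ ⊠ resultᵉ ⊞ scalar 1) ⨾
    store 4 (nat 0) (nat 1 ⊞ scalar 4)

  program : Program
  program = computePowers ⨾ while (op less (scalar 4) Qᵉ) callOnce

-- Correctness of the program

∑<-mono : ∀ {n n′} (f : ℕ → ℕ) → n ≤ n′ → ∑< n f ≤ ∑< n′ f
∑<-mono {n} {n′} f n≤n′ = subst (λ x → ∑< n f ≤ ∑< x f) (m∸n+n≡m n≤n′)
  (≤-trans (m≤n+m (∑< n f) _) (≤-reflexive (sym (∑<-split (n′ ∸ n) n f))))

initial-[] : ∀ a i → initial [] a i ≡ 0ℤ
initial-[] zero    (+ _)    = refl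
initial-[] zero    -[1+ _ ] = refl
initial-[] (suc _) _        = refl

initial-beyond : ∀ xs a j → length xs ≤ j → initial xs a (+ j) ≡ 0ℤ
initial-beyond xs zero    j l≤j = nth-beyond xs j l≤j
initial-beyond xs (suc a) j l≤j = refl

-- Seen from the base of one window, the cells of the next lie at offsets greater than `H`.
beyond-window : ∀ H i → ℤ.- + H ℤ.≤ i → ∃[ n ] + suc (H + H) ℤ.+ i ≡ + (suc H + n)
beyond-window H i -H≤i = ∣ i ℤ.+ + H ∣ , (begin
  + suc (H + H) ℤ.+ i           ≡⟨ ℤ.+-assoc (+ suc H) (+ H) i ⟩
  + suc H ℤ.+ (+ H ℤ.+ i)       ≡⟨ cong (ℤ._+_ (+ suc H)) (ℤ.+-comm (+ H) i) ⟩
  + suc H ℤ.+ (i ℤ.+ + H)       ≡⟨ cong (ℤ._+_ (+ suc H)) (sym (ℤ.0≤i⇒+∣i∣≡i 0≤i+H)) ⟩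
  + (suc H + ∣ i ℤ.+ + H ∣)     ∎)
  where
  open ≡-Reasoning
  0≤i+H : 0ℤ ℤ.≤ i ℤ.+ + H
  0≤i+H = ℤ.≤-trans (ℤ.≤-reflexive (sym (ℤ.+-inverseˡ (+ H)))) (ℤ.+-monoˡ-≤ (+ H) -H≤i)

length-concat-tabulate : ∀ {k} (f : Fin k → List ℤ) n → (∀ i → length (f i) ≡ n) → length (concat (tabulate f)) ≡ k * n
length-concat-tabulate {zero}  f n e = refl
length-concat-tabulate {suc k} f n e = trans (length-++ (f zero))
  (cong₂ _+_ (e zero) (length-concat-tabulate (f ∘ suc) n (e ∘ suc)))

module Correctness {k : ℕ} .{{_ : NonZero k}} {d : Fin k → ℕ} {l : ℕ} (ψ : Formula d l) (A c w : ℕ) (p : Program)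
  (set : ∀ i → List (Vec ℤ (d i))) (t : Vec ℤ l) (N R M : ℕ)
  (N≡ : N ≡ 2 + ∑ᶠ (length ∘ set))
  (X≤2^R : logBound k A c N ≤ 2 ^ R) (2^r<X : ∀ r → r < R → 2 ^ r < logBound k A c N)
  (6k<R : k * 6 < R)
  (len≤N : ∀ i → length (set i) ≤ N)
  (elements : ∀ i {x} → x ∈ set i → All (λ a → ∣ dot (Atom.coefficients a i) x ∣ ≤ valueBound A c N) (atoms ψ))
  (params : All (ThresholdBound (valueBound A c N) t) (atoms ψ))
  (2^R≤M : 2 ^ R ≤ M) (Z+N≤M : padStart k (length (atoms ψ)) R + N ≤ M)
  (QS≤M : calls k (length (atoms ψ)) R * stride k w N ≤ M)
  where

  open Reduced ψ A c w p

  W Y Z H S Q : ℕ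
  W = valueBound A c N
  Y = packRadix k R
  Z = padStart k #atoms R
  H = window k w N
  S = stride k w N
  Q = calls k #atoms R

  W+kW<2^R : W + k * W < 2 ^ R
  W+kW<2^R = ≤-trans (≤-trans (m≤m+n (1 + W + k * W) N) (m≤m+n _ (2 ^ (k * 6)))) X≤2^R

  N<2^R : N < 2 ^ R
  N<2^R = ≤-trans (≤-trans (+-monoˡ-≤ N (s≤s z≤n)) (m≤m+n _ (2 ^ (k * 6)))) X≤2^R

  Y-large : k * (2 ^ R + 3) < Y
  Y-large = ≤-trans (s≤s (*-monoʳ-≤ k (m≤m+n (2 ^ R + 3) R)))
    (+-monoˡ-≤ (k * (2 ^ R + 3 + R)) (≤-trans (m^n>0 2 R) (≤-trans (m≤m+n (2 ^ R) 3) (m≤m+n (2 ^ R + 3) R))))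

  Y-large′ : 2 ^ R + R ≤ Y
  Y-large′ = ≤-trans (+-monoˡ-≤ R (m≤m+n (2 ^ R) 3)) (m≤m+n (2 ^ R + 3 + R) _)

  open Reduction ψ set t N R Y W 6k<R Y-large Y-large′ W+kW<2^R
    (λ i → ≤-<-trans (len≤N i) N<2^R) elements params public
    using (T; T<Z; values; values-<; weight; count; kSUM-instance; #witnesses-instance; #witnesses-sum; R-nonZero)

  instance _ = R-nonZero

  certificate : ℕ → Vec ℕ (#atoms * 3)
  certificate q = digits R (#atoms * 3) q

  bits : ℕ → Vec ℕ k
  bits q = digits R k (dropDigits R (#atoms * 3) q)

  term : ℕ → ℕ
  term q = weight (certificate q) (bits q) * count (certificate q) (bits q)

  encodingOf : ℕ → List ℤ
  encodingOf q = WitnessProblem.Instance.encoding (kSUM-instance (certificate q) (bits q))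

  enc : List ℤ
  enc = blocks set ++ Vec.toList t

  at-0 : SuffixAt enc 0 enc
  at-0 = suffix (λ j → refl)

  module _ {m : Memory} (inp : Input enc (m 0)) where

    ⇓N : Nᵉ ⇓[ m ] N
    ⇓N = subst (λ n → Nᵉ ⇓[ m ] n) (sym N≡) (⇓+ ⇓nat (⇓totalLength {enc} inp set ⇓nat at-0))

    ⇓W : Wᵉ ⇓[ m ] W
    ⇓W = ⇓* ⇓nat (⇓⊛ c ⇓N)

    ⇓X : Xᵉ ⇓[ m ] logBound k A c N
    ⇓X = ⇓+ (⇓+ (⇓+ (⇓+ ⇓nat ⇓W) (⇓* ⇓nat ⇓W)) ⇓N) ⇓nat

    ⇓H : Hᵉ ⇓[ m ] H
    ⇓H = ⇓+ (⇓⊛ w (⇓+ ⇓nat ⇓N)) (⇓+ (⇓* ⇓nat (⇓+ ⇓nat ⇓N)) ⇓nat)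

    ⇓S : Sᵉ ⇓[ m ] S
    ⇓S = ⇓+ ⇓nat (⇓+ ⇓H ⇓H)

  module _ {m : Memory} (g : Globals enc R (m 0) (m 2) (m 3)) where

    open Globals g

    ⇓R : Rᵉ ⇓[ m ] R
    ⇓R = ⇓scalar radix

    ⇓Y : Yᵉ ⇓[ m ] Y
    ⇓Y = ⇓* ⇓nat (⇓+ (⇓+ (⇓pow powers ⇓R ≤-refl) ⇓nat) ⇓R)

    ⇓Z : Zᵉ ⇓[ m ] Z
    ⇓Z = ⇓⊛ (#atoms * 2) ⇓Y

    ⇓Q : Qᵉ ⇓[ m ] Q
    ⇓Q = ⇓* (⇓⊛ (#atoms * 3) ⇓R) (⇓⊛ k ⇓R)

    ⇓thresholds : ∀ {e o} → e ⇓[ m ] o → SuffixAt enc o (Vec.toList t) → ∀ as → All (ThresholdBound W t) as →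
      Evaluates m (thresholdsᵉ as e) (thresholds W as t)
    ⇓thresholds         p s []       []       = []
    ⇓thresholds {o = o} p s (a ∷ as) (b ∷ bs) = value (trans
      (cong₂ (λ x y → Atom.constant a ℤ.- x ℤ.+ y)
        (eval-dotAt {enc} {m} input (Atom.parameters a) t p
          (subst (SuffixAt enc o) (sym (++-identityʳ (Vec.toList t))) s))
        (eval≡ (⇓* (⇓nat {m} {k}) (⇓W input))))
      (sym (∣i+n∣ (Atom.constant a ℤ.- dot (Atom.parameters a) t) (k * W) (≤-trans b (m≤n*m W k)))))
      ∷ ⇓thresholds p s as bs

    ⇓elementValues : ∀ {e o ys i x} → e ⇓[ m ] o → SuffixAt enc o (Vec.toList x ++ ys) →
      ∀ as → All (λ a → ∣ dot (Atom.coefficients a i) x ∣ ≤ W) as →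
      Evaluates m (elementValuesᵉ as i e) (elementValues W as i x)
    ⇓elementValues                 p s []       []       = []
    ⇓elementValues {i = i} {x = x} p s (a ∷ as) (b ∷ bs) = value (trans
      (cong₂ ℤ._+_ (eval-dotAt {enc} {m} input (Atom.coefficients a i) x p s) (eval≡ (⇓W {m} input)))
      (sym (∣i+n∣ (dot (Atom.coefficients a i) x) W b)))
      ∷ ⇓elementValues p s as bs

    module _ {q : ℕ} (index : m 4 0ℤ ≡ + q) where

      ⇓certificate : Evaluates m certificateᵉ (certificate q)
      ⇓certificate = ⇓digits ⇓R (#atoms * 3) (⇓scalar index)

      ⇓bits : Evaluates m bitsᵉ (bits q)
      ⇓bits = ⇓digits ⇓R k (⇓dropDigits ⇓R (#atoms * 3) (⇓scalar index))

      certificate-< : All< R (certificate q)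
      certificate-< = digits-< R (#atoms * 3) q

      ⇓value : ∀ {e o ys i x} → x ∈ set i → e ⇓[ m ] o → SuffixAt enc o (Vec.toList x ++ ys) →
        valueᵉ i e ⇓[ m ] pack Y (elementValues W (atoms ψ) i x) (certificate q)
      ⇓value x∈ p s = ⇓pack powers ⇓Y (⇓elementValues p s (atoms ψ) (elements _ x∈)) ⇓certificate certificate-<

      ⇓T : Tᵉ ⇓[ m ] T (certificate q)
      ⇓T = let (o , p , s) = ⇓afterBlocks {enc} input set ⇓nat at-0 in
        ⇓target powers ⇓Y (⇓thresholds p s (atoms ψ) params) ⇓certificate certificate-<

      ⇓weight : weightᵉ ⇓[ m ] weight (certificate q) (bits q)
      ⇓weight = ⇓* (⇓validity k #atoms ⇓certificate)
        (⇓* (proj₁ (⇓decide ψ (⇓claims (comparisons (atoms ψ)) ⇓certificate)))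
            (⇓weightOfBits powers ⇓bits (digits-< R k (dropDigits R (#atoms * 3) q))))

  1≤Q : 1 ≤ Q
  1≤Q = *-mono-≤ (m^n>0 R (#atoms * 3)) (m^n>0 R k)

  S≤M : S ≤ M
  S≤M = ≤-trans (≤-trans (≤-reflexive (sym (*-identityˡ S))) (*-monoˡ-≤ S 1≤Q)) QS≤M

  H≤S : H ≤ S
  H≤S = ≤-trans (m≤m+n H H) (n≤1+n (H + H))

  Q≤M : Q ≤ M
  Q≤M = ≤-trans (m≤m*n Q S) QS≤M

  qS+S≤M : ∀ {q} → q < Q → q * S + S ≤ M
  qS+S≤M {q} q<Q = ≤-trans (≤-reflexive (+-comm (q * S) S)) (≤-trans (*-monoˡ-≤ S q<Q) QS≤M)

  encoding-length : k * suc N + 1 ≤ H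
  encoding-length = m≤n+m (k * suc N + 1) ((2 + N) ^ w)

  paddedSet : ℕ → Fin k → List ℕ
  paddedSet q i = padded Z N (Vec.lookup (bits q) i) (values (certificate q) i)

  padded-length : ∀ q i → length (paddedSet q i) ≡ N
  padded-length q i = trans
    (length-slots Z (Vec.lookup (bits q) i) (tally vs) 0 vs (N ∸ length vs))
    (m+[n∸m]≡n (≤-trans (≤-reflexive (length-map (λ x → pack Y (elementValues W (atoms ψ) i x) (certificate q)) (set i))) (len≤N i)))
    where
    vs : List ℕ
    vs = values (certificate q) i

  paddedSets : ℕ → Fin k → List ℤ
  paddedSets q i = + N ∷ map +_ (paddedSet q i)

  encoding≡ : ∀ q → encodingOf q ≡ concat (tabulate (paddedSets q)) ++ + T (certificate q) ∷ []
  encoding≡ q = cong (_++ + T (certificate q) ∷ []) (cong concat (tabulate-cong blocks≡))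
    where
    blocks≡ : ∀ i → + length (map +_ (paddedSet q i)) ∷ concatMap List.[_] (map +_ (paddedSet q i)) ≡ paddedSets q i
    blocks≡ i = cong₂ (λ n ys → + n ∷ ys)
      (trans (length-map +_ (paddedSet q i)) (padded-length q i)) (concat-map-[_] (map +_ (paddedSet q i)))

  length-encoding : ∀ q → length (encodingOf q) ≡ k * suc N + 1
  length-encoding q = trans (cong length (encoding≡ q)) (trans
    (length-++ (concat (tabulate (paddedSets q))) {+ T (certificate q) ∷ []})
    (cong (_+ 1) (length-concat-tabulate (paddedSets q) (suc N)
      (λ i → cong suc (trans (length-map +_ (paddedSet q i)) (padded-length q i))))))

  length-encoding-≤ : ∀ q → length (encodingOf q) ≤ H
  length-encoding-≤ q = ≤-trans (≤-reflexive (length-encoding q)) encoding-length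

  module Loop (τ : ℕ)
    (calls-correct : ∀ q → q < Q → ∃[ s ] ∃[ μ ] Run ((2 + N) ^ w) p (initial (encodingOf q)) s μ × s ≤ τ ×
                     output μ ≡ + count (certificate q) (bits q))
    (∑≤M : ∑< Q term ≤ M)
    where

    -- As `Represents` has no upper limit, `fresh` covers the window of the next call and all later
    -- ones.
    record Between (j : ℕ) (m : Memory) : Set where
      field
        q       : ℕ
        left    : q + j ≡ Q
        globals : Globals enc R (m 0) (m 2) (m 3)
        output≡ : m 1 0ℤ ≡ + ∑< q term
        index≡  : m 4 0ℤ ≡ + q
        counts  : Counts (λ _ → 0) (m 8)
        fresh   : Represents (q * S) H m (initial [])

    callTime : ℕ
    callTime = 1 + (1 + (k * setTime N + 1 + (2 + (τ + (1 + 1)))))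

    reach-call : ∀ {j m} → Between (suc j) m → Reaches M callOnce m callTime (Between j)
    reach-call {j} {m} record { q = q ; left = left ; globals = g ; output≡ = output≡ ; index≡ = index≡ ; counts = cs ; fresh = fresh } =
      reach-⨾ {P = λ m′ → m′ ≡ m₁} (reach-store 5 (nat 0) (scalar 4 ⊠ Sᵉ) _
          (≤-trans (≤-reflexive (cong ∣_∣ (eval≡ ⇓base))) (≤-trans (m≤m+n b S) (qS+S≤M q<Q))) refl)
      λ { refl → reach-⨾ {P = λ m′ → m′ ≡ m₂} (reach-store 6 (nat 0) (scalar 5) _
          (≤-trans (≤-reflexive (cong ∣_∣ (eval≡ ⇓base))) (≤-trans (m≤m+n b S) (qS+S≤M q<Q))) refl)
      λ { refl → reach-⨾ (reach-buildSets valueᵉ (λ i x → pack Y (elementValues W (atoms ψ) i x) (certificate q)) set len≤N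
            (λ i → All.tabulate (λ x∈ → values-∈ i x∈ , λ C p s → ⇓value (Core.globals C) (Core.index≡ C) x∈ p s))
            (nat 0) 0 (λ _ → ⇓nat) (Vec.toList t) at-0 (λ C → ⇓bits (Core.globals C) (Core.index≡ C))
            (digits-< R k (dropDigits R (#atoms * 3) q))
            Zᵉ (λ C → ⇓Z (Core.globals C)) Nᵉ (λ C → ⇓N (Globals.input (Core.globals C)))
            (≤-trans (+-monoʳ-≤ b (≤-trans (m≤m+n (k * suc N) 1) (≤-trans encoding-length H≤S))) (qS+S≤M q<Q))
            building₀ cs)
      λ { {m₃} (B₃ , cs₃) → reach-⨾ {P = λ m′ → Building (encodingOf q) m′ × Counts (λ _ → 0) (m′ 8)}
          (reach-emit Tᵉ _ B₃ (⇓T (Core.globals (Building.core B₃)) (Core.index≡ (Building.core B₃)))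
            (≤-trans (<⇒≤ (T<Z (certificate q) (digits-< R (#atoms * 3) q))) (≤-trans (m≤m+n Z N) Z+N≤M))
            (≤-trans (+-monoʳ-≤ b (≤-trans (≤-reflexive (sym length-sets)) (≤-trans (length-encoding-≤ q) H≤S))) (qS+S≤M q<Q))
            (subst (λ l → Building l (emitted m₃ (+ T (certificate q)))) (sym (encoding≡ q)) (building-emitted (+ T (certificate q)) B₃) , cs₃))
      λ { {m₄} (B₄ , cs₄) → afterCall m₄ B₄ cs₄ } } } }
      where
      b : ℕ
      b = q * S
      open Build enc R N Z M (∑< q term) q b H Z+N≤M
      q<Q : q < Q
      q<Q = ≤-trans (m≤m+n (suc q) j) (≤-reflexive (trans (sym (+-suc q j)) left))
      ⇓base : (scalar 4 ⊠ Sᵉ) ⇓[ m ] b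
      ⇓base = ⇓* (⇓scalar index≡) (⇓S (Globals.input g))
      m₁ m₂ : Memory
      m₁ = m [ 5 , 0ℤ ]≔ eval (scalar 4 ⊠ Sᵉ) m
      m₂ = m₁ [ 6 , 0ℤ ]≔ m₁ 5 0ℤ
      building₀ : Building [] m₂
      building₀ = record
        { core     = record { globals = g ; output≡ = output≡ ; index≡ = index≡ ; base≡ = eval≡ ⇓base }
        ; pointer≡ = trans (eval≡ ⇓base) (cong +_ (sym (+-identityʳ b)))
        ; local    = fresh }
      values-∈ : ∀ i {x} → x ∈ set i → pack Y (elementValues W (atoms ψ) i x) (certificate q) < Z
      values-∈ i x∈ = All.lookup (values-< (certificate q) i) (∈-map⁺ (λ x → pack Y (elementValues W (atoms ψ) i x) (certificate q)) x∈)
      length-sets : length (encodingOf q) ≡ suc (length (sets (paddedSet q)))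
      length-sets = trans (cong length (encoding≡ q))
        (trans (length-++ (sets (paddedSet q))) (+-comm (length (sets (paddedSet q))) 1))
      afterCall : ∀ m₄ → Building (encodingOf q) m₄ → Counts (λ _ → 0) (m₄ 8) →
        Reaches M (relocate p ⨾ store 1 (nat 0) (weightᵉ ⊠ resultᵉ ⊞ scalar 1) ⨾ store 4 (nat 0) (nat 1 ⊞ scalar 4))
          m₄ (τ + (1 + 1)) (Between j)
      afterCall m₄ B₄ cs₄ with calls-correct q q<Q
      ... | s , μ , run , s≤τ , out with run-relocate {M} {(2 + N) ^ w} {b} {H} (≤-trans B≤H (≤-trans H≤S S≤M)) B≤H
                                             (Core.base≡ (Building.core B₄)) (Building.local B₄) run
        where
        B≤H : (2 + N) ^ w ≤ H
        B≤H = m≤m+n ((2 + N) ^ w) (k * suc N + 1)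
      ...   | m₅ , ex , rep , frame =
        reach-⨾ {P = λ m′ → m′ ≡ m₅} (reaches ex s≤τ refl)
        λ { refl → reach-⨾ {P = λ m′ → m′ ≡ m₅ [ 1 , 0ℤ ]≔ eval (weightᵉ ⊠ resultᵉ ⊞ scalar 1) m₅}
            (reach-store 1 (nat 0) (weightᵉ ⊠ resultᵉ ⊞ scalar 1) _
              (≤-trans (≤-reflexive (cong ∣_∣ (eval≡ ⇓out))) (≤-trans (∑<-mono term q<Q) ∑≤M)) refl)
        λ { refl → reach-store 4 (nat 0) (nat 1 ⊞ scalar 4) (Between j)
            (≤-trans (≤-reflexive (cong (λ z → ∣ 1ℤ ℤ.+ z ∣) index₅)) (≤-trans q<Q Q≤M))
            record
            { q = suc q ; left = trans (sym (+-suc q j)) left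
            ; globals = g₅
            ; output≡ = eval≡ ⇓out
            ; index≡ = cong (ℤ._+_ 1ℤ) index₅
            ; counts = λ x → trans (frame (s≤s (m≤m+n 8 0)) (+ x)) (cs₄ x)
            ; fresh = fresh′ } } }
        where
        C₄ : Context m₄
        C₄ = Building.core B₄
        g₄ : Globals enc R (m₄ 0) (m₄ 2) (m₄ 3)
        g₄ = Core.globals C₄
        g₅ : Globals enc R (m₅ 0) (m₅ 2) (m₅ 3)
        g₅ = record
          { input  = λ i → trans (frame (m≤m+n 1 8) (+ i)) (Globals.input g₄ i)
          ; radix  = trans (frame (m≤m+n 3 6) 0ℤ) (Globals.radix g₄)
          ; powers = λ i i≤R → trans (frame (m≤m+n 4 5) (+ i)) (Globals.powers g₄ i i≤R) }
        index₅ : m₅ 4 0ℤ ≡ + q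
        index₅ = trans (frame (m≤m+n 5 4) 0ℤ) (Core.index≡ C₄)
        ⇓result : resultᵉ ⇓[ m₅ ] count (certificate q) (bits q)
        ⇓result = value (trans (cong (λ x → m₅ 10 (x ℤ.+ 0ℤ)) (trans (frame (m≤m+n 6 3) 0ℤ) (Core.base≡ C₄)))
          (trans (rep 1 0ℤ (∣i∣≤⇒-≤ z≤n)) out))
        ⇓out : weightᵉ ⊠ resultᵉ ⊞ scalar 1 ⇓[ m₅ ] ∑< (suc q) term
        ⇓out = ⇓+ (⇓* (⇓weight g₅ index₅) ⇓result) (⇓scalar (trans (frame (m≤m+n 2 7) 0ℤ) (Core.output≡ C₄)))
        -- A cell of the next window is beyond every word of this run, hence untouched by it, and
        -- beyond the end of the encoding, hence still 0.
        fresh′ : Represents (suc q * S) H m₅ (initial [])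
        fresh′ a i -H≤i with beyond-window H i -H≤i
        ... | n , e = begin
          m₅ (9 + a) (+ (S + b) ℤ.+ i)
            ≡⟨ cong (m₅ (9 + a)) (trans (cong (λ x → + x ℤ.+ i) (+-comm S b)) (ℤ.+-assoc (+ b) (+ S) i)) ⟩
          m₅ (9 + a) (+ b ℤ.+ (+ S ℤ.+ i))
            ≡⟨ cong (λ x → m₅ (9 + a) (+ b ℤ.+ x)) e ⟩
          m₅ (9 + a) (+ b ℤ.+ + (suc H + n))
            ≡⟨ rep a (+ (suc H + n)) (ℤ.≤-trans (ℤ.neg-≤-pos {H} {0}) (ℤ.+≤+ z≤n)) ⟩
          μ a (+ (suc H + n))
            ≡⟨ run-outside run a (+ (suc H + n)) (≤-trans (s≤s (m≤m+n ((2 + N) ^ w) (k * suc N + 1))) (m≤m+n (suc H) n)) ⟩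
          initial (encodingOf q) a (+ (suc H + n))
            ≡⟨ initial-beyond (encodingOf q) a (suc H + n) (≤-trans (length-encoding-≤ q) (≤-trans (n≤1+n H) (m≤m+n (suc H) n))) ⟩
          0ℤ
            ≡⟨ initial-[] a i ⟨
          initial [] a i ∎
          where open ≡-Reasoning

    record Doubling (j : ℕ) (m : Memory) : Set where
      field
        r      : ℕ
        left   : r + j ≡ R
        input  : Input enc (m 0)
        radix  : m 2 0ℤ ≡ + r
        powers : PowersOf2 r (m 3)
        zero₁  : m 1 0ℤ ≡ 0ℤ
        zero₄  : m 4 0ℤ ≡ 0ℤ
        zero₈  : ∀ i → m 8 i ≡ 0ℤ
        zero₉  : ∀ a i → m (9 + a) i ≡ 0ℤ

    time : ℕ
    time = 1 + (R * 3 + 1) + (Q * suc callTime + 1)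

    reach-program : Reaches M program (initial enc) time (λ m → output m ≡ + ∑< Q term)
    reach-program = reach-⨾ {P = Doubling 0} reach-computePowers
      λ { {m} D → reach-weaken (reach-while callTime Between
            (λ { {j} {m} inv → less≢0 {m = m} (⇓scalar (Between.index≡ inv)) (⇓Q (Between.globals inv))
                   (≤-trans (m≤m+n (suc (Between.q inv)) j) (≤-reflexive (trans (sym (+-suc (Between.q inv) j)) (Between.left inv))))
                 , reach-call inv })
            (λ {m} inv → less≡0 {m = m} (⇓scalar (Between.index≡ inv)) (⇓Q (Between.globals inv))
                   (≤-reflexive (trans (sym (Between.left inv)) (+-identityʳ (Between.q inv)))))
            Q (between D))
          ≤-refl (λ inv → trans (Between.output≡ inv) (cong (λ n → + ∑< n term) (trans (sym (+-identityʳ _)) (Between.left inv)))) }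
      where
      between : ∀ {m} → Doubling 0 m → Between Q m
      between {m} record { r = r ; left = left ; input = input ; radix = radix ; powers = powers
                     ; zero₁ = zero₁ ; zero₄ = zero₄ ; zero₈ = zero₈ ; zero₉ = zero₉ } = record
        { q = 0 ; left = refl
        ; globals = record { input = input ; radix = trans radix (cong +_ r≡R) ; powers = subst (λ n → PowersOf2 n (m 3)) r≡R powers }
        ; output≡ = zero₁ ; index≡ = zero₄ ; counts = λ x → zero₈ (+ x)
        ; fresh = λ a i _ → trans (zero₉ a (0ℤ ℤ.+ i)) (sym (initial-[] a i)) }
        where
        r≡R : r ≡ R
        r≡R = trans (sym (+-identityʳ r)) left
      step : ∀ {j m} → Doubling (suc j) m → eval (op less (read 3 Rᵉ) Xᵉ) m ≢ 0ℤ ×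
        Reaches M (store 3 (nat 1 ⊞ Rᵉ) (nat 2 ⊠ read 3 Rᵉ) ⨾ store 2 (nat 0) (nat 1 ⊞ Rᵉ)) m 2 (Doubling j)
      step {j} {m} record { r = r ; left = left ; input = input ; radix = radix ; powers = powers
                          ; zero₁ = zero₁ ; zero₄ = zero₄ ; zero₈ = zero₈ ; zero₉ = zero₉ } =
        less≢0 {m = m} ⇓2^r (⇓X input) (2^r<X r r<R) ,
        reach-⨾ {P = λ m′ → m′ ≡ m₁} (reach-store 3 (nat 1 ⊞ Rᵉ) (nat 2 ⊠ read 3 Rᵉ) _
          (≤-trans (≤-reflexive (cong ∣_∣ (eval≡ ⇓2^1+r))) (≤-trans (^-monoʳ-≤ 2 r<R) 2^R≤M)) refl)
        λ { refl → reach-store 2 (nat 0) (nat 1 ⊞ Rᵉ) (Doubling j)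
          (≤-trans (≤-reflexive (cong (λ z → ∣ 1ℤ ℤ.+ z ∣) radix)) (≤-trans r<R (≤-trans (<⇒≤ (n<2^n R)) 2^R≤M)))
          record { r = suc r ; left = trans (sym (+-suc r j)) left ; input = input ; radix = cong (ℤ._+_ 1ℤ) radix
                 ; powers = powers′ ; zero₁ = zero₁ ; zero₄ = zero₄ ; zero₈ = zero₈ ; zero₉ = zero₉ } }
        where
        r<R : r < R
        r<R = ≤-trans (m≤m+n (suc r) j) (≤-reflexive (trans (sym (+-suc r j)) left))
        ⇓2^r : read 3 Rᵉ ⇓[ m ] (2 ^ r)
        ⇓2^r = ⇓pow powers (⇓scalar radix) ≤-refl
        ⇓2^1+r : (nat 2 ⊠ read 3 Rᵉ) ⇓[ m ] (2 ^ suc r)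
        ⇓2^1+r = ⇓* ⇓nat ⇓2^r
        m₁ : Memory
        m₁ = m [ 3 , 1ℤ ℤ.+ m 2 0ℤ ]≔ eval (nat 2 ⊠ read 3 Rᵉ) m
        powers′ : PowersOf2 (suc r) (m₁ 3)
        powers′ i i≤1+r = trans (cong₂ (λ x y → (m [ 3 , x ]≔ y) 3 (+ i)) (cong (ℤ._+_ 1ℤ) radix) (eval≡ ⇓2^1+r)) (updated (compare≡ (suc r) i))
          where
          updated : Comparable (suc r) i → (m [ 3 , + suc r ]≔ (+ (2 ^ suc r))) 3 (+ i) ≡ + (2 ^ i)
          updated (same e refl) = cong (λ b → if b then + (2 ^ suc r) else m 3 (+ suc r)) e
          updated (other e ≢) = trans (cong (λ b → if b then + (2 ^ suc r) else m 3 (+ i)) e) (powers i (s≤s⁻¹ (≤∧≢⇒< i≤1+r (≢ ∘ sym))))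
      reach-computePowers : Reaches M computePowers (initial enc) (1 + (R * 3 + 1)) (Doubling 0)
      reach-computePowers = reach-⨾ {P = Doubling R}
        (reach-store 3 (nat 0) (nat 1) (Doubling R) (≤-trans (m^n>0 2 R) 2^R≤M) record
          { r = 0 ; left = refl ; input = λ _ → refl ; radix = refl ; powers = λ { zero z≤n → refl }
          ; zero₁ = refl ; zero₄ = refl ; zero₈ = λ _ → refl ; zero₉ = λ _ _ → refl })
        (λ D → reach-while 2 Doubling step
          (λ { {m} D → less≡0 {m = m} (⇓pow (Doubling.powers D) (⇓scalar (Doubling.radix D)) ≤-refl) (⇓X (Doubling.input D))
                 (≤-trans X≤2^R (≤-reflexive (cong (2 ^_) (trans (sym (Doubling.left D)) (+-identityʳ (Doubling.r D)))))) })
          R D)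

-- Polynomial bounds

-- No constant factor is needed: for `N ≥ 2` the exponent absorbs it, as `c ≤ 2 ^ c ≤ N ^ c`.
Polynomial : (ℕ → ℕ) → Set
Polynomial f = ∃[ e ] (∀ N → 2 ≤ N → f N ≤ N ^ e)

poly-≤ : ∀ {f g : ℕ → ℕ} → Polynomial g → (∀ N → 2 ≤ N → f N ≤ g N) → Polynomial f
poly-≤ (e , b) f≤g = e , λ N 2≤N → ≤-trans (f≤g N 2≤N) (b N 2≤N)

poly-const : ∀ c → Polynomial (λ _ → c)
poly-const c = c , λ N 2≤N → ≤-trans (<⇒≤ (n<2^n c)) (^-monoˡ-≤ c 2≤N)

poly-id : Polynomial (λ N → N)
poly-id = 1 , λ N _ → ≤-reflexive (sym (*-identityʳ N))

poly-+ : ∀ {f g : ℕ → ℕ} → Polynomial f → Polynomial g → Polynomial (λ N → f N + g N)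
poly-+ {f} {g} (x , a) (y , b) = suc x + suc y , λ N 2≤N → begin
  f N + g N              ≤⟨ +-mono-≤ (≤-trans (a N 2≤N) (step N 2≤N x)) (≤-trans (b N 2≤N) (step N 2≤N y)) ⟩
  N ^ suc x + N ^ suc y  ≤⟨ +≤* (large N 2≤N x) (large N 2≤N y) ⟩
  N ^ suc x * N ^ suc y  ≡⟨ ^-distribˡ-+-* N (suc x) (suc y) ⟨
  N ^ (suc x + suc y)    ∎
  where
  open ≤-Reasoning
  step : ∀ N → 2 ≤ N → ∀ x → N ^ x ≤ N ^ suc x
  step N 2≤N x = ^-monoʳ-≤ N {{>-nonZero (≤-trans (s≤s z≤n) 2≤N)}} (n≤1+n x)
  large : ∀ N → 2 ≤ N → ∀ x → 2 ≤ N ^ suc x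
  large N 2≤N x = ≤-trans 2≤N (m≤m*n N (N ^ x) {{m^n≢0 N x {{>-nonZero (≤-trans (s≤s z≤n) 2≤N)}}}})

poly-* : ∀ {f g : ℕ → ℕ} → Polynomial f → Polynomial g → Polynomial (λ N → f N * g N)
poly-* {f} {g} (x , a) (y , b) = x + y , λ N 2≤N →
  ≤-trans (*-mono-≤ (a N 2≤N) (b N 2≤N)) (≤-reflexive (sym (^-distribˡ-+-* N x y)))

poly-^ : ∀ {f : ℕ → ℕ} → Polynomial f → ∀ j → Polynomial (λ N → f N ^ j)
poly-^ {f} (x , a) j = x * j , λ N 2≤N → ≤-trans (^-monoˡ-≤ j (a N 2≤N)) (≤-reflexive (^-*-assoc N x j))

IsLog : ℕ → ℕ → Set
IsLog X R = X ≤ 2 ^ R × (∀ r → r < R → 2 ^ r < X)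

log : ∀ X → ∃[ R ] IsLog X R
log X = search X (<⇒≤ (n<2^n X))
  where
  search : ∀ n → X ≤ 2 ^ n → ∃[ R ] IsLog X R
  search zero    X≤ = 0 , X≤ , λ _ ()
  search (suc n) X≤ with X ≤? 2 ^ n
  ... | yes X≤′ = search n X≤′
  ... | no X≰   = suc n , X≤ , λ r r≤n → ≤-<-trans (^-monoʳ-≤ 2 (s≤s⁻¹ r≤n)) (≰⇒> X≰)

log-≤ : ∀ {X} R → 1 ≤ X → IsLog X R → 2 ^ R ≤ 2 * X
log-≤ {X} zero    1≤X _       = ≤-trans 1≤X (m≤n*m X 2)
log-≤     (suc r) _   (_ , l) = *-monoʳ-≤ 2 (<⇒≤ (l r ≤-refl))

module _ (k m A c : ℕ) where

  radixOf : ℕ → ℕ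
  radixOf N = proj₁ (log (logBound k A c N))

  radixOf-log : ∀ N → IsLog (logBound k A c N) (radixOf N)
  radixOf-log N = proj₂ (log (logBound k A c N))

  poly-2^R : Polynomial (λ N → 2 ^ radixOf N)
  poly-2^R = poly-≤
    (poly-* (poly-const 2) (poly-+ (poly-+ (poly-+ (poly-+ (poly-const 1) poly-W) (poly-* (poly-const k) poly-W)) poly-id)
                                   (poly-const (2 ^ (k * 6)))))
    (λ N _ → log-≤ (radixOf N) (s≤s z≤n) (radixOf-log N))
    where
    poly-W : Polynomial (valueBound A c)
    poly-W = poly-* (poly-const A) (poly-^ poly-id c)

  poly-R : Polynomial radixOf
  poly-R = poly-≤ poly-2^R (λ N _ → <⇒≤ (n<2^n (radixOf N)))

  abstract

    poly-padEnd : Polynomial (λ N → padStart k m (radixOf N) + N)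
    poly-padEnd = poly-+ (poly-^ (poly-* (poly-const (suc k)) (poly-+ (poly-+ poly-2^R (poly-const 3)) poly-R)) (m * 2)) poly-id

  poly-stride : ∀ w → Polynomial (stride k w)
  poly-stride w = poly-+ (poly-const 1) (poly-+ poly-H poly-H)
    where
    poly-H : Polynomial (window k w)
    poly-H = poly-+ (poly-^ (poly-+ (poly-const 2) poly-id) w)
                    (poly-+ (poly-* (poly-const k) (poly-+ (poly-const 1) poly-id)) (poly-const 1))

  -- One term for each kind of stored number: powers of 2, entries of the instances, window
  -- addresses, the number of witnesses and the input numbers.
  memoryBound : ℕ → ℕ → ℕ
  memoryBound w N = 2 ^ radixOf N + (padStart k m (radixOf N) + N) + calls k m (radixOf N) * stride k w N + N ^ k + N ^ c

  abstract

    poly-memoryBound : ∀ w → Polynomial (memoryBound w)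
    poly-memoryBound w = poly-+ (poly-+ (poly-+ (poly-+ poly-2^R poly-padEnd)
      (poly-* (poly-* (poly-^ poly-R (m * 3)) (poly-^ poly-R k)) (poly-stride w))) (poly-^ poly-id k)) (poly-^ poly-id c)

^-cancelˡ-≤ : ∀ e {x y} .{{_ : NonZero e}} → x ^ e ≤ y ^ e → x ≤ y
^-cancelˡ-≤ e {x} {y} x^e≤y^e with x ≤? y
... | yes x≤y = x≤y
... | no x≰y  = contradiction x^e≤y^e (<⇒≱ (^-monoˡ-< e (≰⇒> x≰y)))

^-distribʳ-* : ∀ n x y → (x * y) ^ n ≡ x ^ n * y ^ n
^-distribʳ-* zero    x y = refl
^-distribʳ-* (suc n) x y = trans (cong (x * y *_) (^-distribʳ-* n x y))
  (solve 4 (λ x y a b → x :* y :* (a :* b) := x :* a :* (y :* b)) refl x y (x ^ n) (y ^ n))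

-- From `x < 2 ^ x` for `x = R / b` one gets `R ≤ b * 2 ^ (R / b)`; then take the `b`-th power.
power-≤-exponential : ∀ b R → R ^ b ≤ b ^ b * 2 ^ R
power-≤-exponential zero      R = ≤-trans (m^n>0 2 R) (m≤m+n (2 ^ R) 0)
power-≤-exponential b@(suc _) R = begin
  R ^ b                          ≤⟨ ^-monoˡ-≤ b R≤ ⟩
  (b * 2 ^ (R / b)) ^ b          ≡⟨ ^-distribʳ-* b b (2 ^ (R / b)) ⟩
  b ^ b * (2 ^ (R / b)) ^ b      ≡⟨ cong (b ^ b *_) (^-*-assoc 2 (R / b) b) ⟩
  b ^ b * 2 ^ (R / b * b)        ≤⟨ *-monoʳ-≤ (b ^ b) (^-monoʳ-≤ 2 (m/n*n≤m R b)) ⟩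
  b ^ b * 2 ^ R                  ∎
  where
  open ≤-Reasoning
  R≤ : R ≤ b * 2 ^ (R / b)
  R≤ = begin
    R                    ≡⟨ m≡m%n+[m/n]*n R b ⟩
    R % b + R / b * b    ≤⟨ +-monoˡ-≤ (R / b * b) (<⇒≤ (m%n<n R b)) ⟩
    suc (R / b) * b      ≤⟨ *-monoˡ-≤ b (n<2^n (R / b)) ⟩
    2 ^ (R / b) * b      ≡⟨ *-comm (2 ^ (R / b)) b ⟩
    b * 2 ^ (R / b)      ∎

abstract

  -- Since `2 ^ R` is at most `N ^ e` rather than `N`, the `e`-th powers of both sides are compared,
  -- with `b = j * e` in `power-≤-exponential`. The successor in `e` makes the root cancellable.
  polylog : ∀ (R : ℕ → ℕ) → Polynomial (λ N → 2 ^ R N) → ∀ j → ∃[ C ] (∀ N → 2 ≤ N → R N ^ j ≤ C * N)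
  polylog R (e₀ , 2^R≤) j = b ^ b , λ N 2≤N → ^-cancelˡ-≤ e (begin
    (R N ^ j) ^ e          ≡⟨ ^-*-assoc (R N) j e ⟩
    R N ^ b                ≤⟨ power-≤-exponential b (R N) ⟩
    b ^ b * 2 ^ R N        ≤⟨ *-mono-≤ (x≤x^e (b ^ b) (1≤b^b b)) (≤-trans (2^R≤ N 2≤N)
                                (^-monoʳ-≤ N {{>-nonZero (≤-trans (s≤s z≤n) 2≤N)}} (n≤1+n e₀))) ⟩
    (b ^ b) ^ e * N ^ e    ≡⟨ ^-distribʳ-* e (b ^ b) N ⟨
    (b ^ b * N) ^ e        ∎)
    where
    open ≤-Reasoning
    e b : ℕ
    e = suc e₀
    b = j * e
    1≤b^b : ∀ b → 1 ≤ b ^ b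
    1≤b^b zero      = ≤-refl
    1≤b^b b@(suc _) = m^n>0 b b
    x≤x^e : ∀ x → 1 ≤ x → x ≤ x ^ e
    x≤x^e x 1≤x = m≤m*n x (x ^ e₀) {{m^n≢0 x e₀ {{>-nonZero 1≤x}}}}

-- Sizes of instances

size-≤∑ : ∀ {k} (f : Fin k → ℕ) → Vector.foldr _⊔_ 0 f ≤ ∑ᶠ f
size-≤∑ {zero}  f = z≤n
size-≤∑ {suc k} f = ≤-trans (m⊔n≤m+n (f zero) _) (+-monoʳ-≤ (f zero) (size-≤∑ (f ∘ suc)))

≤-size : ∀ {k} (f : Fin k → ℕ) i → f i ≤ Vector.foldr _⊔_ 0 f
≤-size f zero    = m≤m⊔n (f zero) _
≤-size f (suc i) = ≤-trans (≤-size (f ∘ suc) i) (m≤n⊔m (f zero) _)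

≤-∑ᶠ : ∀ {k} (f : Fin k → ℕ) i → f i ≤ ∑ᶠ f
≤-∑ᶠ f i = ≤-trans (≤-size f i) (size-≤∑ f)

size-const : ∀ {k} .{{_ : NonZero k}} (f : Fin k → ℕ) n → (∀ i → f i ≡ n) → Vector.foldr _⊔_ 0 f ≡ n
size-const {suc k} f n f≗n = trans (cong (_⊔ _) (f≗n zero)) (m≥n⇒m⊔n≡m (upper (f ∘ suc) (f≗n ∘ suc)))
  where
  upper : ∀ {k} (f : Fin k → ℕ) → (∀ i → f i ≡ n) → Vector.foldr _⊔_ 0 f ≤ n
  upper {zero}  f f≗n = z≤n
  upper {suc k} f f≗n = ⊔-lub (≤-reflexive (f≗n zero)) (upper (f ∘ suc) (f≗n ∘ suc))

length-choices : ∀ {k} {X : Fin k → Set} (A : ∀ i → List (X i)) n → (∀ i → length (A i) ≤ n) →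
                 length (choices A) ≤ n ^ k
length-choices {zero}  A n A≤ = ≤-refl
length-choices {suc k} A n A≤ = ≤-trans
  (≤-reflexive (length-product _ (A zero) (choices (A ∘ suc))))
  (*-mono-≤ (A≤ zero) (length-choices (A ∘ suc) n (A≤ ∘ suc)))
  where
  length-product : ∀ {A B C : Set} (f : A → B → C) xs ys →
                   length (List.cartesianProductWith f xs ys) ≡ length xs * length ys
  length-product f []       ys = refl
  length-product f (x ∷ xs) ys = trans (length-++ (map (f x) ys))
    (cong₂ _+_ (length-map (f x) ys) (length-product f xs ys))

norm : ∀ {n} → Vec ℤ n → ℕ
norm []       = 0
norm (α ∷ αs) = ∣ α ∣ + norm αs

∣dot∣-≤ : ∀ {n} U (αs xs : Vec ℤ n) → All (λ z → ∣ z ∣ ≤ U) (Vec.toList xs) → ∣ dot αs xs ∣ ≤ norm αs * U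
∣dot∣-≤ U []       []       []       = z≤n
∣dot∣-≤ U (α ∷ αs) (x ∷ xs) (p ∷ ps) = begin
  ∣ α ℤ.* x ℤ.+ dot αs xs ∣      ≤⟨ ℤ.∣i+j∣≤∣i∣+∣j∣ (α ℤ.* x) (dot αs xs) ⟩
  ∣ α ℤ.* x ∣ + ∣ dot αs xs ∣    ≤⟨ +-mono-≤ (≤-trans (≤-reflexive (ℤ.abs-* α x)) (*-monoʳ-≤ ∣ α ∣ p)) (∣dot∣-≤ U αs xs ps) ⟩
  ∣ α ∣ * U + norm αs * U        ≡⟨ *-distribʳ-+ U ∣ α ∣ (norm αs) ⟨
  (∣ α ∣ + norm αs) * U          ∎
  where open ≤-Reasoning

module _ {k : ℕ} {d : Fin k → ℕ} {l : ℕ} where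

  atomNorm : Atom d l → ℕ
  atomNorm (atom α β _ γ) = ∑ᶠ (norm ∘ α) + (∣ γ ∣ + norm β)

  formulaNorm : List (Atom d l) → ℕ
  formulaNorm as = ∑ as atomNorm

  atomNorm-≤ : ∀ {a as} → a ∈ as → atomNorm a ≤ formulaNorm as
  atomNorm-≤ {as = _ ∷ as} (here refl) = m≤m+n _ (formulaNorm as)
  atomNorm-≤ {as = b ∷ as} (there a∈)  = ≤-trans (atomNorm-≤ a∈) (m≤n+m _ (atomNorm b))

  element-bound : ∀ U {a as i} {x : Vec ℤ (d i)} → a ∈ as → All (λ z → ∣ z ∣ ≤ U) (Vec.toList x) →
                  ∣ dot (Atom.coefficients a i) x ∣ ≤ formulaNorm as * U
  element-bound U {a@(atom α β r γ)} {as} {i} {x} a∈ x≤ = ≤-trans (∣dot∣-≤ U (α i) x x≤)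
    (*-monoˡ-≤ U (≤-trans (≤-trans (≤-∑ᶠ (norm ∘ α) i) (m≤m+n _ (∣ γ ∣ + norm β))) (atomNorm-≤ a∈)))

  threshold-bound : ∀ U {a as} {t : Vec ℤ l} → 1 ≤ U → a ∈ as → All (λ z → ∣ z ∣ ≤ U) (Vec.toList t) →
                    ThresholdBound (formulaNorm as * U) t a
  threshold-bound U {a@(atom α β r γ)} {as} {t} 1≤U a∈ t≤ = begin
    ∣ γ ℤ.- dot β t ∣             ≤⟨ ℤ.∣i-j∣≤∣i∣+∣j∣ γ (dot β t) ⟩
    ∣ γ ∣ + ∣ dot β t ∣           ≤⟨ +-mono-≤ (m≤m*n ∣ γ ∣ U {{>-nonZero 1≤U}}) (∣dot∣-≤ U β t t≤) ⟩
    ∣ γ ∣ * U + norm β * U        ≡⟨ *-distribʳ-+ U ∣ γ ∣ (norm β) ⟨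
    (∣ γ ∣ + norm β) * U          ≤⟨ *-monoˡ-≤ U (≤-trans (m≤n+m _ (∑ᶠ (norm ∘ α))) (atomNorm-≤ a∈)) ⟩
    formulaNorm as * U            ∎
    where open ≤-Reasoning

-- Time

maximum< : ℕ → (ℕ → ℕ) → ℕ
maximum< zero    f = 0
maximum< (suc n) f = f n ⊔ maximum< n f

≤-maximum< : ∀ n f {i} → i < n → f i ≤ maximum< n f
≤-maximum< (suc n) f {i} i<1+n with i ≟ n
... | yes refl = m≤m⊔n (f n) _
... | no i≢n   = ≤-trans (≤-maximum< n f (≤∧≢⇒< (s≤s⁻¹ i<1+n) i≢n)) (m≤n⊔m (f n) _)

-- A maximum is one of the values, or 0 on the empty range. In this way the time bound of the single
-- calls passes to the slowest one.
maximum<-closed : (P : ℕ → Set) → P 0 → ∀ n f → (∀ i → i < n → P (f i)) → P (maximum< n f)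
maximum<-closed P P0 zero    f Pf = P0
maximum<-closed P P0 (suc n) f Pf with ⊔-sel (f n) (maximum< n f)
... | inj₁ e = subst P (sym e) (Pf n ≤-refl)
... | inj₂ e = subst P (sym e) (maximum<-closed P P0 n f (λ i i<n → Pf i (m≤n⇒m≤1+n i<n)))

-- The 14 is 3 + 3 + 8: constant steps, the doubling loop by `R ≤ Q`, and the overhead of a call.
-- The 24 is the 12 of `setTime`, doubled because `suc N ≤ N + N`.
program-time : ∀ k R Q N τ → 1 ≤ N → 1 ≤ Q → R ≤ Q →
  1 + (R * 3 + 1) + (Q * suc (1 + (1 + (k * setTime N + 1 + (2 + (τ + (1 + 1)))))) + 1)
  ≤ Q * ((14 + k * 24) * (N + τ))
program-time k R Q N τ 1≤N 1≤Q R≤Q = begin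
  1 + (R * 3 + 1) + (Q * suc (1 + (1 + (k * setTime N + 1 + (2 + (τ + (1 + 1)))))) + 1)
    ≡⟨ solve 5 (λ R Q k s τ → con 1 :+ (R :* con 3 :+ con 1) :+
         (Q :* (con 1 :+ (con 1 :+ (con 1 :+ (k :* s :+ con 1 :+ (con 2 :+ (τ :+ (con 1 :+ con 1))))))) :+ con 1)
         := con 3 :+ R :* con 3 :+ Q :* (con 8 :+ k :* s :+ τ)) refl R Q k (setTime N) τ ⟩
  3 + R * 3 + Q * (8 + k * setTime N + τ)
    ≤⟨ +-monoˡ-≤ _ (+-mono-≤ (*-monoʳ-≤ 3 1≤Q) (*-monoˡ-≤ 3 R≤Q)) ⟩
  3 * Q + Q * 3 + Q * (8 + k * setTime N + τ)
    ≡⟨ solve 4 (λ Q k s τ → con 3 :* Q :+ Q :* con 3 :+ Q :* (con 8 :+ k :* s :+ τ)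
         := Q :* (con 14 :+ k :* s :+ τ)) refl Q k (setTime N) τ ⟩
  Q * (14 + k * setTime N + τ)
    ≤⟨ *-monoʳ-≤ Q (+-mono-≤ (+-mono-≤ (*-monoʳ-≤ 14 1≤N) (*-monoʳ-≤ k (*-monoʳ-≤ 12 (+-monoˡ-≤ N 1≤N)))) (≤-refl {τ})) ⟩
  Q * (14 * N + k * (12 * (N + N)) + τ)
    ≤⟨ *-monoʳ-≤ Q (+-monoʳ-≤ (14 * N + k * (12 * (N + N))) (m≤n*m τ (14 + k * 24))) ⟩
  Q * (14 * N + k * (12 * (N + N)) + (14 + k * 24) * τ)
    ≡⟨ cong (_*_ Q) (solve 3 (λ N k τ → con 14 :* N :+ k :* (con 12 :* (N :+ N)) :+ (con 14 :+ k :* con 24) :* τ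
         := (con 14 :+ k :* con 24) :* (N :+ τ)) refl N k τ) ⟩
  Q * ((14 + k * 24) * (N + τ)) ∎
  where open ≤-Reasoning

-- The exponent saving p / q of the given algorithm becomes 1 / 2q; the remaining
-- factor N ^ (1 / 2q) pays for the polylogarithmic number of calls.
final-bound : ∀ k h q p {T Q n N τ C C₂} → 2 ≤ h → 1 ≤ q → 1 ≤ p → 1 ≤ N → n ≤ N → N ≤ (2 + k) * n →
  T ≤ Q * ((14 + k * 24) * (N + τ)) → Q ^ (q + q) ≤ C₂ * N → τ ^ q * N ^ p ≤ C * N ^ (h * q) →
  T ^ (q + q) * n ^ 1 ≤
    C₂ * (14 + k * 24) ^ (q + q) * (2 ^ (q + q) * (1 + C * C)) * (2 + k) ^ (h * (q + q)) * n ^ (h * (q + q))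
final-bound k h q p {T} {Q} {n} {N} {τ} {C} {C₂} 2≤h 1≤q 1≤p 1≤N n≤N N≤ T≤ Q≤ τ≤ = begin
  T ^ D * n ^ 1                    ≤⟨ *-mono-≤ (^-monoˡ-≤ D T≤) (≤-trans (≤-reflexive (*-identityʳ n)) n≤N) ⟩
  (Q * (K * (N + τ))) ^ D * N      ≤⟨ *-cancelʳ-≤ _ _ N squared ⟩
  C₂ * K ^ D * C₃ * N ^ (h * D)    ≤⟨ *-monoʳ-≤ (C₂ * K ^ D * C₃) (≤-trans (^-monoˡ-≤ (h * D) N≤)
                                        (≤-reflexive (^-distribʳ-* (h * D) (2 + k) n))) ⟩
  C₂ * K ^ D * C₃ * ((2 + k) ^ (h * D) * n ^ (h * D))
                                   ≡⟨ *-assoc (C₂ * K ^ D * C₃) _ _ ⟨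
  C₂ * K ^ D * C₃ * (2 + k) ^ (h * D) * n ^ (h * D) ∎
  where
  open ≤-Reasoning
  D K C₃ : ℕ
  D = q + q
  K = 14 + k * 24
  C₃ = 2 ^ D * (1 + C * C)
  instance
    _ = >-nonZero 1≤N
  -- Of the saving `N ^ p` a single factor `N` is kept.
  τ^q*N≤ : τ ^ q * N ≤ C * N ^ (h * q)
  τ^q*N≤ = ≤-trans (*-monoʳ-≤ (τ ^ q) (≤-trans (≤-reflexive (sym (*-identityʳ N))) (^-monoʳ-≤ N 1≤p))) τ≤
  square : ∀ x → x ^ D ≡ x ^ q * x ^ q
  square x = ^-distribˡ-+-* x q q
  h-split : h * D ≡ h * q + h * q
  h-split = *-distribˡ-+ h q q
  2+D≤hD : D + 2 ≤ h * D
  2+D≤hD = begin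
    D + 2      ≤⟨ +-monoʳ-≤ D (+-mono-≤ 1≤q 1≤q) ⟩
    D + D      ≡⟨ cong (_+_ D) (+-identityʳ D) ⟨
    2 * D      ≤⟨ *-monoˡ-≤ D 2≤h ⟩
    h * D      ∎
  sum-bound : (N + τ) ^ D * (N * N) ≤ C₃ * N ^ (h * D)
  -- If `τ ≤ N`, writing the instances dominates and `2 ≤ h` leaves room for the factor `N * N`.
  -- Otherwise the calls dominate, and the bound on `τ ^ q` is squared.
  sum-bound with ≤-total τ N
  ... | inj₁ τ≤N = begin
    (N + τ) ^ D * (N * N)
      ≤⟨ *-monoˡ-≤ (N * N) (^-monoˡ-≤ D (≤-trans (+-monoʳ-≤ N τ≤N) (≤-reflexive (cong (_+_ N) (sym (+-identityʳ N)))))) ⟩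
    (2 * N) ^ D * (N * N)
      ≡⟨ cong₂ _*_ (^-distribʳ-* D 2 N) (cong (_*_ N) (sym (*-identityʳ N))) ⟩
    2 ^ D * N ^ D * N ^ 2
      ≡⟨ trans (*-assoc (2 ^ D) (N ^ D) (N ^ 2)) (cong (_*_ (2 ^ D)) (sym (^-distribˡ-+-* N D 2))) ⟩
    2 ^ D * N ^ (D + 2)
      ≤⟨ *-mono-≤ (m≤m*n (2 ^ D) (1 + C * C)) (^-monoʳ-≤ N 2+D≤hD) ⟩
    C₃ * N ^ (h * D) ∎
  ... | inj₂ N≤τ = begin
    (N + τ) ^ D * (N * N)
      ≤⟨ *-monoˡ-≤ (N * N) (^-monoˡ-≤ D (≤-trans (+-monoˡ-≤ τ N≤τ) (≤-reflexive (cong (_+_ τ) (sym (+-identityʳ τ)))))) ⟩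
    (2 * τ) ^ D * (N * N)
      ≡⟨ cong (_* (N * N)) (trans (^-distribʳ-* D 2 τ) (cong (_*_ (2 ^ D)) (square τ))) ⟩
    2 ^ D * (τ ^ q * τ ^ q) * (N * N)
      ≡⟨ solve 3 (λ a t N → a :* (t :* t) :* (N :* N) := a :* ((t :* N) :* (t :* N))) refl (2 ^ D) (τ ^ q) N ⟩
    2 ^ D * ((τ ^ q * N) * (τ ^ q * N))
      ≤⟨ *-monoʳ-≤ (2 ^ D) (*-mono-≤ τ^q*N≤ τ^q*N≤) ⟩
    2 ^ D * ((C * N ^ (h * q)) * (C * N ^ (h * q)))
      ≡⟨ solve 3 (λ a c x → a :* ((c :* x) :* (c :* x)) := a :* (c :* c) :* (x :* x)) refl (2 ^ D) C (N ^ (h * q)) ⟩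
    2 ^ D * (C * C) * (N ^ (h * q) * N ^ (h * q))
      ≡⟨ cong (_*_ (2 ^ D * (C * C))) (trans (cong (N ^_) h-split) (^-distribˡ-+-* N (h * q) (h * q))) ⟨
    2 ^ D * (C * C) * N ^ (h * D)
      ≤⟨ *-monoˡ-≤ (N ^ (h * D)) (*-monoʳ-≤ (2 ^ D) (n≤1+n (C * C))) ⟩
    C₃ * N ^ (h * D) ∎
  -- One factor `N` on the left becomes the saving in the conclusion; the other is matched by the
  -- `N` on the right, which comes from `Q ^ D ≤ C₂ * N`.
  squared : (Q * (K * (N + τ))) ^ D * N * N ≤ C₂ * K ^ D * C₃ * N ^ (h * D) * N
  squared = begin
    (Q * (K * (N + τ))) ^ D * N * N
      ≡⟨ cong (λ x → x * N * N) (trans (^-distribʳ-* D Q (K * (N + τ))) (cong (_*_ (Q ^ D)) (^-distribʳ-* D K (N + τ)))) ⟩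
    Q ^ D * (K ^ D * (N + τ) ^ D) * N * N
      ≡⟨ solve 4 (λ a b c N → a :* (b :* c) :* N :* N := a :* b :* (c :* (N :* N))) refl (Q ^ D) (K ^ D) ((N + τ) ^ D) N ⟩
    Q ^ D * K ^ D * ((N + τ) ^ D * (N * N))
      ≤⟨ *-mono-≤ (*-monoˡ-≤ (K ^ D) Q≤) sum-bound ⟩
    C₂ * N * K ^ D * (C₃ * N ^ (h * D))
      ≡⟨ solve 5 (λ a N b c x → a :* N :* b :* (c :* x) := a :* b :* c :* x :* N) refl C₂ N (K ^ D) C₃ (N ^ (h * D)) ⟩
    C₂ * K ^ D * C₃ * N ^ (h * D) * N ∎

abstract

  wordExponent : ℕ → ℕ → ℕ → ℕ
  wordExponent k μ ω = suc k * μ * ω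

  -- The base is `2 + n` because `n` may be 0. The factor between `N` and `2 + n` is at most
  -- `suc k ≤ 2 ^ k ≤ (2 + n) ^ k`, hence the exponent `suc k`.
  word-bound : ∀ k μ ω {M N n} → M ≤ N ^ μ → N ≤ 2 + k * n → M ^ ω ≤ (2 + n) ^ wordExponent k μ ω
  word-bound k μ ω {M} {N} {n} M≤ N≤ = begin
    M ^ ω                          ≤⟨ ^-monoˡ-≤ ω (≤-trans M≤ (^-monoˡ-≤ μ N≤[2+n]^[1+k])) ⟩
    (((2 + n) ^ suc k) ^ μ) ^ ω    ≡⟨ cong (_^ ω) (^-*-assoc (2 + n) (suc k) μ) ⟩
    ((2 + n) ^ (suc k * μ)) ^ ω    ≡⟨ ^-*-assoc (2 + n) (suc k * μ) ω ⟩
    (2 + n) ^ (suc k * μ * ω)      ∎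
    where
    open ≤-Reasoning
    N≤[2+n]^[1+k] : N ≤ (2 + n) ^ suc k
    N≤[2+n]^[1+k] = begin
      N                        ≤⟨ N≤ ⟩
      2 + k * n                ≤⟨ +-mono-≤ (m≤m+n 2 n) (*-monoʳ-≤ k (m≤n+m n 2)) ⟩
      suc k * (2 + n)          ≤⟨ *-monoˡ-≤ (2 + n) (n<2^n k) ⟩
      2 ^ k * (2 + n)          ≤⟨ *-monoˡ-≤ (2 + n) (^-monoˡ-≤ k (m≤m+n 2 n)) ⟩
      (2 + n) ^ k * (2 + n)    ≡⟨ *-comm ((2 + n) ^ k) (2 + n) ⟩
      (2 + n) ^ suc k          ∎

-- The counting program on an instance

nth-small : ∀ {M xs} → All (λ z → ∣ z ∣ ≤ M) xs → ∀ j → ∣ nth xs j ∣ ≤ M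
nth-small []       j       = z≤n
nth-small (p ∷ ps) zero    = p
nth-small (p ∷ ps) (suc j) = nth-small ps j

initial-small : ∀ {M xs} → All (λ z → ∣ z ∣ ≤ M) xs → Small M (initial xs)
initial-small ps zero    (+ j)    = nth-small ps j
initial-small ps zero    -[1+ j ] = z≤n
initial-small ps (suc a) i        = z≤n

module CountingProgram {k h : ℕ} .{{_ : NonZero k}} (2≤h : 2 ≤ h) {ε : ℚ} (1≤p : 1 ≤ ∣ ↥ ε ∣)
            (hyp : CountableInTime (kSUM k) h ε) (φ : ∃Formula k) (c : ℕ) where

  open ∃Formula φ

  m A c′ w C n₀ : ℕ
  m = length (atoms ψ)
  A = formulaNorm (atoms ψ)
  -- The numbers in the calls are at most `Z + N ≤ N ^ c′`, so the hypothesis is used for the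
  -- universe exponent `c′`. This changes the called program and its constants, but not the exponent
  -- of its running time.
  c′ = proj₁ (poly-padEnd k m A c)
  p : Program
  p = proj₁ (hyp c′)
  w = proj₁ (proj₂ (hyp c′))
  C = proj₁ (proj₂ (proj₂ (hyp c′)))
  n₀ = proj₁ (proj₂ (proj₂ (proj₂ (hyp c′))))

  open Reduced ψ A c w p public using (program)

  μ w′ q : ℕ
  μ = proj₁ (poly-memoryBound k m A c w)
  w′ = wordExponent k μ (programWeight program)
  q = ↧ₙ ε

  calls-bound : ∃[ C₂ ] (∀ N → 2 ≤ N → radixOf k m A c N ^ ((m * 3 + k) * (q + q)) ≤ C₂ * N)
  calls-bound = polylog (radixOf k m A c) (poly-2^R k m A c) ((m * 3 + k) * (q + q))

  C₂ C′ : ℕ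
  C₂ = proj₁ calls-bound
  C′ = C₂ * (14 + k * 24) ^ (q + q) * (2 ^ (q + q) * (1 + C * C)) * (2 + k) ^ (h * (q + q))

  module OnInstance (I : WitnessProblem.Instance (FOPℤ φ)) where

    open WitnessProblem.Instance I renaming (size to n)

    module _ (universe : InUniverse (n ^ c)) where

      N R M : ℕ
      N = 2 + ∑ᶠ (length ∘ set)
      R = radixOf k m A c N
      M = memoryBound k m A c w N

      len≤n : ∀ i → length (set i) ≤ n
      len≤n = ≤-size (length ∘ set)

      len≤N : ∀ i → length (set i) ≤ N
      len≤N i = ≤-trans (≤-∑ᶠ (length ∘ set) i) (m≤n+m _ 2)

      2≤N : 2 ≤ N
      2≤N = m≤m+n 2 _

      n≤N : n ≤ N
      n≤N = ≤-trans (size-≤∑ (length ∘ set)) (m≤n+m _ 2)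

      N≤2+kn : N ≤ 2 + k * n
      N≤2+kn = +-monoʳ-≤ 2 (∑ᶠ-≤ n len≤n)

      instance
        N-nonZero : NonZero N
        N-nonZero = >-nonZero (≤-trans (s≤s z≤n) 2≤N)

      U≤ : ∀ {xs} → All (λ z → ∣ z ∣ ≤ n ^ c) xs → All (λ z → ∣ z ∣ ≤ N ^ c) xs
      U≤ = All.map (λ z≤ → ≤-trans z≤ (^-monoˡ-≤ c n≤N))

      set-numbers : ∀ i → All (λ z → ∣ z ∣ ≤ N ^ c) (concatMap Vec.toList (set i))
      set-numbers i = U≤ (All.tabulate⁻ (All.concat⁻ (All.++⁻ˡ (concat (tabulate (λ i → concatMap Vec.toList (set i)))) universe)) i)

      param-numbers : All (λ z → ∣ z ∣ ≤ N ^ c) (Vec.toList params)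
      param-numbers = U≤ (All.++⁻ʳ (concat (tabulate (λ i → concatMap Vec.toList (set i)))) universe)

      X≤2^R : logBound k A c N ≤ 2 ^ R
      X≤2^R = proj₁ (radixOf-log k m A c N)

      6k<R : k * 6 < R
      6k<R = ≰⇒> (λ R≤6k → <⇒≱ (≤-trans (s≤s (m≤n+m (2 ^ (k * 6)) _)) X≤2^R) (^-monoʳ-≤ 2 R≤6k))

      2^R≤M : 2 ^ R ≤ M
      2^R≤M = ≤-trans (≤-trans (m≤m+n (2 ^ R) _) (m≤m+n _ _)) (≤-trans (m≤m+n _ (N ^ k)) (m≤m+n _ (N ^ c)))

      Z+N≤M : padStart k m R + N ≤ M
      Z+N≤M = ≤-trans (≤-trans (m≤n+m _ (2 ^ R)) (m≤m+n _ _)) (≤-trans (m≤m+n _ (N ^ k)) (m≤m+n _ (N ^ c)))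

      QS≤M : calls k m R * stride k w N ≤ M
      QS≤M = ≤-trans (m≤n+m _ (2 ^ R + (padStart k m R + N))) (≤-trans (m≤m+n _ (N ^ k)) (m≤m+n _ (N ^ c)))

      N^k≤M : N ^ k ≤ M
      N^k≤M = ≤-trans (m≤n+m (N ^ k) _) (m≤m+n _ (N ^ c))

      N^c≤M : N ^ c ≤ M
      N^c≤M = m≤n+m (N ^ c) _

      N≤M : N ≤ M
      N≤M = ≤-trans (m≤n+m N (padStart k m R)) Z+N≤M

      elements : ∀ i {x} → x ∈ set i → All (λ a → ∣ dot (Atom.coefficients a i) x ∣ ≤ valueBound A c N) (atoms ψ)
      elements i {x} x∈ = All.tabulate (λ a∈ → element-bound (N ^ c) a∈
        (All.lookup (All.map⁻ (All.concat⁻ (set-numbers i))) x∈))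

      param-bounds : All (ThresholdBound (valueBound A c N) params) (atoms ψ)
      param-bounds = All.tabulate (λ a∈ → threshold-bound (N ^ c) (m^n>0 N c) a∈ param-numbers)

      module Correct = Correctness ψ A c w p set params N R M refl X≤2^R
        (proj₂ (radixOf-log k m A c N)) 6k<R len≤N elements param-bounds 2^R≤M Z+N≤M QS≤M

      open Correct using (certificate; bits; term; encodingOf; kSUM-instance; count; T; T<Z; Q; Z; paddedSet;
        padded-length; values; values-<; 1≤Q; #witnesses-sum; #witnesses-instance; R-nonZero)

      inst : ℕ → WitnessProblem.Instance (kSUM k)
      inst i = kSUM-instance (certificate i) (bits i)

      -- The purpose of padding: whatever the certificate and bits, the universe condition and the
      -- time bound of the hypothesis refer to the same `N`.
      size≡ : ∀ i → WitnessProblem.Instance.size (inst i) ≡ N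
      size≡ i = size-const _ N (λ j → trans (length-map +_ (paddedSet i j)) (padded-length i j))

      inst-universe : ∀ i → WitnessProblem.Instance.InUniverse (inst i) (N ^ c′)
      inst-universe i = All.++⁺ (All.concat⁺ (All.tabulate⁺ λ j →
          subst (All (λ z → ∣ z ∣ ≤ N ^ c′)) (sym (concat-map-[_] (map +_ (paddedSet i j))))
            (All.map⁺ (All.map (λ y≤ → ≤-trans y≤ (≤-trans (+-monoʳ-≤ Z (≤-reflexive (m+[n∸m]≡n (vs≤N j)))) Z+N≤))
              (slots-bound Z _ _ 0 (values (certificate i) j) _ (values-< (certificate i) j))))))
        (≤-trans (<⇒≤ (T<Z (certificate i) (digits-< R {{R-nonZero}} (m * 3) i))) (≤-trans (m≤m+n Z N) Z+N≤) ∷ [])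
        where
        vs≤N : ∀ j → length (values (certificate i) j) ≤ N
        vs≤N j = ≤-trans (≤-reflexive (length-map _ (set j))) (len≤N j)
        Z+N≤ : Z + N ≤ N ^ c′
        Z+N≤ = proj₂ (poly-padEnd k m A c) N 2≤N

      call : ∀ i → ∃[ s ] ∃[ μ ] Run ((2 + N) ^ w) p (initial (encodingOf i)) s μ ×
             output μ ≡ + count (certificate i) (bits i) × (n₀ ≤ N → Bound s C N h ε)
      call i = transport (size≡ i) (proj₂ (proj₂ (proj₂ (proj₂ (hyp c′)))) (inst i)
          (subst (λ s → WitnessProblem.Instance.InUniverse (inst i) (s ^ c′)) (sym (size≡ i)) (inst-universe i)))
        where
        transport : ∀ {x} → x ≡ N →
          (∃[ s ] ∃[ μ ] Run ((2 + x) ^ w) p (initial (encodingOf i)) s μ ×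
             output μ ≡ + WitnessProblem.Instance.#witnesses (inst i) × (n₀ ≤ x → Bound s C x h ε)) →
          ∃[ s ] ∃[ μ ] Run ((2 + N) ^ w) p (initial (encodingOf i)) s μ ×
             output μ ≡ + count (certificate i) (bits i) × (n₀ ≤ N → Bound s C N h ε)
        transport refl (s , μ , run , out , bound) = s , μ , run ,
          trans out (cong +_ (#witnesses-instance (certificate i) (bits i))) , bound

      τ : ℕ
      τ = maximum< Q (λ i → proj₁ (call i))

      total≤M : ∑< Q term ≤ M
      total≤M = ≤-trans (≤-reflexive (sym #witnesses-sum)) (≤-trans (length-filter (λ a → satisfies? ψ a params) (choices set))
        (≤-trans (length-choices set N len≤N) N^k≤M))

      calls-correct : ∀ i → i < Q → ∃[ s ] ∃[ μ ] Run ((2 + N) ^ w) p (initial (encodingOf i)) s μ × s ≤ τ ×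
                      output μ ≡ + count (certificate i) (bits i)
      calls-correct i i<Q = let (s , μ , run , out , _) = call i in
        s , μ , run , ≤-maximum< Q (λ i → proj₁ (call i)) i<Q , out

      open Correct.Loop τ calls-correct total≤M using (reach-program)

      input-small : Small M (initial encoding)
      input-small = initial-small (All.++⁺ (All.concat⁺ (All.tabulate⁺ λ i →
          ≤-trans (len≤N i) N≤M ∷ All.map (λ z≤ → ≤-trans z≤ N^c≤M) (set-numbers i)))
        (All.map (λ z≤ → ≤-trans z≤ N^c≤M) param-numbers))

      M≤ : M ^ programWeight program ≤ (2 + n) ^ w′
      M≤ = word-bound k μ (programWeight program) {M} {N} {n} (proj₂ (poly-memoryBound k m A c w) N 2≤N) N≤2+kn

      R≤Q : R ≤ Q
      R≤Q = ≤-trans (≤-trans (≤-reflexive (sym (*-identityʳ R))) (^-monoʳ-≤ R {{R-nonZero}} (>-nonZero⁻¹ k)))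
                    (m≤n*m (R ^ k) (R ^ (m * 3)) {{m^n≢0 R (m * 3) {{R-nonZero}}}})

      Q≤ : Q ^ (q + q) ≤ C₂ * N
      Q≤ = ≤-trans (≤-reflexive (trans (cong (_^ (q + q)) (sym (^-distribˡ-+-* R (m * 3) k)))
        (^-*-assoc R (m * 3 + k) (q + q)))) (proj₂ calls-bound N 2≤N)

      τ-bound : n₀ ≤ N → Bound τ C N h ε
      τ-bound n₀≤N = maximum<-closed (λ s → Bound s C N h ε) z≤n Q (λ i → proj₁ (call i))
        (λ i _ → proj₂ (proj₂ (proj₂ (proj₂ (call i)))) n₀≤N)

      N≤[2+k]n : 1 ≤ n → N ≤ (2 + k) * n
      N≤[2+k]n 1≤n = ≤-trans N≤2+kn (≤-trans (+-monoˡ-≤ (k * n) (*-monoʳ-≤ 2 1≤n))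
        (≤-reflexive (sym (*-distribʳ-+ n 2 k))))

      -- The threshold is `suc n₀` because `N ≤ (2 + k) * n` requires `n ≥ 1`.
      countable : ∃[ t ] ∃[ m′ ] Run ((2 + n) ^ w′) program (initial encoding) t m′ × output m′ ≡ + #witnesses ×
               (suc n₀ ≤ n → t ^ (q + q) * n ^ 1 ≤ C′ * n ^ (h * (q + q)))
      countable = let reaches {t} {m′} ex t≤ out = reach-program in
        t , m′ , proj₁ (exec⇒run (≤-trans 2≤N N≤M) input-small M≤ ex) ,
        trans out (cong +_ (sym #witnesses-sum)) ,
        λ n₀<n → final-bound k h q ∣ ↥ ε ∣ {t} {Q} {n} {N} {τ} {C} {C₂} 2≤h (s≤s z≤n) 1≤p (≤-trans (s≤s z≤n) 2≤N) n≤N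
          (N≤[2+k]n (≤-trans (s≤s z≤n) n₀<n))
          (≤-trans t≤ (program-time k R Q N τ (≤-trans (s≤s z≤n) 2≤N) 1≤Q R≤Q)) Q≤
          (τ-bound (≤-trans (<⇒≤ n₀<n) n≤N))

-- For `ε = p / q` this is `1 / 2q`. A rational stores its denominator minus 1, and with this choice
-- the denominator computes to `q + q`.
halved : ℚ → ℚ
halved ε = mkℚ (+ 1) (ℚ.denominator-1 ε + suc (ℚ.denominator-1 ε)) (1-coprimeTo _)

theorem2 : ∀ (k : ℕ) → k ≥ 3 → 2 ∤ k →
    (∃[ ε ] ε ℚ.> 0ℚ × CountableInTime (kSUM k) ⌈ k /2⌉ ε) →
    ∀ (φ : ∃Formula k) →
    ∃[ ε′ ] ε′ ℚ.> 0ℚ × CountableInTime (FOPℤ φ) ⌈ k /2⌉ ε′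
theorem2 k@(suc _) 3≤k _ (ε , ε>0 , hyp) φ =
  -- The new saving is fixed before the universe exponent `c`, on which only the program and the
  -- constants depend.
  halved ε , ℚ.*<* (ℤ.+<+ (s≤s z≤n)) , λ c →
    Solution.program c , Solution.w′ c , Solution.C′ c , suc (Solution.n₀ c) , Solution.OnInstance.countable c
  where
  1≤p : ∀ ε → ε ℚ.> 0ℚ → 1 ≤ ∣ ↥ ε ∣
  1≤p (mkℚ (+ suc _) _ _) _ = s≤s z≤n
  1≤p (mkℚ (+ zero) _ _)  (ℚ.*<* (ℤ.+<+ ()))
  1≤p (mkℚ -[1+ _ ] _ _)  (ℚ.*<* ())
  -- As `⌈ 3 /2⌉` computes to 2, monotonicity gives `2 ≤ ⌈ k /2⌉`.
  module Solution (c : ℕ) = CountingProgram (⌈n/2⌉-mono 3≤k) {ε} (1≤p ε ε>0) hyp φ c
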